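{- Let $K$ be any quadratic field and let $E$ be the elliptic curve $y^2 = x^3 + 1$. Then the torsion subgroup $E(K)_{tors}$ of the group $E(K)$ of $K$-rational points of $E$ is isomorphic to one of $\mathbb{Z}/6\mathbb{Z}$, $\mathbb{Z}/18\mathbb{Z}$, or $\mathbb{Z}/2\mathbb{Z} \oplus \mathbb{Z}/6\mathbb{Z}$.
   Context: A quadratic field is a field extension of $\mathbb{Q}$ of degree $2$. $E(K)$ consists of the affine points $(x,y) \in K^2$ satisfying the equation together with the point at infinity $\mathcal{O}$, which is the identity of the group law. -}

module Defs where

open import Level using (Level; _⊔_; suc)
open import Algebra.Bundles using (CommutativeRing; RawGroup)
open import Algebra.Definitions using (Invertible)
open import Algebra.Definitions.RawMonoid using (sum)
import Algebra.Definitions.RawMonoid as RawMonoidDefinitions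
open import Algebra.Morphism.Structures using (IsRingHomomorphism; IsGroupIsomorphism)
open import Algebra.Solver.Ring.AlmostCommutativeRing
  using (fromCommutativeRing; _-Raw-AlmostCommutative⟶_)
import Algebra.Solver.Ring as RingSolver
import Algebra.Properties.Ring as RingProperties
open import Data.Fin.Base using (Fin)
open import Data.Fin.Properties using (all?)
open import Data.Integer.Base as ℤ using (ℤ)
import Data.Integer.Divisibility as ℤ
open import Data.Maybe.Base as Maybe using (Maybe)
open import Data.Nat.Base using (ℕ; NonZero)
open import Data.Product.Base using (Σ; ∃; ∃-syntax; _×_; _,_; proj₁; proj₂)
open import Data.Rational.Base as ℚ using (ℚ; 0ℚ)
import Data.Rational.Properties as ℚ
open import Data.Vec.Functional using (Vector)
open import Function.Base using (_on_)
open import Relation.Binary.Consequences using (dec⇒weaklyDec)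
open import Relation.Binary.Definitions using (Decidable)
open import Relation.Binary.PropositionalEquality.Core as ≡ using (_≡_)
open import Relation.Nullary using (¬_; yes; no)
open import Relation.Nullary.Decidable using (map′)
import Relation.Binary.Reasoning.Setoid as SetoidReasoning

------------------------------------------------------------------------
-- Fields, and extensions of ℚ of finite degree

record IsField {c ℓ} (R : CommutativeRing c ℓ) : Set (c ⊔ ℓ) where
  open CommutativeRing R
  field
    0≉1        : ¬ (0# ≈ 1#)
    invertible : ∀ x → ¬ (x ≈ 0#) → Invertible _≈_ 1# _*_ x

record FieldExtensionOfℚ c ℓ : Set (suc (c ⊔ ℓ)) where
  field
    commutativeRing : CommutativeRing c ℓ
    isField         : IsField commutativeRing
  open CommutativeRing commutativeRing public
  open IsField isField public
  field
    ι                    : ℚ → Carrier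
    ι-isRingHomomorphism : IsRingHomomorphism ℚ.+-*-rawRing rawRing ι

  linearCombination : ∀ {n} → Vector ℚ n → Vector Carrier n → Carrier
  linearCombination a b = sum +-rawMonoid (λ i → ι (a i) * b i)

  record IsBasis {n} (b : Vector Carrier n) : Set (c ⊔ ℓ) where
    field
      independent : ∀ a → linearCombination a b ≈ 0# → ∀ i → a i ≡ 0ℚ
      spanning    : ∀ x → ∃[ a ] x ≈ linearCombination a b

  HasDegree : ℕ → Set (c ⊔ ℓ)
  HasDegree n = Σ (Vector Carrier n) IsBasis

record NumberField c ℓ (n : ℕ) : Set (suc (c ⊔ ℓ)) where
  field
    extension : FieldExtensionOfℚ c ℓ
  open FieldExtensionOfℚ extension public
  field
    degree : HasDegree n

QuadraticField : ∀ c ℓ → Set (suc (c ⊔ ℓ))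
QuadraticField c ℓ = NumberField c ℓ 2

-- Equality is decided by comparing the coordinates of x - y with 0.
module DecidableEquality {c ℓ n} (K : NumberField c ℓ n) where
  open NumberField K
  open IsRingHomomorphism ι-isRingHomomorphism using (0#-homo; ⟦⟧-cong)
  open RingProperties ring using (x∙y⁻¹≈ε⇒x≈y)

  private
    b = proj₁ degree
    open IsBasis (proj₂ degree)

    sum-zero : ∀ {m} (a : Vector ℚ m) (v : Vector Carrier m) →
               (∀ i → a i ≡ 0ℚ) → linearCombination a v ≈ 0#
    sum-zero {ℕ.zero}  a v a≡0 = refl
    sum-zero {ℕ.suc m} a v a≡0 =
      trans (+-cong (trans (*-congʳ (trans (⟦⟧-cong (a≡0 Fin.zero)) 0#-homo)) (zeroˡ _))
                    (sum-zero (λ i → a (Fin.suc i)) (λ i → v (Fin.suc i)) (λ i → a≡0 (Fin.suc i))))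
            (+-identityˡ 0#)

  infix 4 _≟_
  _≟_ : Decidable _≈_
  x ≟ y with spanning (x - y)
  ... | a , x-y≈ = map′
    (λ a≡0 → x∙y⁻¹≈ε⇒x≈y x y (trans x-y≈ (sum-zero a b a≡0)))
    (λ x≈y → independent a (trans (sym x-y≈) (trans (+-congʳ x≈y) (-‿inverseʳ y))))
    (all? (λ i → a i ℚ.≟ 0ℚ))

------------------------------------------------------------------------
-- The elliptic curve y² = x³ + 1

module EllipticCurve {c ℓ n} (K : NumberField c ℓ n) where
  open NumberField K
  open DecidableEquality K
  open RingProperties ring

  _² _³ : Carrier → Carrier
  x ² = x * x
  x ³ = x * x * x

  data Point : Set (c ⊔ ℓ) where
    𝒪      : Point
    affine : ∀ x y → y ² ≈ x ³ + 1# → Point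

  infix 4 _≈ₚ_
  data _≈ₚ_ : Point → Point → Set (c ⊔ ℓ) where
    𝒪      : 𝒪 ≈ₚ 𝒪
    affine : ∀ {x₁ y₁ e₁ x₂ y₂ e₂} → x₁ ≈ x₂ → y₁ ≈ y₂ →
             affine x₁ y₁ e₁ ≈ₚ affine x₂ y₂ e₂

  infixl 7 _/_[_]
  _/_[_] : (x y : Carrier) → ¬ (y ≈ 0#) → Carrier
  x / y [ y≉0 ] = x * proj₁ (invertible y y≉0)

  private
    module Solver where
      open IsRingHomomorphism ι-isRingHomomorphism
      morphism : ℚ.+-*-rawRing -Raw-AlmostCommutative⟶ fromCommutativeRing commutativeRing
      morphism = record
        { ⟦_⟧ = ι ; +-homo = +-homo ; *-homo = *-homo
        ; -‿homo = -‿homo ; 0-homo = 0#-homo ; 1-homo = 1#-homo }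
      ι-weaklyDec : ∀ p q → Maybe (ι p ≈ ι q)
      ι-weaklyDec p q = Maybe.map ⟦⟧-cong (dec⇒weaklyDec ℚ._≟_ p q)
      open RingSolver ℚ.+-*-rawRing (fromCommutativeRing commutativeRing) morphism ι-weaklyDec public
        using (solve; _:=_; _:+_; _:*_; _:-_; :-_)

    /-cancel : ∀ x y (y≉0 : ¬ (y ≈ 0#)) → x / y [ y≉0 ] * y ≈ x
    /-cancel x y y≉0 = trans (*-assoc _ _ _)
      (trans (*-congˡ (proj₁ (proj₂ (invertible y y≉0)))) (*-identityʳ x))

    cancel : ∀ x y → ¬ (x ≈ 0#) → x * y ≈ 0# → y ≈ 0#
    cancel x y x≉0 xy≈0 with invertible x x≉0
    ... | x⁻¹ , x⁻¹x≈1 , _ = trans (sym (*-identityˡ y)) (trans (*-congʳ (sym x⁻¹x≈1))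
      (trans (*-assoc _ _ _) (trans (*-congˡ xy≈0) (zeroʳ _))))

    -- The x-coordinates of the points where the line of slope m through
    -- (x₀, y₀) meets the curve are the roots of f m x₀ y₀.
    f : (m x₀ y₀ x : Carrier) → Carrier
    f m x₀ y₀ x = x ³ + 1# - (y₀ + m * (x - x₀)) ²

  -- Reflection in the x-axis of the third intersection point of the curve
  -- with the line of slope m through (x₁, y₁), where x₂ is the x-coordinate
  -- of the second intersection point.
  thirdX : (m x₁ x₂ : Carrier) → Carrier
  thirdX m x₁ x₂ = m ² - x₁ - x₂

  thirdY : (m x₁ y₁ x₂ : Carrier) → Carrier
  thirdY m x₁ y₁ x₂ = m * (x₁ - thirdX m x₁ x₂) - y₁

  private
    f≈0 : ∀ m x₀ y₀ x y → y ² ≈ x ³ + 1# → y₀ + m * (x - x₀) ≈ y → f m x₀ y₀ x ≈ 0#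
    f≈0 m x₀ y₀ x y e l = trans (+-congˡ (-‿cong (trans (*-cong l l) e))) (-‿inverseʳ _)

    third-onCurve : ∀ m x₁ y₁ x₂ → f m x₁ y₁ (thirdX m x₁ x₂) ≈ 0# →
                    thirdY m x₁ y₁ x₂ ² ≈ thirdX m x₁ x₂ ³ + 1#
    third-onCurve m x₁ y₁ x₂ h = trans
      (solve 4 (λ m x y x₃ → (m :* (x :- x₃) :- y) :* (m :* (x :- x₃) :- y)
                          := (y :+ m :* (x₃ :- x)) :* (y :+ m :* (x₃ :- x)))
               refl m x₁ y₁ (thirdX m x₁ x₂))
      (sym (x∙y⁻¹≈ε⇒x≈y _ _ h))
      where open Solver

    xu+yv≈0 : ∀ x y {u v} → u ≈ 0# → v ≈ 0# → x * u + y * v ≈ 0#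
    xu+yv≈0 x y u≈0 v≈0 = trans (+-cong (trans (*-congˡ u≈0) (zeroʳ x))
                                         (trans (*-congˡ v≈0) (zeroʳ y))) (+-identityˡ 0#)

    line-at-base : ∀ m x₁ y₁ → y₁ + m * (x₁ - x₁) ≈ y₁
    line-at-base m x₁ y₁ = trans (+-congˡ (trans (*-congˡ (-‿inverseʳ x₁)) (zeroʳ m))) (+-identityʳ y₁)

    chord-onCurve : ∀ m x₁ y₁ x₂ y₂ → y₁ ² ≈ x₁ ³ + 1# → y₂ ² ≈ x₂ ³ + 1# →
                    ¬ (x₂ - x₁ ≈ 0#) → m * (x₂ - x₁) ≈ y₂ - y₁ →
                    thirdY m x₁ y₁ x₂ ² ≈ thirdX m x₁ x₂ ³ + 1#
    chord-onCurve m x₁ y₁ x₂ y₂ e₁ e₂ d≉0 md≈ = third-onCurve m x₁ y₁ x₂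
      (cancel (x₂ - x₁) _ d≉0 (trans
        (solve 5 (λ m x₁ y₁ x₂ o →
            let x₃ = m :* m :- x₁ :- x₂
                f  = λ x → x :* x :* x :+ o :- (y₁ :+ m :* (x :- x₁)) :* (y₁ :+ m :* (x :- x₁))
            in (x₂ :- x₁) :* f x₃ := (x₂ :- x₃) :* f x₁ :+ (x₃ :- x₁) :* f x₂)
          refl m x₁ y₁ x₂ 1#)
        (xu+yv≈0 _ _
          (f≈0 m x₁ y₁ x₁ y₁ e₁ (line-at-base m x₁ y₁))
          (f≈0 m x₁ y₁ x₂ y₂ e₂ (trans (+-congˡ md≈)
            (solve 2 (λ y₁ y₂ → y₁ :+ (y₂ :- y₁) := y₂) refl y₁ y₂))))))
      where open Solver

    tangent-onCurve : ∀ m x₁ y₁ → y₁ ² ≈ x₁ ³ + 1# →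
                      m * (y₁ + y₁) ≈ x₁ ² + x₁ ² + x₁ ² →
                      thirdY m x₁ y₁ x₁ ² ≈ thirdX m x₁ x₁ ³ + 1#
    tangent-onCurve m x₁ y₁ e₁ h = third-onCurve m x₁ y₁ x₁ (trans
      (solve 4 (λ m x y o →
          let x₃ = m :* m :- x :- x
              f  = λ z → z :* z :* z :+ o :- (y :+ m :* (z :- x)) :* (y :+ m :* (z :- x))
          in f x₃ := (f x :+ (x₃ :- x) :* ((x :* x :+ x :* x :+ x :* x) :- m :* (y :+ y))))
        refl m x₁ y₁ 1#)
      (trans (+-cong (f≈0 m x₁ y₁ x₁ y₁ e₁ (line-at-base m x₁ y₁))
                     (trans (*-congˡ (trans (+-congˡ (-‿cong h)) (-‿inverseʳ _))) (zeroʳ _)))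
             (+-identityˡ 0#)))
      where open Solver

    2y≉0 : ∀ {x₁ y₁ x₂ y₂} → y₁ ² ≈ x₁ ³ + 1# → y₂ ² ≈ x₂ ³ + 1# →
           x₁ ≈ x₂ → ¬ (y₁ ≈ - y₂) → ¬ (y₁ + y₁ ≈ 0#)
    2y≉0 {x₁} {y₁} {x₂} {y₂} e₁ e₂ x₁≈x₂ y₁≉-y₂ 2y₁≈0 =
      y₁≉-y₂ (trans (+-inverseʳ-unique y₁ y₁ 2y₁≈0) (-‿cong y₁≈y₂))
      where
      open Solver
      sum≉0 : ¬ (y₁ + y₂ ≈ 0#)
      sum≉0 s = y₁≉-y₂ (+-inverseˡ-unique y₁ y₂ s)
      y₁≈y₂ : y₁ ≈ y₂
      y₁≈y₂ = x∙y⁻¹≈ε⇒x≈y y₁ y₂ (cancel (y₁ + y₂) _ sum≉0 (trans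
        (solve 2 (λ a b → (a :+ b) :* (a :- b) := a :* a :- b :* b) refl y₁ y₂)
        (trans (+-cong (trans e₁ (+-congʳ (*-cong (*-cong x₁≈x₂ x₁≈x₂) x₁≈x₂))) (-‿cong e₂))
               (-‿inverseʳ _))))

  infix 8 ⊖_
  ⊖_ : Point → Point
  ⊖ 𝒪            = 𝒪
  ⊖ affine x y e = affine x (- y) (trans (-x*-y≈x*y y y) e)
    where
    -x*-y≈x*y : ∀ x y → - x * - y ≈ x * y
    -x*-y≈x*y = solve 2 (λ x y → (:- x) :* (:- y) := x :* y) refl
      where open Solver

  infixl 6 _⊕_
  _⊕_ : Point → Point → Point
  𝒪               ⊕ Q               = Q
  affine x₁ y₁ e₁ ⊕ 𝒪               = affine x₁ y₁ e₁
  affine x₁ y₁ e₁ ⊕ affine x₂ y₂ e₂ with x₁ ≟ x₂ | y₁ ≟ - y₂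
  ... | yes _     | yes _      = 𝒪
  ... | yes x₁≈x₂ | no  y₁≉-y₂ =
    -- here P = Q, and the line is the tangent at P
    let 2y₁≉0 = 2y≉0 e₁ e₂ x₁≈x₂ y₁≉-y₂
        m     = (x₁ ² + x₁ ² + x₁ ²) / (y₁ + y₁) [ 2y₁≉0 ]
    in affine (thirdX m x₁ x₁) (thirdY m x₁ y₁ x₁)
              (tangent-onCurve m x₁ y₁ e₁ (/-cancel _ _ 2y₁≉0))
  ... | no  x₁≉x₂ | _          =
    let d≉0 = λ d≈0 → x₁≉x₂ (sym (x∙y⁻¹≈ε⇒x≈y x₂ x₁ d≈0))
        m   = (y₂ - y₁) / (x₂ - x₁) [ d≉0 ]
    in affine (thirdX m x₁ x₂) (thirdY m x₁ y₁ x₂)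
              (chord-onCurve m x₁ y₁ x₂ y₂ e₁ e₂ d≉0 (/-cancel _ _ d≉0))

  E[K] : RawGroup (c ⊔ ℓ) (c ⊔ ℓ)
  E[K] = record
    { Carrier = Point ; _≈_ = _≈ₚ_ ; _∙_ = _⊕_ ; ε = 𝒪 ; _⁻¹ = ⊖_ }

------------------------------------------------------------------------
-- Subgroups, torsion, isomorphism

-- Equality of the subgroup ignores the membership proofs, so its isomorphism
-- class depends only on G and P, not on the closure proofs.
record IsSubgroup {a ℓ p} (G : RawGroup a ℓ) (P : RawGroup.Carrier G → Set p) :
                  Set (a ⊔ p) where
  open RawGroup G
  field
    ∙-closed  : ∀ {x y} → P x → P y → P (x ∙ y)
    ε-closed  : P ε
    ⁻¹-closed : ∀ {x} → P x → P (x ⁻¹)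

  subgroup : RawGroup (a ⊔ p) ℓ
  subgroup = record
    { Carrier = Σ Carrier P
    ; _≈_     = _≈_ on proj₁
    ; _∙_     = λ (x , px) (y , py) → x ∙ y , ∙-closed px py
    ; ε       = ε , ε-closed
    ; _⁻¹     = λ (x , px) → x ⁻¹ , ⁻¹-closed px
    }

IsTorsion : ∀ {a ℓ} (G : RawGroup a ℓ) → RawGroup.Carrier G → Set ℓ
IsTorsion G x = ∃[ n ] NonZero n × (n · x) ≈ ε
  where
  open RawGroup G
  open RawMonoidDefinitions rawMonoid using () renaming (_×_ to _·_)

infix 4 _≅_
_≅_ : ∀ {a ℓ₁ b ℓ₂} → RawGroup a ℓ₁ → RawGroup b ℓ₂ → Set (a ⊔ ℓ₁ ⊔ b ⊔ ℓ₂)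
G ≅ H = ∃ (IsGroupIsomorphism G H)

ℤ/_ℤ : ℕ → RawGroup Level.zero Level.zero
ℤ/ n ℤ = record
  { Carrier = ℤ
  ; _≈_     = λ i j → ℤ.+ n ℤ.∣ i ℤ.- j
  ; _∙_     = ℤ._+_
  ; ε       = ℤ.0ℤ
  ; _⁻¹     = ℤ.-_
  }

{-# OPTIONS --safe #-}

-- The group law is associative because, with l, m the slopes of the lines AB
-- and BC and n the slope of the line through A + B and C, one has
-- (n + l)(m - l) = x(C) - x(A), which is antisymmetric in A and C.
--
-- A torsion point P with rational x has x ∈ {-1, 0, 2}: since
-- x(2P) = x(x³ - 8) / 4(x³ + 1), the 2-adic valuation of x is otherwise
-- eventually strictly monotone along P, 2P, 4P, ..., whereas this sequence
-- repeats.  Hence the torsion points with rational x are the multiples of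
-- G = (2, 3), which has order 6.
--
-- Let σ be the conjugation of K.  For P torsion, P + σP and P - σP have rational
-- x, so 2P = (P + σP) + (P - σP) is a multiple of G; moreover P - σP is 0 or
-- 3G = (-1, 0), because it is a multiple of G that σ both fixes and inverts.
-- This excludes 2P = 3G, and P is a multiple of G up to a point of order two.
-- The x-coordinates of the latter are the roots of (x + 1)(x² - x + 1), so
-- everything depends on whether √-3 lies in K.
module Submission where

open import Defs
open import Level using (_⊔_)
open import Algebra.Bundles using (AbelianGroup; Group; RawGroup)
open import Algebra.Construct.DirectProduct as DirectProduct using (rawGroup)
import Algebra.Morphism.Construct.Composition as Composition
open import Algebra.Morphism.Structures using (IsRingHomomorphism)
import Algebra.Properties.AbelianGroup as AbelianGroupProperties
import Algebra.Properties.CommutativeMonoid.Mult as CommutativeMonoidMult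
import Algebra.Properties.CommutativeSemigroup as CommutativeSemigroupProperties
import Algebra.Properties.Group as GroupProperties
import Algebra.Properties.Monoid.Mult as MonoidMult
import Algebra.Properties.Ring as RingProperties
import Algebra.Solver.Ring as RingSolver
open import Algebra.Solver.Ring.AlmostCommutativeRing
  using (fromCommutativeRing; _-Raw-AlmostCommutative⟶_)
open import Algebra.Structures using (IsAbelianGroup; IsGroup)
open import Data.Empty using (⊥; ⊥-elim)
open import Data.Fin.Base as Fin using (Fin)
import Data.Fin.Properties as Fin
open import Data.Integer.Base as ℤ using (ℤ; +_; -[1+_])
import Data.Integer.Divisibility.Signed as Signed
import Data.Integer.DivMod as ℤ
import Data.Integer.Properties as ℤ
import Data.Integer.Tactic.RingSolver as ℤSolver
open import Data.List.Base using ([]; _∷_)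
open import Data.Maybe.Base as Maybe using (Maybe)
open import Data.Nat.Base as ℕ using (ℕ; zero; suc; NonZero)
open import Data.Nat.Coprimality as ℕ using (Coprime)
open import Data.Nat.Divisibility as ℕ using (_∣_; divides)
import Data.Nat.DivMod as ℕ
import Data.Nat.Properties as ℕ
import Data.Nat.Tactic.RingSolver as ℕSolver
open import Data.Product.Base using (Σ; ∃-syntax; _×_; _,_; proj₁; proj₂)
open import Data.Rational.Base as ℚ using (ℚ; 0ℚ; 1ℚ)
import Data.Rational.Properties as ℚ
import Data.Rational.Unnormalised.Base as ℚᵘ
import Data.Rational.Unnormalised.Properties as ℚᵘ
open import Data.Sum.Base using (_⊎_; inj₁; inj₂)
import Data.Vec.Functional as Vector
open import Relation.Binary.Consequences using (dec⇒weaklyDec)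
open import Relation.Binary.PropositionalEquality as ≡ using (_≡_; _≢_)
import Relation.Binary.Reasoning.Setoid as SetoidReasoning
open import Relation.Nullary using (¬_; Dec; yes; no)
open import Relation.Nullary.Decidable using (map′; _×-dec_)

-- The integers in a number field

-- Why just -1, 0 and 2: with v the 2-adic valuation of x, doubling lowers a negative v by 2 and
-- raises a v ≥ 2 by 1. If v is 0 or 1, one doubling leads into one of these ranges, unless the
-- denominator of x(2P) vanishes, at x = -1, or its numerator does, at x = 2; and x = 0 has no
-- valuation. What counts is that x, not y, is rational: this treats alike the points that σ fixes
-- and those that it negates. Two things shape the rest. `_⊕_` branches on equality and divides, so
-- its laws are proved for a relation `IsSum` given by polynomial equations, in which chord and
-- tangent are one case; such equations also survive conjugation. And the final alternative has to
-- be decided: whether √-3 lies in K becomes the question whether a certain integer is a square.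
-- Without √-3 the points killed by 2 are 𝒪 and 3G, so G generates; with it there is a point W of
-- order two outside ⟨G⟩, and W and G generate.

fromℤ : ℤ → ℚ
fromℤ i = i ℚ./ 1

-- Operations on ℚ normalise by a gcd. The laws of `fromℤ` are therefore checked on unnormalised
-- fractions, where i is represented by i over 1.
toℚᵘ-fromℤ : ∀ i → ℚ.toℚᵘ (fromℤ i) ℚᵘ.≃ ℚᵘ.mkℚᵘ i 0
toℚᵘ-fromℤ i = ℚ.toℚᵘ-fromℚᵘ (ℚᵘ.mkℚᵘ i 0)

fromℤ-homo-+ : ∀ i j → fromℤ (i ℤ.+ j) ≡ fromℤ i ℚ.+ fromℤ j
fromℤ-homo-+ i j = ℚ.toℚᵘ-injective (begin
  ℚ.toℚᵘ (fromℤ (i ℤ.+ j))                   ≈⟨ toℚᵘ-fromℤ (i ℤ.+ j) ⟩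
  ℚᵘ.mkℚᵘ (i ℤ.+ j) 0                        ≈⟨ ℚᵘ.*≡* (≡.cong (ℤ._* + 1)
                                                  (≡.sym (≡.cong₂ ℤ._+_ (ℤ.*-identityʳ i) (ℤ.*-identityʳ j)))) ⟩
  ℚᵘ.mkℚᵘ i 0 ℚᵘ.+ ℚᵘ.mkℚᵘ j 0               ≈⟨ ℚᵘ.+-cong (toℚᵘ-fromℤ i) (toℚᵘ-fromℤ j) ⟨
  ℚ.toℚᵘ (fromℤ i) ℚᵘ.+ ℚ.toℚᵘ (fromℤ j)     ≈⟨ ℚ.toℚᵘ-homo-+ (fromℤ i) (fromℤ j) ⟨
  ℚ.toℚᵘ (fromℤ i ℚ.+ fromℤ j)               ∎)
  where open ℚᵘ.≃-Reasoning

fromℤ-homo-* : ∀ i j → fromℤ (i ℤ.* j) ≡ fromℤ i ℚ.* fromℤ j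
fromℤ-homo-* i j = ℚ.toℚᵘ-injective (begin
  ℚ.toℚᵘ (fromℤ (i ℤ.* j))                   ≈⟨ toℚᵘ-fromℤ (i ℤ.* j) ⟩
  ℚᵘ.mkℚᵘ i 0 ℚᵘ.* ℚᵘ.mkℚᵘ j 0               ≈⟨ ℚᵘ.*-cong (toℚᵘ-fromℤ i) (toℚᵘ-fromℤ j) ⟨
  ℚ.toℚᵘ (fromℤ i) ℚᵘ.* ℚ.toℚᵘ (fromℤ j)     ≈⟨ ℚ.toℚᵘ-homo-* (fromℤ i) (fromℤ j) ⟨
  ℚ.toℚᵘ (fromℤ i ℚ.* fromℤ j)               ∎)
  where open ℚᵘ.≃-Reasoning

fromℤ-homo-neg : ∀ i → fromℤ (ℤ.- i) ≡ ℚ.- fromℤ i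
fromℤ-homo-neg i = ℚ.toℚᵘ-injective (begin
  ℚ.toℚᵘ (fromℤ (ℤ.- i))   ≈⟨ toℚᵘ-fromℤ (ℤ.- i) ⟩
  ℚᵘ.- ℚᵘ.mkℚᵘ i 0         ≈⟨ ℚᵘ.-‿cong (toℚᵘ-fromℤ i) ⟨
  ℚᵘ.- ℚ.toℚᵘ (fromℤ i)    ≈⟨ ℚ.toℚᵘ-homo‿- (fromℤ i) ⟨
  ℚ.toℚᵘ (ℚ.- fromℤ i)     ∎)
  where open ℚᵘ.≃-Reasoning

fromℤ-isRingHomomorphism : IsRingHomomorphism ℤ.+-*-rawRing ℚ.+-*-rawRing fromℤ
fromℤ-isRingHomomorphism = record
  { isSemiringHomomorphism = record
    { isNearSemiringHomomorphism = record
      { +-isMonoidHomomorphism = record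
        { isMagmaHomomorphism = record
          { isRelHomomorphism = record { cong = ≡.cong fromℤ }
          ; homo = fromℤ-homo-+ }
        ; ε-homo = ≡.refl }
      ; *-homo = fromℤ-homo-* }
    ; 1#-homo = ≡.refl }
  ; -‿homo = fromℤ-homo-neg }

↥≡*↧ : ∀ q → q ℚ.* fromℤ (ℚ.↧ q) ≡ fromℤ (ℚ.↥ q)
↥≡*↧ q@(ℚ.mkℚ _ d-1 _) = ℚ.toℚᵘ-injective (begin
  ℚ.toℚᵘ (q ℚ.* fromℤ (ℚ.↧ q))           ≈⟨ ℚ.toℚᵘ-homo-* q (fromℤ (ℚ.↧ q)) ⟩
  ℚ.toℚᵘ q ℚᵘ.* ℚ.toℚᵘ (fromℤ (ℚ.↧ q))   ≈⟨ ℚᵘ.*-congˡ {ℚ.toℚᵘ q} (toℚᵘ-fromℤ (ℚ.↧ q)) ⟩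
  ℚ.toℚᵘ q ℚᵘ.* ℚᵘ.mkℚᵘ (ℚ.↧ q) 0        ≈⟨ ℚᵘ.*≡* (≡.trans (ℤ.*-identityʳ _)
                                              (≡.cong (λ m → ℚ.↥ q ℤ.* + m) (≡.sym (ℕ.*-identityʳ (ℕ.suc d-1))))) ⟩
  ℚᵘ.mkℚᵘ (ℚ.↥ q) 0                      ≈⟨ toℚᵘ-fromℤ (ℚ.↥ q) ⟨
  ℚ.toℚᵘ (fromℤ (ℚ.↥ q))                 ∎)
  where open ℚᵘ.≃-Reasoning

module NumberFieldProperties {c ℓ n} (K : NumberField c ℓ n) where
  open NumberField K
  open RingProperties ring using (x∙y⁻¹≈ε⇒x≈y)
  private module ι = IsRingHomomorphism ι-isRingHomomorphism

  opaque
    -- Opaque, so that an integer constant stays an atom instead of unfolding to a normalised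
    -- fraction; `ιℤ≈ι` keeps the link with `ι`.
    ιℤ : ℤ → Carrier
    ιℤ i = ι (fromℤ i)

    ιℤ≈ι : ∀ i → ιℤ i ≈ ι (fromℤ i)
    ιℤ≈ι i = refl

    ιℤ-isRingHomomorphism : IsRingHomomorphism ℤ.+-*-rawRing rawRing ιℤ
    ιℤ-isRingHomomorphism =
      Composition.isRingHomomorphism trans fromℤ-isRingHomomorphism ι-isRingHomomorphism

  module ιℤ = IsRingHomomorphism ιℤ-isRingHomomorphism

  module Solver where
    morphism : ℤ.+-*-rawRing -Raw-AlmostCommutative⟶ fromCommutativeRing commutativeRing
    morphism = record
      { ⟦_⟧ = ιℤ ; +-homo = ιℤ.+-homo ; *-homo = ιℤ.*-homo
      ; -‿homo = ιℤ.-‿homo ; 0-homo = ιℤ.0#-homo ; 1-homo = ιℤ.1#-homo }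
    ιℤ-weaklyDec : ∀ i j → Maybe (ιℤ i ≈ ιℤ j)
    ιℤ-weaklyDec i j = Maybe.map ιℤ.⟦⟧-cong (dec⇒weaklyDec ℤ._≟_ i j)
    open RingSolver ℤ.+-*-rawRing (fromCommutativeRing commutativeRing) morphism ιℤ-weaklyDec public
      using (solve; con; _:=_; _:+_; _:*_; _:-_; :-_)

  -- Equations are derived from hypotheses aᵢ ≈ bᵢ in the form
  -- l - r ≈ Σ cᵢ * (aᵢ - bᵢ), where the solver proves the latter.
  infix  1 _⇐_
  infixl 6 _⊞_
  infixl 7 _⊡_

  _⇐_ : ∀ {l r z} → l - r ≈ z → z ≈ 0# → l ≈ r
  l-r≈z ⇐ z≈0 = x∙y⁻¹≈ε⇒x≈y _ _ (trans l-r≈z z≈0)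

  _⊞_ : ∀ {u v} → u ≈ 0# → v ≈ 0# → u + v ≈ 0#
  u≈0 ⊞ v≈0 = trans (+-cong u≈0 v≈0) (+-identityˡ 0#)

  _⊡_ : ∀ c {a b} → a ≈ b → c * (a - b) ≈ 0#
  c ⊡ a≈b = trans (*-congˡ (trans (+-congʳ a≈b) (-‿inverseʳ _))) (zeroʳ c)

  *-cancelˡ-≉0 : ∀ {x y z} → ¬ (x ≈ 0#) → x * y ≈ x * z → y ≈ z
  *-cancelˡ-≉0 {x} {y} {z} x≉0 xy≈xz with invertible x x≉0
  ... | x⁻¹ , x⁻¹x≈1 , _ = trans (sym (undo y)) (trans (*-congˡ xy≈xz) (undo z))
    where
    undo : ∀ w → x⁻¹ * (x * w) ≈ w
    undo w = trans (sym (*-assoc _ _ _)) (trans (*-congʳ x⁻¹x≈1) (*-identityˡ w))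

  x*y≈0⇒y≈0 : ∀ {x y} → ¬ (x ≈ 0#) → x * y ≈ 0# → y ≈ 0#
  x*y≈0⇒y≈0 x≉0 xy≈0 = *-cancelˡ-≉0 x≉0 (trans xy≈0 (sym (zeroʳ _)))

  x*y≉0 : ∀ {x y} → ¬ (x ≈ 0#) → ¬ (y ≈ 0#) → ¬ (x * y ≈ 0#)
  x*y≉0 x≉0 y≉0 xy≈0 = y≉0 (x*y≈0⇒y≈0 x≉0 xy≈0)

  ι-≉0 : ∀ {q} → q ≢ 0ℚ → ¬ (ι q ≈ 0#)
  ι-≉0 {q} q≢0 ιq≈0 = 0≉1 (begin
    0#                          ≈⟨ zeroˡ _ ⟨
    0# * ι (ℚ.1/ q)             ≈⟨ *-congʳ ιq≈0 ⟨
    ι q * ι (ℚ.1/ q)            ≈⟨ ι.*-homo q (ℚ.1/ q) ⟨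
    ι (q ℚ.* (ℚ.1/ q))          ≈⟨ ι.⟦⟧-cong (ℚ.*-inverseʳ q) ⟩
    ι 1ℚ                        ≈⟨ ι.1#-homo ⟩
    1#                          ∎)
    where
    open import Relation.Binary.Reasoning.Setoid setoid
    instance _ = ℚ.≢-nonZero q≢0

  ι-injective : ∀ {p q} → ι p ≈ ι q → p ≡ q
  ι-injective {p} {q} ιp≈ιq with p ℚ.- q ℚ.≟ 0ℚ
  ... | yes p-q≡0 = RingProperties.x∙y⁻¹≈ε⇒x≈y ℚ.+-*-ring p q p-q≡0
  ... | no  p-q≢0 = ⊥-elim (ι-≉0 p-q≢0 (trans (ι.+-homo p (ℚ.- q))
    (trans (+-congˡ (ι.-‿homo q)) (trans (+-congʳ ιp≈ιq) (-‿inverseʳ (ι q))))))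

  ιℤ-injective : ∀ {i j} → ιℤ i ≈ ιℤ j → i ≡ j
  ιℤ-injective {i} {j} eq = ℤ-inj (ι-injective (trans (sym (ιℤ≈ι i)) (trans eq (ιℤ≈ι j))))
    where
    ℤ-inj : fromℤ i ≡ fromℤ j → i ≡ j
    ℤ-inj eq with ℚᵘ.≃-trans (ℚᵘ.≃-sym (toℚᵘ-fromℤ i)) (ℚᵘ.≃-trans (ℚᵘ.≃-reflexive (≡.cong ℚ.toℚᵘ eq)) (toℚᵘ-fromℤ j))
    ... | ℚᵘ.*≡* i1≡j1 = ≡.trans (≡.sym (ℤ.*-identityʳ i)) (≡.trans i1≡j1 (ℤ.*-identityʳ j))

  ιℤ-≉0 : ∀ {i} → i ≢ + 0 → ¬ (ιℤ i ≈ 0#)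
  ιℤ-≉0 i≢0 eq = i≢0 (ιℤ-injective (trans eq (sym ιℤ.0#-homo)))

  -- Rationals are used through this equation, cleared of denominators, so that valuations and
  -- integrality become statements about integers.
  ι-↥↧ : ∀ q → ι q * ιℤ (ℚ.↧ q) ≈ ιℤ (ℚ.↥ q)
  ι-↥↧ q = trans (*-congˡ (ιℤ≈ι (ℚ.↧ q))) (trans (sym (ι.*-homo q (fromℤ (ℚ.↧ q))))
    (trans (ι.⟦⟧-cong (↥≡*↧ q)) (sym (ιℤ≈ι (ℚ.↥ q)))))

-- The group law

module GroupLaw {c ℓ n} (K : NumberField c ℓ n) where
  open NumberField K
  open DecidableEquality K
  open EllipticCurve K
  open NumberFieldProperties K
  open RingProperties ring

  -- m is the slope of the chord through two points of the curve, or of the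
  -- tangent if they coincide: subtracting the equations of the curve gives
  -- (y₂ - y₁)(y₁ + y₂) = (x₂ - x₁)(x₁² + x₁x₂ + x₂²).
  record Slope (m x₁ y₁ x₂ y₂ : Carrier) : Set ℓ where
    constructor slope
    field
      chord   : m * (x₂ - x₁) ≈ y₂ - y₁
      tangent : m * (y₁ + y₂) ≈ x₁ ² + x₁ * x₂ + x₂ ²

  -- The graph of the addition, free of equality tests and inverses. Symmetries and associativity
  -- can then be proved by matching on the geometric situation, and `line` covers both chord and
  -- tangent.
  data IsSum : Point → Point → Point → Set (c ⊔ ℓ) where
    𝒪ˡ       : ∀ {Q R} → Q ≈ₚ R → IsSum 𝒪 Q R
    𝒪ʳ       : ∀ {P R} → P ≈ₚ R → IsSum P 𝒪 R
    opposite : ∀ {x₁ y₁ e₁ x₂ y₂ e₂} → x₁ ≈ x₂ → y₁ ≈ - y₂ →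
               IsSum (affine x₁ y₁ e₁) (affine x₂ y₂ e₂) 𝒪
    line     : ∀ m {x₁ y₁ e₁ x₂ y₂ e₂ x₃ y₃ e₃} → Slope m x₁ y₁ x₂ y₂ →
               x₃ ≈ thirdX m x₁ x₂ → y₃ ≈ m * (x₁ - x₃) - y₁ →
               IsSum (affine x₁ y₁ e₁) (affine x₂ y₂ e₂) (affine x₃ y₃ e₃)

  ≈ₚ-refl : ∀ {P} → P ≈ₚ P
  ≈ₚ-refl {𝒪}            = 𝒪
  ≈ₚ-refl {affine _ _ _} = affine refl refl

  ≈ₚ-sym : ∀ {P Q} → P ≈ₚ Q → Q ≈ₚ P
  ≈ₚ-sym 𝒪            = 𝒪
  ≈ₚ-sym (affine p q) = affine (sym p) (sym q)

  ≈ₚ-trans : ∀ {P Q R} → P ≈ₚ Q → Q ≈ₚ R → P ≈ₚ R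
  ≈ₚ-trans 𝒪            𝒪              = 𝒪
  ≈ₚ-trans (affine p q) (affine p′ q′) = affine (trans p p′) (trans q q′)

  private
    ²-cong : ∀ {x y} → x ≈ y → x ² ≈ y ²
    ²-cong x≈y = *-cong x≈y x≈y

    -‿cong₂ : ∀ {w x y z} → w ≈ x → y ≈ z → w - y ≈ x - z
    -‿cong₂ w≈x y≈z = +-cong w≈x (-‿cong y≈z)

  slope-cong : ∀ {m x₁ y₁ x₂ y₂ m′ x₁′ y₁′ x₂′ y₂′} →
               m ≈ m′ → x₁ ≈ x₁′ → y₁ ≈ y₁′ → x₂ ≈ x₂′ → y₂ ≈ y₂′ →
               Slope m x₁ y₁ x₂ y₂ → Slope m′ x₁′ y₁′ x₂′ y₂′
  slope-cong m x₁ y₁ x₂ y₂ (slope h k) = slope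
    (trans (*-cong (sym m) (sym (-‿cong₂ x₂ x₁))) (trans h (-‿cong₂ y₂ y₁)))
    (trans (*-cong (sym m) (sym (+-cong y₁ y₂)))
      (trans k (+-cong (+-cong (²-cong x₁) (*-cong x₁ x₂)) (²-cong x₂))))

  slope-sym : ∀ {m x₁ y₁ x₂ y₂} → Slope m x₁ y₁ x₂ y₂ → Slope m x₂ y₂ x₁ y₁
  slope-sym {m} {x₁} {y₁} {x₂} {y₂} (slope h k) = slope
    (solve 5 (λ m x₁ y₁ x₂ y₂ → m :* (x₁ :- x₂) :- (y₁ :- y₂)
        := con (ℤ.- + 1) :* (m :* (x₂ :- x₁) :- (y₂ :- y₁))) refl m x₁ y₁ x₂ y₂
      ⇐ _ ⊡ h)
    (solve 5 (λ m x₁ y₁ x₂ y₂ → m :* (y₂ :+ y₁) :- (x₂ :* x₂ :+ x₂ :* x₁ :+ x₁ :* x₁)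
        := con (+ 1) :* (m :* (y₁ :+ y₂) :- (x₁ :* x₁ :+ x₁ :* x₂ :+ x₂ :* x₂))) refl m x₁ y₁ x₂ y₂
      ⇐ _ ⊡ k)
    where open Solver

  -- A non-vertical line meets the curve in P and -P only if P is a point of
  -- order two and a singular point.
  slope-not-opposite : ∀ {m x₁ y₁ x₂ y₂} → y₁ ² ≈ x₁ ³ + 1# → Slope m x₁ y₁ x₂ y₂ →
                       x₁ ≈ x₂ → ¬ (y₁ ≈ - y₂)
  slope-not-opposite {m} {x₁} {y₁} {x₂} {y₂} e (slope h k) hx hy =
    0≉1 (sym (x*y≈0⇒y≈0 (ιℤ-≉0 {+ 6} λ ())
      -- The chord equation gives 2y₁ = 0 and the tangent equation 3x₁² = 0, so the equation of the
      -- curve becomes 0 = 1. Scaling by 6 avoids dividing by 2 and 3.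
      (solve 6 (λ m x₁ y₁ x₂ y₂ o → con (+ 6) :* o :- con (+ 0) :=
          con (ℤ.- + 6) :* (y₁ :* y₁ :- (x₁ :* x₁ :* x₁ :+ o))
          :+ (con (+ 3) :* y₁ :- con (+ 2) :* x₁ :* m) :* (y₁ :- (:- y₂))
          :+ con (+ 3) :* y₁ :* (m :* (x₂ :- x₁) :- (y₂ :- y₁))
          :+ con (+ 2) :* x₁ :* (m :* (y₁ :+ y₂) :- (x₁ :* x₁ :+ x₁ :* x₂ :+ x₂ :* x₂))
          :+ (con (+ 3) :* y₁ :* m :- con (+ 2) :* x₁ :* (x₂ :+ con (+ 2) :* x₁)) :* (x₁ :- x₂))
        refl m x₁ y₁ x₂ y₂ 1#
       ⇐′ _ ⊡ e ⊞ _ ⊡ hy ⊞ _ ⊡ h ⊞ _ ⊡ k ⊞ _ ⊡ hx)))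
    where
    open Solver
    infix 1 _⇐′_
    _⇐′_ : ∀ {l z} → l - ιℤ (+ 0) ≈ z → z ≈ 0# → l ≈ 0#
    p ⇐′ q = trans (p ⇐ q) ιℤ.0#-homo

  -- One of the factors x₂ - x₁ and y₁ + y₂ of the slope is nonzero, since otherwise the points
  -- would be opposite. The equation with that factor determines m.
  slope-unique : ∀ {m m′ x₁ y₁ x₂ y₂} → y₁ ² ≈ x₁ ³ + 1# →
                 Slope m x₁ y₁ x₂ y₂ → Slope m′ x₁ y₁ x₂ y₂ → m ≈ m′
  slope-unique {m} {m′} {x₁} {y₁} {x₂} {y₂} e s@(slope h k) (slope h′ k′) with x₂ - x₁ ≟ 0#
  ... | no  d≉0 = *-cancelˡ-≉0 d≉0 (trans (*-comm _ _) (trans (trans h (sym h′)) (*-comm _ _)))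
  ... | yes d≈0 with y₁ + y₂ ≟ 0#
  ...   | no  t≉0 = *-cancelˡ-≉0 t≉0 (trans (*-comm _ _) (trans (trans k (sym k′)) (*-comm _ _)))
  ...   | yes t≈0 = ⊥-elim (slope-not-opposite e s (sym (x∙y⁻¹≈ε⇒x≈y _ _ d≈0)) (+-inverseˡ-unique _ _ t≈0))

  thirdY-sym : ∀ {m x₁ y₁ x₂ y₂ x₃} → m * (x₂ - x₁) ≈ y₂ - y₁ →
               m * (x₁ - x₃) - y₁ ≈ m * (x₂ - x₃) - y₂
  thirdY-sym {m} {x₁} {y₁} {x₂} {y₂} {x₃} h =
    (solve 6 (λ m x₁ y₁ x₂ y₂ x₃ → m :* (x₁ :- x₃) :- y₁ :- (m :* (x₂ :- x₃) :- y₂)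
        := con (ℤ.- + 1) :* (m :* (x₂ :- x₁) :- (y₂ :- y₁))) refl m x₁ y₁ x₂ y₂ x₃
      ⇐ _ ⊡ h)
    where open Solver

  isSum-comm : ∀ {P Q R} → IsSum P Q R → IsSum Q P R
  isSum-comm (𝒪ˡ Q≈R) = 𝒪ʳ Q≈R
  isSum-comm (𝒪ʳ P≈R) = 𝒪ˡ P≈R
  isSum-comm (opposite x₁≈x₂ y₁≈-y₂) = opposite (sym x₁≈x₂)
    (trans (sym (-‿involutive _)) (-‿cong (sym y₁≈-y₂)))
  isSum-comm (line m {x₁ = x₁} {x₂ = x₂} s x₃≈ y₃≈) = line m (slope-sym s)
    (trans x₃≈ (solve 3 (λ m x₁ x₂ → m :* m :- x₁ :- x₂ := m :* m :- x₂ :- x₁) refl m x₁ x₂))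
    (trans y₃≈ (thirdY-sym (Slope.chord s)))
    where open Solver

  -- Uniqueness of the sum and compatibility with `_≈ₚ_` at once. The mixed cases clash by
  -- `slope-not-opposite`.
  isSum-unique : ∀ {P Q R P′ Q′ R′} → P ≈ₚ P′ → Q ≈ₚ Q′ → IsSum P Q R → IsSum P′ Q′ R′ → R ≈ₚ R′
  isSum-unique 𝒪 q (𝒪ˡ r) (𝒪ˡ r′) = ≈ₚ-trans (≈ₚ-sym r) (≈ₚ-trans q r′)
  isSum-unique 𝒪 𝒪 (𝒪ˡ r) (𝒪ʳ r′) = ≈ₚ-trans (≈ₚ-sym r) r′
  isSum-unique 𝒪 𝒪 (𝒪ʳ r) (𝒪ˡ r′) = ≈ₚ-trans (≈ₚ-sym r) r′
  isSum-unique p 𝒪 (𝒪ʳ r) (𝒪ʳ r′) = ≈ₚ-trans (≈ₚ-sym r) (≈ₚ-trans p r′)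
  isSum-unique (affine _ _) (affine _ _) (opposite _ _) (opposite _ _) = 𝒪
  isSum-unique (affine x₁ y₁) (affine x₂ y₂) (opposite hx hy) (line m {e₁ = e₁} s _ _) =
    ⊥-elim (slope-not-opposite e₁ s (trans (sym x₁) (trans hx x₂))
                                 (trans (sym y₁) (trans hy (-‿cong y₂))))
  isSum-unique (affine x₁ y₁) (affine x₂ y₂) (line m {e₁ = e₁} s _ _) (opposite hx hy) =
    ⊥-elim (slope-not-opposite e₁ s (trans x₁ (trans hx (sym x₂)))
                                 (trans y₁ (trans hy (-‿cong (sym y₂)))))
  isSum-unique (affine x₁ y₁) (affine x₂ y₂) (line m s x₃≈ y₃≈) (line m′ {e₁ = e₁} s′ x₃′≈ y₃′≈) =
    affine x₃ (trans y₃≈ (trans (-‿cong₂ (*-cong m≈m′ (-‿cong₂ x₁ x₃)) y₁) (sym y₃′≈)))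
    where
    m≈m′ = slope-unique e₁ (slope-cong refl x₁ y₁ x₂ y₂ s) s′
    x₃ = trans x₃≈ (trans (-‿cong₂ (-‿cong₂ (²-cong m≈m′) x₁) x₂) (sym x₃′≈))

  -- In each case of `_⊕_` one of the two slope equations is the definition of the slope and the
  -- other must be supplied. For a tangent the chord equation reads 0 = 0; for a chord the tangent
  -- equation holds after multiplication by x₂ - x₁.
  ⊕-isSum : ∀ P Q → IsSum P Q (P ⊕ Q)
  ⊕-isSum 𝒪               Q               = 𝒪ˡ ≈ₚ-refl
  ⊕-isSum (affine x₁ y₁ e₁) 𝒪             = 𝒪ʳ ≈ₚ-refl
  ⊕-isSum (affine x₁ y₁ e₁) (affine x₂ y₂ e₂) with x₁ ≟ x₂ | y₁ ≟ - y₂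
  ... | yes x₁≈x₂ | yes y₁≈-y₂ = opposite x₁≈x₂ y₁≈-y₂
  ... | yes x₁≈x₂ | no  y₁≉-y₂ = line _
    (slope-cong refl refl refl x₁≈x₂ y₁≈y₂
      (slope (trans (*-congˡ (-‿inverseʳ x₁)) (trans (zeroʳ _) (sym (-‿inverseʳ y₁))))
             (trans (*-assoc _ _ _) (trans (*-congˡ (proj₁ (proj₂ (invertible _ _)))) (*-identityʳ _)))))
    (+-congˡ (-‿cong x₁≈x₂)) refl
    where
    open Solver
    y₁≈y₂ : y₁ ≈ y₂
    y₁≈y₂ = x∙y⁻¹≈ε⇒x≈y _ _ (x*y≈0⇒y≈0 (λ t≈0 → y₁≉-y₂ (+-inverseˡ-unique y₁ y₂ t≈0))
      (trans (solve 2 (λ y₁ y₂ → (y₁ :+ y₂) :* (y₁ :- y₂) := y₁ :* y₁ :- y₂ :* y₂) refl y₁ y₂)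
        (trans (-‿cong₂ (trans e₁ (+-congʳ (*-cong (²-cong x₁≈x₂) x₁≈x₂))) e₂) (-‿inverseʳ _))))
  ... | no  x₁≉x₂ | _          = line _ (slope md≈ (*-cancelˡ-≉0 d≉0
      (solve 6 (λ m x₁ y₁ x₂ y₂ o →
          (x₂ :- x₁) :* (m :* (y₁ :+ y₂)) :- (x₂ :- x₁) :* (x₁ :* x₁ :+ x₁ :* x₂ :+ x₂ :* x₂)
          := (y₁ :+ y₂) :* (m :* (x₂ :- x₁) :- (y₂ :- y₁))
          :+ con (+ 1) :* (y₂ :* y₂ :- (x₂ :* x₂ :* x₂ :+ o))
          :+ con (ℤ.- + 1) :* (y₁ :* y₁ :- (x₁ :* x₁ :* x₁ :+ o)))
        refl _ x₁ y₁ x₂ y₂ 1#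
       ⇐ _ ⊡ md≈ ⊞ _ ⊡ e₂ ⊞ _ ⊡ e₁)))
    refl refl
    where
    open Solver
    d≉0 : ¬ (x₂ - x₁ ≈ 0#)
    d≉0 d≈0 = x₁≉x₂ (sym (x∙y⁻¹≈ε⇒x≈y x₂ x₁ d≈0))
    md≈ = trans (*-assoc _ _ _) (trans (*-congˡ (proj₁ (proj₂ (invertible (x₂ - x₁) _)))) (*-identityʳ _))

  isSum⇒⊕ : ∀ {P Q R} → IsSum P Q R → P ⊕ Q ≈ₚ R
  isSum⇒⊕ {P} {Q} = isSum-unique ≈ₚ-refl ≈ₚ-refl (⊕-isSum P Q)

  ⊖-cong : ∀ {P Q} → P ≈ₚ Q → ⊖ P ≈ₚ ⊖ Q
  ⊖-cong 𝒪            = 𝒪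
  ⊖-cong (affine p q) = affine p (-‿cong q)

  ⊖-involutive : ∀ P → ⊖ (⊖ P) ≈ₚ P
  ⊖-involutive 𝒪              = 𝒪
  ⊖-involutive (affine x y e) = affine refl (-‿involutive y)

  isSum-inverseʳ : ∀ P → IsSum P (⊖ P) 𝒪
  isSum-inverseʳ 𝒪              = 𝒪ˡ 𝒪
  isSum-inverseʳ (affine x y e) = opposite refl (sym (-‿involutive y))

  -- The third point of the line is the negative of the sum, hence `- y₃`; any two of the three
  -- points span the same line.
  slope-third : ∀ {m x₁ y₁ x₂ y₂ x₃ y₃} → Slope m x₁ y₁ x₂ y₂ →
                x₃ ≈ thirdX m x₁ x₂ → y₃ ≈ m * (x₁ - x₃) - y₁ → Slope m x₁ y₁ x₃ (- y₃)
  slope-third {m} {x₁} {y₁} {x₂} {y₂} {x₃} {y₃} (slope h k) hx hy = slope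
    (solve 5 (λ m x₁ y₁ x₃ y₃ → m :* (x₃ :- x₁) :- (:- y₃ :- y₁)
        := con (+ 1) :* (y₃ :- (m :* (x₁ :- x₃) :- y₁))) refl m x₁ y₁ x₃ y₃
      ⇐ _ ⊡ hy)
    (solve 7 (λ m x₁ y₁ x₂ y₂ x₃ y₃ → m :* (y₁ :+ :- y₃) :- (x₁ :* x₁ :+ x₁ :* x₃ :+ x₃ :* x₃)
        := con (+ 1) :* (m :* (y₁ :+ y₂) :- (x₁ :* x₁ :+ x₁ :* x₂ :+ x₂ :* x₂))
        :+ m :* (m :* (x₂ :- x₁) :- (y₂ :- y₁))
        :+ (:- m) :* (y₃ :- (m :* (x₁ :- x₃) :- y₁))
        :+ (x₂ :- x₃) :* (x₃ :- (m :* m :- x₁ :- x₂)))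
      refl m x₁ y₁ x₂ y₂ x₃ y₃
      ⇐ _ ⊡ k ⊞ _ ⊡ h ⊞ _ ⊡ hy ⊞ _ ⊡ hx)
    where open Solver

  slope-neg : ∀ {m x₁ y₁ x₂ y₂} → Slope m x₁ y₁ x₂ y₂ → Slope (- m) x₁ (- y₁) x₂ (- y₂)
  slope-neg {m} {x₁} {y₁} {x₂} {y₂} (slope h k) = slope
    (solve 5 (λ m x₁ y₁ x₂ y₂ → (:- m) :* (x₂ :- x₁) :- (:- y₂ :- :- y₁)
        := con (ℤ.- + 1) :* (m :* (x₂ :- x₁) :- (y₂ :- y₁))) refl m x₁ y₁ x₂ y₂
      ⇐ _ ⊡ h)
    (trans (solve 3 (λ m y₁ y₂ → (:- m) :* (:- y₁ :+ :- y₂) := m :* (y₁ :+ y₂)) refl m y₁ y₂) k)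
    where open Solver

  -- P, Q and -R lie on one line. Its reflection, of slope -m, contains R, -Q and -P.
  isSum-cancel : ∀ {P Q R} → IsSum P Q R → IsSum R (⊖ Q) P
  isSum-cancel (𝒪ˡ 𝒪)            = 𝒪ˡ 𝒪
  isSum-cancel (𝒪ˡ (affine x y)) = opposite (sym x) (trans (sym y) (sym (-‿involutive _)))
  isSum-cancel (𝒪ʳ P≈R)          = 𝒪ʳ (≈ₚ-sym P≈R)
  isSum-cancel (opposite x y)    = 𝒪ˡ (affine (sym x) (sym y))
  isSum-cancel (line m {x₁ = x₁} {y₁} {_} {x₂} {y₂} {_} {x₃} {y₃} s x₃≈ y₃≈) = line (- m)
    (slope-cong refl refl (-‿involutive y₃) refl refl
      (slope-neg (slope-sym (slope-third (slope-sym s) x₃≈′ y₃≈′))))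
    (solve 4 (λ m x₁ x₂ x₃ → x₁ :- ((:- m) :* (:- m) :- x₃ :- x₂)
        := con (+ 1) :* (x₃ :- (m :* m :- x₁ :- x₂))) refl m x₁ x₂ x₃
      ⇐ _ ⊡ x₃≈)
    (solve 5 (λ m x₁ x₃ y₁ y₃ → y₁ :- ((:- m) :* (x₃ :- x₁) :- y₃)
        := con (+ 1) :* (y₃ :- (m :* (x₁ :- x₃) :- y₁))) refl m x₁ x₃ y₁ y₃
      ⇐ _ ⊡ y₃≈)
    where
    open Solver
    x₃≈′ = trans x₃≈ (solve 3 (λ m x₁ x₂ → m :* m :- x₁ :- x₂ := m :* m :- x₂ :- x₁) refl m x₁ x₂)
    y₃≈′ = trans y₃≈ (thirdY-sym (Slope.chord s))

  -- With L the line AB and N the line through A + B and C, the sum of the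
  -- equations of L and N vanishes at x(A + B), and (n + l)(y₃ - L(x₃)) is
  -- (x₃ - x₁)(x₃ - x₂).  The right-hand side x₃ - x₁ is antisymmetric in A and
  -- C, which is what makes the addition associative.
  slope-sum : ∀ {l m n x₁ y₁ x₂ y₂ x₃ y₃ x₄ y₄} → y₂ ² ≈ x₂ ³ + 1# →
              Slope l x₁ y₁ x₂ y₂ → Slope m x₂ y₂ x₃ y₃ →
              x₄ ≈ thirdX l x₁ x₂ → y₄ ≈ l * (x₁ - x₄) - y₁ →
              Slope n x₄ y₄ x₃ y₃ → (n + l) * (m - l) ≈ x₃ - x₁
  slope-sum {l} {m} {n} {x₁} {y₁} {x₂} {y₂} {x₃} {y₃} {x₄} {y₄} e₂ sl@(slope hl kl) sm@(slope hm km) hx₄ hy₄ (slope hn kn)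
    with x₂ ≟ x₃
  ... | no  x₂≉x₃ = *-cancelˡ-≉0 (λ d≈0 → x₂≉x₃ (sym (x∙y⁻¹≈ε⇒x≈y x₃ x₂ d≈0)))
      (solve 11 (λ l m n x₁ y₁ x₂ y₂ x₃ y₃ x₄ y₄ →
          (x₃ :- x₂) :* ((n :+ l) :* (m :- l)) :- (x₃ :- x₂) :* (x₃ :- x₁)
          := (n :+ l) :* (m :* (x₃ :- x₂) :- (y₃ :- y₂))
          :+ (n :+ l) :* (l :* (x₂ :- x₁) :- (y₂ :- y₁))
          :+ (:- n) :* (y₄ :- (l :* (x₁ :- x₄) :- y₁))
          :+ con (+ 1) :* (n :* (y₄ :+ y₃) :- (x₄ :* x₄ :+ x₄ :* x₃ :+ x₃ :* x₃))
          :+ (:- l) :* (n :* (x₃ :- x₄) :- (y₃ :- y₄))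
          :+ con (ℤ.- + 1) :* (l :* (y₁ :+ :- y₄) :- (x₁ :* x₁ :+ x₁ :* x₄ :+ x₄ :* x₄))
          :+ (x₃ :- x₁) :* (x₄ :- (l :* l :- x₁ :- x₂)))
        refl l m n x₁ y₁ x₂ y₂ x₃ y₃ x₄ y₄
      ⇐ _ ⊡ hm ⊞ _ ⊡ hl ⊞ _ ⊡ hy₄ ⊞ _ ⊡ kn ⊞ _ ⊡ hn ⊞ _ ⊡ Slope.tangent (slope-third sl hx₄ hy₄) ⊞ _ ⊡ hx₄)
    where open Solver
  -- Here B = C, so that x₃ - x₂ cannot be cancelled. The line BC is a tangent, and 2y₃ takes over:
  -- it is nonzero because B and C are not opposite.
  ... | yes x₂≈x₃ = *-cancelˡ-≉0 2y₃≉0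
      (solve 9 (λ l m n x₁ y₁ x₃ y₃ x₄ y₄ →
          (y₃ :+ y₃) :* ((n :+ l) :* (m :- l)) :- (y₃ :+ y₃) :* (x₃ :- x₁)
          := (n :+ l) :* (m :* (y₃ :+ y₃) :- (x₃ :* x₃ :+ x₃ :* x₃ :+ x₃ :* x₃))
          :+ (:- (n :+ l)) :* (l :* (y₁ :+ y₃) :- (x₁ :* x₁ :+ x₁ :* x₃ :+ x₃ :* x₃))
          :+ ((n :+ l) :* l :+ (x₃ :- x₁)) :* (l :* (x₃ :- x₁) :- (y₃ :- y₁))
          :+ (n :+ l) :* (x₃ :- x₁) :* (x₄ :- (l :* l :- x₁ :- x₃))
          :+ (x₃ :- x₁) :* (n :* (x₃ :- x₄) :- (y₃ :- y₄))
          :+ (:- (x₃ :- x₁)) :* (y₄ :- (l :* (x₁ :- x₄) :- y₁)))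
        refl l m n x₁ y₁ x₃ y₃ x₄ y₄
      ⇐ _ ⊡ Slope.tangent sm′ ⊞ _ ⊡ Slope.tangent sl′ ⊞ _ ⊡ Slope.chord sl′ ⊞ _ ⊡ trans hx₄ (+-congˡ (-‿cong x₂≈x₃)) ⊞ _ ⊡ hn ⊞ _ ⊡ hy₄)
    where
    open Solver
    y₂≈y₃ : y₂ ≈ y₃
    y₂≈y₃ = sym (x∙y⁻¹≈ε⇒x≈y y₃ y₂ (trans (sym hm)
      (trans (*-congˡ (trans (+-congˡ (-‿cong x₂≈x₃)) (-‿inverseʳ x₃))) (zeroʳ m))))
    2y₃≉0 : ¬ (y₃ + y₃ ≈ 0#)
    2y₃≉0 t≈0 = slope-not-opposite e₂ sm x₂≈x₃ (+-inverseˡ-unique y₂ y₃ (trans (+-congʳ y₂≈y₃) t≈0))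
    sl′ = slope-cong refl refl refl x₂≈x₃ y₂≈y₃ sl
    sm′ = slope-cong refl x₂≈x₃ y₂≈y₃ refl refl sm

  private
    -- Here l, m, n, p are the slopes of AB, BC, (A + B)C and A(B + C). `slope-sum` for A, B, C and
    -- for C, B, A gives (m - l)(n + l) = (m - l)(p + m). If m = l, then A = C; otherwise n + l = p
    -- + m, and both coordinates of the two sums agree.
    assoc-line : ∀ {l m n p x₁ y₁ x₂ y₂ x₃ y₃ x₄ y₄ x₅ y₅ x₆ y₆ x₇ y₇ e₆ e₇} →
      y₂ ² ≈ x₂ ³ + 1# → ¬ (x₁ ≈ x₃ × y₁ ≈ y₃) →
      Slope l x₁ y₁ x₂ y₂ → x₄ ≈ thirdX l x₁ x₂ → y₄ ≈ l * (x₁ - x₄) - y₁ →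
      Slope m x₂ y₂ x₃ y₃ → x₅ ≈ thirdX m x₂ x₃ → y₅ ≈ m * (x₂ - x₅) - y₂ →
      Slope n x₄ y₄ x₃ y₃ → x₆ ≈ thirdX n x₄ x₃ → y₆ ≈ n * (x₄ - x₆) - y₄ →
      Slope p x₁ y₁ x₅ y₅ → x₇ ≈ thirdX p x₁ x₅ → y₇ ≈ p * (x₁ - x₇) - y₁ →
      affine x₆ y₆ e₆ ≈ₚ affine x₇ y₇ e₇
    assoc-line {l} {m} {n} {p} {x₁} {y₁} {x₂} {y₂} {x₃} {y₃} {x₄} {y₄} {x₅} {y₅} {x₆} {y₆} {x₇} {y₇}
      e₂ A≉C sl hx₄ hy₄ sm hx₅ hy₅ sn hx₆ hy₆ sp hx₇ hy₇ = affine x₆≈x₇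
      (solve 15 (λ l m n p x₁ y₁ x₂ y₂ x₃ y₃ x₄ x₆ y₆ x₇ y₇ → y₆ :- y₇
          := con (+ 1) :* (y₆ :- (n :* (x₃ :- x₆) :- y₃))
          :+ con (ℤ.- + 1) :* (y₇ :- (p :* (x₁ :- x₇) :- y₁))
          :+ (:- p) :* (x₆ :- x₇)
          :+ (x₁ :- x₆) :* (n :+ l :- (p :+ m))
          :+ con (+ 1) :* (m :* (x₃ :- x₂) :- (y₃ :- y₂))
          :+ con (+ 1) :* (l :* (x₂ :- x₁) :- (y₂ :- y₁))
          :+ (l :- m) :* (x₆ :- (n :* n :- x₄ :- x₃))
          :+ (m :- l) :* (x₄ :- (l :* l :- x₁ :- x₂))
          :+ (l :- n) :* ((n :+ l) :* (m :- l) :- (x₃ :- x₁)))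
        refl l m n p x₁ y₁ x₂ y₂ x₃ y₃ x₄ x₆ y₆ x₇ y₇
       ⇐ _ ⊡ trans hy₆ (thirdY-sym (Slope.chord sn)) ⊞ _ ⊡ hy₇ ⊞ _ ⊡ x₆≈x₇ ⊞ _ ⊡ n+l≈p+m
         ⊞ _ ⊡ Slope.chord sm ⊞ _ ⊡ Slope.chord sl ⊞ _ ⊡ hx₆ ⊞ _ ⊡ hx₄ ⊞ _ ⊡ nl)
      where
      open Solver
      nl : (n + l) * (m - l) ≈ x₃ - x₁
      nl = slope-sum e₂ sl sm hx₄ hy₄ sn
      pm : (p + m) * (l - m) ≈ x₁ - x₃
      pm = slope-sum e₂ (slope-sym sm) (slope-sym sl)
        (trans hx₅ (solve 3 (λ m x₂ x₃ → m :* m :- x₂ :- x₃ := m :* m :- x₃ :- x₂) refl m x₂ x₃))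
        (trans hy₅ (thirdY-sym (Slope.chord sm))) (slope-sym sp)
      m≉l : ¬ (m - l ≈ 0#)
      m≉l m-l≈0 = A≉C (sym x₃≈x₁ ,
        (solve 8 (λ l m x₁ y₁ x₂ y₂ x₃ y₃ → y₁ :- y₃
            := con (+ 1) :* (m :* (x₃ :- x₂) :- (y₃ :- y₂))
            :+ con (+ 1) :* (l :* (x₂ :- x₁) :- (y₂ :- y₁))
            :+ (:- m) :* (x₃ :- x₁)
            :+ (x₂ :- x₁) :* (m :- l))
          refl l m x₁ y₁ x₂ y₂ x₃ y₃
        ⇐ (_ ⊡ Slope.chord sm ⊞ _ ⊡ Slope.chord sl ⊞ _ ⊡ x₃≈x₁ ⊞ trans (*-congˡ m-l≈0) (zeroʳ _))))
        where
        x₃≈x₁ : x₃ ≈ x₁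
        x₃≈x₁ = x∙y⁻¹≈ε⇒x≈y x₃ x₁ (trans (sym nl) (trans (*-congˡ m-l≈0) (zeroʳ _)))
      n+l≈p+m : n + l ≈ p + m
      n+l≈p+m = *-cancelˡ-≉0 m≉l
        (solve 6 (λ l m n p x₁ x₃ → (m :- l) :* (n :+ l) :- (m :- l) :* (p :+ m)
            := con (+ 1) :* ((n :+ l) :* (m :- l) :- (x₃ :- x₁))
            :+ con (+ 1) :* ((p :+ m) :* (l :- m) :- (x₁ :- x₃)))
          refl l m n p x₁ x₃
        ⇐ _ ⊡ nl ⊞ _ ⊡ pm)
      x₆≈x₇ : x₆ ≈ x₇
      x₆≈x₇ = solve 11 (λ l m n p x₁ x₂ x₃ x₄ x₅ x₆ x₇ → x₆ :- x₇
            := con (+ 1) :* (x₆ :- (n :* n :- x₄ :- x₃))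
            :+ con (ℤ.- + 1) :* (x₇ :- (p :* p :- x₁ :- x₅))
            :+ con (ℤ.- + 1) :* (x₄ :- (l :* l :- x₁ :- x₂))
            :+ con (+ 1) :* (x₅ :- (m :* m :- x₂ :- x₃))
            :+ (n :+ l :+ p :- m) :* (n :+ l :- (p :+ m))
            :+ con (+ 2) :* ((n :+ l) :* (m :- l) :- (x₃ :- x₁)))
          refl l m n p x₁ x₂ x₃ x₄ x₅ x₆ x₇
        ⇐ _ ⊡ hx₆ ⊞ _ ⊡ hx₇ ⊞ _ ⊡ hx₄ ⊞ _ ⊡ hx₅ ⊞ _ ⊡ n+l≈p+m ⊞ _ ⊡ nl

    -- Both sides equal R, the second one as (Q + R) - Q.
    assoc-opposite₁ : ∀ {P Q R E F F′} → P ≈ₚ ⊖ Q → IsSum Q R E → IsSum 𝒪 R F → IsSum P E F′ → F ≈ₚ F′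
    assoc-opposite₁ P≈⊖Q QR 𝒪R PE = ≈ₚ-trans
      (isSum-unique ≈ₚ-refl ≈ₚ-refl 𝒪R (𝒪ˡ ≈ₚ-refl))
      (isSum-unique ≈ₚ-refl (≈ₚ-sym P≈⊖Q) (isSum-cancel (isSum-comm QR)) (isSum-comm PE))

    -- P + Q = D gives Q - D = -P, and -D = R. Hence Q + R = -P, and both sides vanish.
    assoc-opposite₂ : ∀ {P Q R D E F′} → IsSum P Q D → IsSum Q R E → D ≈ₚ ⊖ R → IsSum P E F′ → 𝒪 ≈ₚ F′
    assoc-opposite₂ {P} {R = R} PQ QR D≈⊖R PE = isSum-unique ≈ₚ-refl
      (isSum-unique ≈ₚ-refl (≈ₚ-trans (⊖-cong D≈⊖R) (⊖-involutive R))
        (isSum-cancel (isSum-comm (isSum-cancel (isSum-comm PQ)))) QR)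
      (isSum-inverseʳ P) PE

  -- The slopes are needed only when all four sums are proper lines. A summand 𝒪 is handled by
  -- uniqueness, a vanishing sum by cancellation, directly or with the roles of P and R exchanged.
  isSum-assoc : ∀ {P Q R D E F F′} → IsSum P Q D → IsSum Q R E → IsSum D R F → IsSum P E F′ → F ≈ₚ F′
  isSum-assoc (𝒪ˡ Q≈D) QR DR (𝒪ˡ E≈F′) =
    ≈ₚ-trans (isSum-unique (≈ₚ-sym Q≈D) ≈ₚ-refl DR QR) E≈F′
  isSum-assoc (𝒪ˡ Q≈D) QR DR (𝒪ʳ 𝒪≈F′) =
    ≈ₚ-trans (isSum-unique (≈ₚ-sym Q≈D) ≈ₚ-refl DR QR) 𝒪≈F′
  isSum-assoc (𝒪ʳ P≈D) (𝒪ˡ R≈E) DR PE = isSum-unique (≈ₚ-sym P≈D) R≈E DR PE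
  isSum-assoc (𝒪ʳ P≈D) (𝒪ʳ R≈E) DR PE = isSum-unique (≈ₚ-sym P≈D) R≈E DR PE
  isSum-assoc PQ (𝒪ʳ Q≈E) (𝒪ʳ D≈F) PE =
    ≈ₚ-trans (≈ₚ-sym D≈F) (isSum-unique ≈ₚ-refl Q≈E PQ PE)
  isSum-assoc PQ (𝒪ʳ Q≈E) (𝒪ˡ D≈F) PE =
    ≈ₚ-trans (≈ₚ-sym D≈F) (isSum-unique ≈ₚ-refl Q≈E PQ PE)
  isSum-assoc (opposite x y) QR DR PE = assoc-opposite₁ (affine x y) QR DR PE
  isSum-assoc PQ (opposite x y) DR PE = ≈ₚ-sym (assoc-opposite₁
    (affine (sym x) (trans (sym (-‿involutive _)) (-‿cong (sym y)))) (isSum-comm PQ) (isSum-comm PE) (isSum-comm DR))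
  isSum-assoc PQ QR (opposite x y) PE = assoc-opposite₂ PQ QR (affine x y) PE
  isSum-assoc PQ QR DR (opposite x y) = ≈ₚ-sym (assoc-opposite₂ (isSum-comm QR) (isSum-comm PQ)
    (affine (sym x) (trans (sym (-‿involutive _)) (-‿cong (sym y)))) (isSum-comm DR))
  isSum-assoc PQ@(line l {x₁ = x₁} {y₁} {e₂ = e₂} sl hx₄ hy₄) QR@(line m {x₂ = x₃} {y₃} sm hx₅ hy₅)
              DR@(line n sn hx₆ hy₆) PE@(line p sp hx₇ hy₇)
    with (x₁ ≟ x₃) ×-dec (y₁ ≟ y₃)
  ... | no  P≉R     = assoc-line e₂ P≉R sl hx₄ hy₄ sm hx₅ hy₅ sn hx₆ hy₆ sp hx₇ hy₇
  -- If A = C, then A + B = B + C, and associativity is commutativity.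
  ... | yes (x , y) = isSum-unique (isSum-unique (affine x y) ≈ₚ-refl PQ (isSum-comm QR))
                                   (affine (sym x) (sym y)) DR (isSum-comm PE)

  ⊕-assoc : ∀ P Q R → (P ⊕ Q) ⊕ R ≈ₚ P ⊕ (Q ⊕ R)
  ⊕-assoc P Q R = isSum-assoc (⊕-isSum P Q) (⊕-isSum Q R) (⊕-isSum (P ⊕ Q) R) (⊕-isSum P (Q ⊕ R))

  ⊕-isAbelianGroup : IsAbelianGroup _≈ₚ_ _⊕_ 𝒪 ⊖_
  ⊕-isAbelianGroup = record
    { isGroup = record
      { isMonoid = record
        { isSemigroup = record
          { isMagma = record
            { isEquivalence = record { refl = ≈ₚ-refl ; sym = ≈ₚ-sym ; trans = ≈ₚ-trans }
            ; ∙-cong = λ {P} {P′} {Q} {Q′} p q → isSum-unique p q (⊕-isSum P Q) (⊕-isSum P′ Q′) }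
          ; assoc = ⊕-assoc }
        ; identity = (λ _ → ≈ₚ-refl) , (λ P → isSum⇒⊕ (𝒪ʳ ≈ₚ-refl)) }
      ; inverse = (λ P → isSum⇒⊕ (isSum-comm (isSum-inverseʳ P))) , (λ P → isSum⇒⊕ (isSum-inverseʳ P))
      ; ⁻¹-cong = ⊖-cong }
    ; comm = λ P Q → isSum⇒⊕ (isSum-comm (⊕-isSum Q P)) }

  ⊕-abelianGroup : AbelianGroup _ _
  ⊕-abelianGroup = record { isAbelianGroup = ⊕-isAbelianGroup }

-- Torsion in abelian groups

infix 4 _≡_[mod_]
_≡_[mod_] : ℤ → ℤ → ℕ → Set
i ≡ j [mod n ] = RawGroup._≈_ (ℤ/ n ℤ) i j

-- Congruences are exchanged for equations with an explicit quotient, which the ring solver can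
-- treat.
≡⇒mod : ∀ {n i j} (q : ℤ) → i ≡ j ℤ.+ q ℤ.* + n → i ≡ j [mod n ]
≡⇒mod {n} {i} {j} q eq = Signed.∣⇒∣ᵤ (Signed.divides q
  (≡.trans (≡.cong (ℤ._- j) eq) (lemma j (q ℤ.* + n))))
  where
  lemma : ∀ j k → j ℤ.+ k ℤ.- j ≡ k
  lemma = ℤSolver.solve-∀

mod-quotient : ∀ {n i j} → i ≡ j [mod n ] → ∃[ q ] i ≡ j ℤ.+ q ℤ.* + n
mod-quotient {n} {i} {j} h with Signed.∣ᵤ⇒∣ h
... | Signed.divides q eq = q , ≡.trans (lemma i j) (≡.cong (ℤ._+_ j) eq)
  where
  lemma : ∀ i j → i ≡ j ℤ.+ (i ℤ.- j)
  lemma = ℤSolver.solve-∀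

mod-trans : ∀ {n i j k} → i ≡ j [mod n ] → j ≡ k [mod n ] → i ≡ k [mod n ]
mod-trans {n} {i} {j} {k} h h′ with mod-quotient {n} {i} {j} h | mod-quotient {n} {j} {k} h′
... | q , eq | q′ , eq′ = ≡⇒mod {n} {i} {k} (q ℤ.+ q′)
    (≡.trans eq (≡.trans (≡.cong (ℤ._+ q ℤ.* + n) eq′) (lemma k q q′ (+ n))))
  where
  lemma : ∀ k q q′ n → k ℤ.+ q′ ℤ.* n ℤ.+ q ℤ.* n ≡ k ℤ.+ (q ℤ.+ q′) ℤ.* n
  lemma = ℤSolver.solve-∀

-- `r + m * s` is r - s plus s times `suc m`: it stands for the difference without leaving ℕ.
∣+*⇒mod : ∀ {m} r s → suc m ∣ r ℕ.+ m ℕ.* s → + r ≡ + s [mod suc m ]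
∣+*⇒mod {m} r s (divides q eq) = ≡⇒mod {suc m} {+ r} {+ s} (+ q ℤ.- + s) (begin
  + r                                                ≡⟨ lemma (+ r) (+ m) (+ s) ⟩
  + r ℤ.+ + m ℤ.* + s ℤ.- + m ℤ.* + s                ≡⟨ ≡.cong (ℤ._- + m ℤ.* + s) eqℤ ⟩
  + q ℤ.* + suc m ℤ.- + m ℤ.* + s                    ≡⟨ lemma′ (+ q) (+ m) (+ s) ⟩
  + s ℤ.+ (+ q ℤ.- + s) ℤ.* + suc m                  ∎)
  where
  open ≡.≡-Reasoning
  lemma : ∀ r m s → r ≡ r ℤ.+ m ℤ.* s ℤ.- m ℤ.* s
  lemma = ℤSolver.solve-∀
  lemma′ : ∀ q m s → q ℤ.* (ℤ.1ℤ ℤ.+ m) ℤ.- m ℤ.* s ≡ s ℤ.+ (q ℤ.- s) ℤ.* (ℤ.1ℤ ℤ.+ m)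
  lemma′ = ℤSolver.solve-∀
  eqℤ : + r ℤ.+ + m ℤ.* + s ≡ + q ℤ.* + suc m
  eqℤ = ≡.trans (≡.cong (ℤ._+_ (+ r)) (≡.sym (ℤ.pos-* m s)))
          (≡.trans (≡.cong +_ eq) (ℤ.pos-* q (suc m)))

mod-isGroup : ∀ n → let open RawGroup (ℤ/ n ℤ) in IsGroup _≈_ _∙_ ε _⁻¹
mod-isGroup n = record
  { isMonoid = record
    { isSemigroup = record
      { isMagma = record
        { isEquivalence = record
          { refl  = λ {i} → mod-refl i
          ; sym   = λ {i} {j} h → let q , eq = mod-quotient {n} {i} {j} h in
              ≡⇒mod {n} {j} {i} (ℤ.- q) (≡.trans (sym-lemma j q (+ n)) (≡.cong (ℤ._+ ℤ.- q ℤ.* + n) (≡.sym eq)))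
          ; trans = λ {i} {j} {k} → mod-trans {n} {i} {j} {k} }
        ; ∙-cong = λ {i} {j} {k} {l} h h′ →
            let q , eq = mod-quotient {n} {i} {j} h ; q′ , eq′ = mod-quotient {n} {k} {l} h′ in
            ≡⇒mod {n} {i ℤ.+ k} {j ℤ.+ l} (q ℤ.+ q′)
              (≡.trans (≡.cong₂ ℤ._+_ eq eq′) (cong-lemma j l q q′ (+ n))) }
      ; assoc = λ i j k → mod-reflexive (ℤ.+-assoc i j k) }
    ; identity = (λ i → mod-reflexive (ℤ.+-identityˡ i)) , (λ i → mod-reflexive (ℤ.+-identityʳ i)) }
  ; inverse = (λ i → mod-reflexive (ℤ.+-inverseˡ i)) , (λ i → mod-reflexive (ℤ.+-inverseʳ i))
  ; ⁻¹-cong = λ {i} {j} h → let q , eq = mod-quotient {n} {i} {j} h in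
      ≡⇒mod {n} {ℤ.- i} {ℤ.- j} (ℤ.- q) (≡.trans (≡.cong (λ k → ℤ.- k) eq) (neg-lemma j q (+ n)))
  }
  where
  mod-refl : ∀ i → i ≡ i [mod n ]
  mod-refl i = ≡⇒mod {n} {i} {i} ℤ.0ℤ (≡.sym (ℤ.+-identityʳ i))
  mod-reflexive : ∀ {i j} → i ≡ j → i ≡ j [mod n ]
  mod-reflexive {i} ≡.refl = mod-refl i
  sym-lemma : ∀ j q n → j ≡ j ℤ.+ q ℤ.* n ℤ.+ ℤ.- q ℤ.* n
  sym-lemma = ℤSolver.solve-∀
  cong-lemma : ∀ j l q q′ n → (j ℤ.+ q ℤ.* n) ℤ.+ (l ℤ.+ q′ ℤ.* n) ≡ j ℤ.+ l ℤ.+ (q ℤ.+ q′) ℤ.* n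
  cong-lemma = ℤSolver.solve-∀
  neg-lemma : ∀ j q n → ℤ.- (j ℤ.+ q ℤ.* n) ≡ ℤ.- j ℤ.+ ℤ.- q ℤ.* n
  neg-lemma = ℤSolver.solve-∀

ℤ/-group : ℕ → Group _ _
ℤ/-group n = record { isGroup = mod-isGroup n }

ℕ-surjects : ∀ m i → ∃[ r ] + r ≡ i [mod suc m ]
ℕ-surjects m i = r , ≡⇒mod {suc m} {+ r} {i} (ℤ.- q)
  (≡.trans (lemma (+ r) q (+ suc m)) (≡.cong (ℤ._+ ℤ.- q ℤ.* + suc m) (≡.sym (ℤ.a≡a%ℕn+[a/ℕn]*n i (suc m)))))
  where
  r = i ℤ.%ℕ suc m
  q = i ℤ./ℕ suc m
  lemma : ∀ r q n → r ≡ r ℤ.+ q ℤ.* n ℤ.+ ℤ.- q ℤ.* n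
  lemma = ℤSolver.solve-∀

module Torsion {a ℓ} (G : AbelianGroup a ℓ) where
  open AbelianGroup G renaming (rawGroup to raw)
  open MonoidMult monoid public renaming (_×_ to infixr 8 _·_)
  open CommutativeMonoidMult commutativeMonoid public using (×-distrib-+)
  open AbelianGroupProperties G
  open CommutativeSemigroupProperties commutativeSemigroup using (interchange)
  open SetoidReasoning setoid

  ·-ε : ∀ n → n · ε ≈ ε
  ·-ε zero    = refl
  ·-ε (suc n) = trans (identityˡ _) (·-ε n)

  ·-⁻¹ : ∀ n x → n · (x ⁻¹) ≈ (n · x) ⁻¹
  ·-⁻¹ n x = inverseˡ-unique (n · (x ⁻¹)) (n · x)
    (trans (sym (×-distrib-+ (x ⁻¹) x n)) (trans (×-congʳ n (inverseˡ x)) (·-ε n)))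

  multiple≈ε : ∀ {n x} m → n · x ≈ ε → (m ℕ.* n) · x ≈ ε
  multiple≈ε {n} {x} m nx≈ε = trans (sym (×-assocˡ x m n)) (trans (×-congʳ m nx≈ε) (·-ε m))

  isTorsion-isSubgroup : IsSubgroup raw (IsTorsion raw)
  isTorsion-isSubgroup = record
    { ∙-closed = λ { {x} {y} (m , m≢0 , mx≈ε) (n , n≢0 , ny≈ε) →
        m ℕ.* n , ℕ.m*n≢0 m n {{m≢0}} {{n≢0}} ,
        trans (×-distrib-+ x y (m ℕ.* n)) (trans
          (∙-cong (trans (×-congˡ (ℕ.*-comm m n)) (multiple≈ε n mx≈ε)) (multiple≈ε m ny≈ε))
          (identityˡ ε)) }
    ; ε-closed = 1 , _ , identityˡ ε
    ; ⁻¹-closed = λ { {x} (n , n≢0 , nx≈ε) →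
        n , n≢0 , trans (·-⁻¹ n x) (trans (⁻¹-cong nx≈ε) ε⁻¹≈ε) } }

  open IsSubgroup isTorsion-isSubgroup public using ()
    renaming (∙-closed to torsion-∙; ε-closed to torsion-ε; ⁻¹-closed to torsion-⁻¹)

  torsion-· : ∀ {x} n → IsTorsion raw x → IsTorsion raw (n · x)
  torsion-· zero    h = torsion-ε
  torsion-· (suc n) h = torsion-∙ h (torsion-· n h)

  ·-% : ∀ {n x} .{{_ : NonZero n}} k → n · x ≈ ε → k · x ≈ (k ℕ.% n) · x
  ·-% {n} {x} k nx≈ε = begin
    k · x                                       ≈⟨ ×-congˡ (ℕ.m≡m%n+[m/n]*n k n) ⟩
    (k ℕ.% n ℕ.+ k ℕ./ n ℕ.* n) · x             ≈⟨ ×-homo-+ x (k ℕ.% n) (k ℕ./ n ℕ.* n) ⟩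
    (k ℕ.% n) · x ∙ (k ℕ./ n ℕ.* n) · x         ≈⟨ ∙-congˡ (multiple≈ε (k ℕ./ n) nx≈ε) ⟩
    (k ℕ.% n) · x ∙ ε                           ≈⟨ identityʳ _ ⟩
    (k ℕ.% n) · x                               ∎

  -- If nx = 0, then 2^i x depends only on 2^i modulo n, and n + 1 exponents share n residues.
  doubling-repeats : ∀ {x} → IsTorsion raw x →
                     ∃[ i ] ∃[ j ] i ℕ.< j × (2 ℕ.^ i) · x ≈ (2 ℕ.^ j) · x
  doubling-repeats {x} (n , n≢0 , nx≈ε) with Fin.pigeonhole ℕ.≤-refl residue
    where
    residue : Fin (suc n) → Fin n
    residue k = Fin.fromℕ< (ℕ.m%n<n (2 ℕ.^ Fin.toℕ k) n {{n≢0}})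
  ... | i , j , i<j , eq = Fin.toℕ i , Fin.toℕ j , i<j , (begin
    (2 ℕ.^ Fin.toℕ i) · x             ≈⟨ ·-% {{n≢0}} (2 ℕ.^ Fin.toℕ i) nx≈ε ⟩
    (ℕ._%_ (2 ℕ.^ Fin.toℕ i) n {{n≢0}}) · x  ≈⟨ ×-congˡ (Fin.fromℕ<-injective _ _ _ _ eq) ⟩
    (ℕ._%_ (2 ℕ.^ Fin.toℕ j) n {{n≢0}}) · x  ≈⟨ ·-% {{n≢0}} (2 ℕ.^ Fin.toℕ j) nx≈ε ⟨
    (2 ℕ.^ Fin.toℕ j) · x             ∎)

  module _ {p} (Level : ℕ → Carrier → Set p)
           (resp   : ∀ {i x y} → x ≈ y → Level i x → Level i y)
           (unique : ∀ {i j x} → Level i x → Level j x → i ≡ j)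
           (double : ∀ {i x} → Level i x → ∃[ j ] i ℕ.< j × Level j (x ∙ x))
           where

    -- Were x torsion, two of the elements x, 2x, 4x, ... would coincide; but their levels increase
    -- strictly, and an element has at most one level.
    level⇒¬torsion : ∀ {i x} → Level i x → ¬ IsTorsion raw x
    level⇒¬torsion {i} {x} h tors with doubling-repeats tors
    ... | j , k , j<k , eq = ℕ.<-irrefl (unique (resp eq (proj₂ (levels j))) (proj₂ (levels k))) (increasing j<k)
      where
      2·_ : ∀ x → x ∙ x ≈ 2 · x
      2· x = ∙-congˡ (sym (identityʳ x))

      levels-suc : ∀ k → ∃[ i ] Level i ((2 ℕ.^ k) · x) → ∃[ i ] Level i ((2 ℕ.^ suc k) · x)
      levels-suc k (i , h) with double h
      ... | j , _ , h′ = j , resp (trans (2· _) (×-assocˡ x 2 (2 ℕ.^ k))) h′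

      levels : ∀ k → ∃[ i ] Level i ((2 ℕ.^ k) · x)
      levels zero    = i , resp (sym (×-homo-1 x)) h
      levels (suc k) = levels-suc k (levels k)

      increasing : ∀ {j k} → j ℕ.< k → proj₁ (levels j) ℕ.< proj₁ (levels k)
      increasing {j} {suc k} j<1+k with ℕ.m≤n⇒m<n∨m≡n (ℕ.s≤s⁻¹ j<1+k)
      ... | inj₁ j<k    = ℕ.<-trans (increasing j<k) (proj₁ (proj₂ (double (proj₂ (levels k)))))
      ... | inj₂ ≡.refl = proj₁ (proj₂ (double (proj₂ (levels k))))

  HasOrder : Carrier → ℕ → Set ℓ
  HasOrder x n = n · x ≈ ε × (∀ k → k · x ≈ ε → n ∣ k)

  -- Adding m · s to both sides turns the right-hand side into a multiple of
  -- suc m and avoids subtraction.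
  order-mod : ∀ {m x} r s → HasOrder x (suc m) → r · x ≈ s · x → + r ≡ + s [mod suc m ]
  order-mod {m} {x} r s (order , minimal) eq = ∣+*⇒mod r s (minimal (r ℕ.+ m ℕ.* s) (begin
    (r ℕ.+ m ℕ.* s) · x       ≈⟨ ×-homo-+ x r (m ℕ.* s) ⟩
    r · x ∙ (m ℕ.* s) · x     ≈⟨ ∙-congʳ eq ⟩
    s · x ∙ (m ℕ.* s) · x     ≈⟨ ×-homo-+ x s (m ℕ.* s) ⟨
    (suc m ℕ.* s) · x         ≈⟨ ×-congˡ (ℕ.*-comm (suc m) s) ⟩
    (s ℕ.* suc m) · x         ≈⟨ multiple≈ε s order ⟩
    ε                         ∎))

  module _ {b ℓ′ m} (H : Group b ℓ′) {M : Set m} (_+_ : M → M → M) (0# : M)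
           (φ : M → Carrier) (χ : M → Group.Carrier H) where
    private module H = Group H

    module _ (φ-+ : ∀ u v → φ (u + v) ≈ φ u ∙ φ v) (φ-0 : φ 0# ≈ ε)
             (χ-+ : ∀ u v → χ (u + v) H.≈ χ u H.∙ χ v) (χ-0 : χ 0# H.≈ H.ε)
             (φ⇒χ : ∀ u v → φ u ≈ φ v → χ u H.≈ χ v)
             (χ⇒φ : ∀ u v → χ u H.≈ χ v → φ u ≈ φ v)
             (torsion-φ : ∀ u → IsTorsion raw (φ u))
             (φ-onto : ∀ x → IsTorsion raw x → ∃[ u ] x ≈ φ u)
             (χ-onto : ∀ h → ∃[ u ] χ u H.≈ h) where

      -- Both groups are parametrised by the same codes, and two codes agree in one group exactly
      -- when they agree in the other. Codes need only a sum and a zero, such as natural multiples: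
      -- compatibility with inverses follows from compatibility with the operation.
      torsion-≅ : IsSubgroup.subgroup isTorsion-isSubgroup ≅ H.rawGroup
      torsion-≅ = ⟦_⟧ , record
        { isGroupMonomorphism = record
          { isGroupHomomorphism = record
            { isMonoidHomomorphism = record
              { isMagmaHomomorphism = record
                { isRelHomomorphism = record { cong = λ {x} {y} x≈y →
                    φ⇒χ _ _ (trans (sym (φ-code x)) (trans x≈y (φ-code y))) }
                ; homo = ∙-homo }
              ; ε-homo = ε-homo }
            ; ⁻¹-homo = λ x → H-inverseˡ-unique _ _ (H.trans (H.sym (∙-homo (inv x) x))
                (H.trans (φ⇒χ _ _ (trans (sym (φ-code _)) (trans (inverseˡ _) (φ-code (ε , torsion-ε))))) ε-homo)) }
          ; injective = λ {x} {y} h → trans (φ-code x) (trans (χ⇒φ _ _ h) (sym (φ-code y))) }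
        ; surjective = λ h → let u , χu≈h = χ-onto h in (φ u , torsion-φ u) ,
            λ {z} z≈φu → H.trans (φ⇒χ _ _ (trans (sym (φ-code z)) z≈φu)) χu≈h }
        where
        module S = RawGroup (IsSubgroup.subgroup isTorsion-isSubgroup)
        open GroupProperties H using () renaming (inverseˡ-unique to H-inverseˡ-unique)
        inv : S.Carrier → S.Carrier
        inv x = x S.⁻¹
        code : S.Carrier → M
        code (x , tx) = proj₁ (φ-onto x tx)
        φ-code : ∀ x → proj₁ x ≈ φ (code x)
        φ-code (x , tx) = proj₂ (φ-onto x tx)
        ⟦_⟧ : S.Carrier → H.Carrier
        ⟦ x ⟧ = χ (code x)
        ∙-homo : ∀ x y → ⟦ x S.∙ y ⟧ H.≈ ⟦ x ⟧ H.∙ ⟦ y ⟧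
        ∙-homo x y = H.trans (φ⇒χ _ _ (trans (sym (φ-code (x S.∙ y)))
          (trans (∙-cong (φ-code x) (φ-code y)) (sym (φ-+ _ _))))) (χ-+ _ _)
        ε-homo : ⟦ S.ε ⟧ H.≈ H.ε
        ε-homo = H.trans (φ⇒χ _ _ (trans (sym (φ-code S.ε)) (sym φ-0))) χ-0

  order-mod⁻¹ : ∀ {n x} r s → n · x ≈ ε → + r ≡ + s [mod n ] → r · x ≈ s · x
  order-mod⁻¹ {n} {x} r s nx≈ε h with mod-quotient {n} {+ r} {+ s} h
  ... | + q      , eq = trans (×-congˡ (ℤ.+-injective (≡.trans eq (≡.cong (ℤ._+_ (+ s)) (≡.sym (ℤ.pos-* q n))))))
      (trans (×-homo-+ x s (q ℕ.* n)) (trans (∙-congˡ (multiple≈ε q nx≈ε)) (identityʳ _)))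
  -- For a negative quotient the roles are exchanged: s is r plus `suc q` times n.
  ... | -[1+ q ] , eq = sym (trans (×-congˡ (ℤ.+-injective
        (≡.trans (lemma (+ s) -[1+ q ] (+ n)) (≡.trans (≡.cong (ℤ._+ + suc q ℤ.* + n) (≡.sym eq))
          (≡.cong (ℤ._+_ (+ r)) (≡.sym (ℤ.pos-* (suc q) n)))))))
      (trans (×-homo-+ x r (suc q ℕ.* n)) (trans (∙-congˡ (multiple≈ε {n} {x} (suc q) nx≈ε)) (identityʳ _))))
    where
    lemma : ∀ s q n → s ≡ s ℤ.+ q ℤ.* n ℤ.+ ℤ.- q ℤ.* n
    lemma = ℤSolver.solve-∀

  cyclic-≅ : ∀ {m x} → HasOrder x (suc m) →
             (∀ y → IsTorsion raw y → ∃[ r ] y ≈ r · x) →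
             IsSubgroup.subgroup isTorsion-isSubgroup ≅ ℤ/ suc m ℤ
  cyclic-≅ {m} {x} order onto = torsion-≅ (ℤ/-group (suc m)) ℕ._+_ 0 (_· x) +_
    (×-homo-+ x) refl (λ r s → H.refl {+ (r ℕ.+ s)}) (H.refl {+ 0})
    (λ r s → order-mod r s order) (λ r s → order-mod⁻¹ r s (proj₁ order))
    (λ r → torsion-· r (suc m , _ , proj₁ order))
    onto (ℕ-surjects m)
    where module H = Group (ℤ/-group (suc m))

  -- The well-definedness and injectivity of the map from ℤ/m ⊕ ℤ/n that sends (k, l) to kx + ly.
  Independent : Carrier → ℕ → Carrier → ℕ → Set ℓ
  Independent x m y n = m · x ≈ ε × n · y ≈ ε × (∀ k l → k · x ∙ l · y ≈ ε → m ∣ k × n ∣ l)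

  product-≅ : ∀ {m n x y} → Independent x (suc m) y (suc n) →
              (∀ z → IsTorsion raw z → ∃[ r ] z ≈ proj₁ r · x ∙ proj₂ r · y) →
              IsSubgroup.subgroup isTorsion-isSubgroup ≅ rawGroup (ℤ/ suc m ℤ) (ℤ/ suc n ℤ)
  product-≅ {m} {n} {x} {y} (mx≈ε , ny≈ε , independent) onto =
    torsion-≅ (DirectProduct.group (ℤ/-group (suc m)) (ℤ/-group (suc n)))
      (λ (k , l) (k′ , l′) → k ℕ.+ k′ , l ℕ.+ l′) (0 , 0) φ (λ (k , l) → + k , + l)
      φ-+ (identityˡ ε) (λ (k , l) (k′ , l′) → H.refl {+ (k ℕ.+ k′) , + (l ℕ.+ l′)}) (H.refl {+ 0 , + 0})
      φ⇒χ
      (λ (k , l) (k′ , l′) (h , h′) → ∙-cong (order-mod⁻¹ k k′ mx≈ε h) (order-mod⁻¹ l l′ ny≈ε h′))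
      (λ (k , l) → torsion-∙ (torsion-· k (suc m , _ , mx≈ε)) (torsion-· l (suc n , _ , ny≈ε)))
      onto
      (λ (i , j) → let k , h = ℕ-surjects m i ; l , h′ = ℕ-surjects n j in (k , l) , (h , h′))
    where
    module H = Group (DirectProduct.group (ℤ/-group (suc m)) (ℤ/-group (suc n)))
    φ : ℕ × ℕ → Carrier
    φ (k , l) = k · x ∙ l · y
    φ-+ : ∀ ((k , l) (k′ , l′) : ℕ × ℕ) → φ (k ℕ.+ k′ , l ℕ.+ l′) ≈ φ (k , l) ∙ φ (k′ , l′)
    φ-+ (k , l) (k′ , l′) = trans (∙-cong (×-homo-+ x k k′) (×-homo-+ y l l′))
      (interchange (k · x) (k′ · x) (l · y) (l′ · y))
    φ⇒χ : ∀ u v → φ u ≈ φ v → (+ proj₁ u ≡ + proj₁ v [mod suc m ]) × (+ proj₂ u ≡ + proj₂ v [mod suc n ])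
    φ⇒χ (k , l) (k′ , l′) eq = ∣+*⇒mod k k′ (proj₁ divisible) , ∣+*⇒mod l l′ (proj₂ divisible)
      where
      divisible : suc m ∣ k ℕ.+ m ℕ.* k′ × suc n ∣ l ℕ.+ n ℕ.* l′
      divisible = independent _ _ (begin
        φ (k ℕ.+ m ℕ.* k′ , l ℕ.+ n ℕ.* l′)        ≈⟨ φ-+ (k , l) (m ℕ.* k′ , n ℕ.* l′) ⟩
        φ (k , l) ∙ φ (m ℕ.* k′ , n ℕ.* l′)        ≈⟨ ∙-congʳ eq ⟩
        φ (k′ , l′) ∙ φ (m ℕ.* k′ , n ℕ.* l′)      ≈⟨ φ-+ (k′ , l′) (m ℕ.* k′ , n ℕ.* l′) ⟨
        φ (suc m ℕ.* k′ , suc n ℕ.* l′)            ≈⟨ ∙-cong (×-congˡ (ℕ.*-comm (suc m) k′)) (×-congˡ (ℕ.*-comm (suc n) l′)) ⟩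
        φ (k′ ℕ.* suc m , l′ ℕ.* suc n)            ≈⟨ ∙-cong (multiple≈ε k′ mx≈ε) (multiple≈ε l′ ny≈ε) ⟩
        ε ∙ ε                                      ≈⟨ identityˡ ε ⟩
        ε                                          ∎)

-- 2-adic valuations

infix 9 2^_
2^_ : ℕ → ℤ
2^ k = (+ 2) ℤ.^ k

Odd : ℤ → Set
Odd i = ∃[ m ] i ≡ + 1 ℤ.+ + 2 ℤ.* m

odd-* : ∀ {i j} → Odd i → Odd j → Odd (i ℤ.* j)
odd-* (m , ≡.refl) (n , ≡.refl) = m ℤ.+ n ℤ.+ + 2 ℤ.* m ℤ.* n , lemma m n
  where
  lemma : ∀ m n → (+ 1 ℤ.+ + 2 ℤ.* m) ℤ.* (+ 1 ℤ.+ + 2 ℤ.* n) ≡ + 1 ℤ.+ + 2 ℤ.* (m ℤ.+ n ℤ.+ + 2 ℤ.* m ℤ.* n)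
  lemma = ℤSolver.solve-∀

odd-+2* : ∀ {i} j → Odd i → Odd (i ℤ.+ + 2 ℤ.* j)
odd-+2* j (m , ≡.refl) = m ℤ.+ j , lemma m j
  where
  lemma : ∀ m j → + 1 ℤ.+ + 2 ℤ.* m ℤ.+ + 2 ℤ.* j ≡ + 1 ℤ.+ + 2 ℤ.* (m ℤ.+ j)
  lemma = ℤSolver.solve-∀

odd-neg : ∀ {i} → Odd i → Odd (ℤ.- i)
odd-neg {i} o = ≡.subst Odd (lemma i) (odd-+2* (ℤ.- i) o)
  where
  lemma : ∀ i → i ℤ.+ + 2 ℤ.* (ℤ.- i) ≡ ℤ.- i
  lemma = ℤSolver.solve-∀

odd+odd : ∀ {i j} → Odd i → Odd j → ∃[ k ] i ℤ.+ j ≡ + 2 ℤ.* k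
odd+odd (m , ≡.refl) (n , ≡.refl) = + 1 ℤ.+ m ℤ.+ n , lemma m n
  where
  lemma : ∀ m n → (+ 1 ℤ.+ + 2 ℤ.* m) ℤ.+ (+ 1 ℤ.+ + 2 ℤ.* n) ≡ + 2 ℤ.* (+ 1 ℤ.+ m ℤ.+ n)
  lemma = ℤSolver.solve-∀

odd≢2* : ∀ {i} j → Odd i → i ≢ + 2 ℤ.* j
odd≢2* {i} j (m , eq) eq′ = 2*≢1 (j ℤ.- m) (≡.trans (lemma j m) (≡.trans
    (≡.cong (ℤ._- + 2 ℤ.* m) (≡.trans (≡.sym eq′) eq)) (lemma′ m)))
  where
  lemma : ∀ j m → + 2 ℤ.* (j ℤ.- m) ≡ + 2 ℤ.* j ℤ.- + 2 ℤ.* m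
  lemma = ℤSolver.solve-∀
  lemma′ : ∀ m → + 1 ℤ.+ + 2 ℤ.* m ℤ.- + 2 ℤ.* m ≡ + 1
  lemma′ = ℤSolver.solve-∀
  2*≢1 : ∀ k → + 2 ℤ.* k ≢ + 1
  2*≢1 k eq with ℕ.m*n≡1⇒m≡1 2 ℤ.∣ k ∣ (≡.trans (≡.sym (ℤ.abs-* (+ 2) k)) (≡.cong ℤ.∣_∣ eq))
  ... | ()

odd≢0 : ∀ {i} → Odd i → i ≢ + 0
odd≢0 o = odd≢2* (+ 0) o

even⊎odd : ∀ i → (∃[ j ] i ≡ + 2 ℤ.* j) ⊎ Odd i
even⊎odd i with i ℤ.%ℕ 2 | i ℤ./ℕ 2 | ℤ.n%ℕd<d i 2 | ℤ.a≡a%ℕn+[a/ℕn]*n i 2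
... | 0 | q | _ | eq = inj₁ (q , ≡.trans eq (≡.trans (ℤ.+-identityˡ _) (ℤ.*-comm q (+ 2))))
... | 1 | q | _ | eq = inj₂ (q , ≡.trans eq (≡.cong (ℤ._+_ (+ 1)) (ℤ.*-comm q (+ 2))))
... | suc (suc _) | _ | ℕ.s<s (ℕ.s<s ()) | _

2^*odd : ∀ {i} → i ≢ + 0 → ∃[ k ] ∃[ a ] Odd a × i ≡ 2^ k ℤ.* a
2^*odd {i} i≢0 = go ℤ.∣ i ∣ i i≢0 ℕ.≤-refl
  where
  go : ∀ n i → i ≢ + 0 → ℤ.∣ i ∣ ℕ.≤ n → ∃[ k ] ∃[ a ] Odd a × i ≡ 2^ k ℤ.* a
  go zero    i i≢0 ∣i∣≤0 = ⊥-elim (i≢0 (ℤ.∣i∣≡0⇒i≡0 (ℕ.n≤0⇒n≡0 ∣i∣≤0)))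
  go (suc n) i i≢0 ∣i∣≤1+n with even⊎odd i
  ... | inj₂ o            = 0 , i , o , ≡.sym (ℤ.*-identityˡ i)
  ... | inj₁ (j , ≡.refl) with go n j j≢0 ∣j∣≤n
    where
    j≢0 : j ≢ + 0
    j≢0 ≡.refl = i≢0 ≡.refl
    ∣j∣≤n : ℤ.∣ j ∣ ℕ.≤ n
    ∣j∣≤n = ℕ.s≤s⁻¹ (ℕ.≤-trans (ℕ.m<m*n ℤ.∣ j ∣ 2 {{ℕ.≢-nonZero (λ eq → j≢0 (ℤ.∣i∣≡0⇒i≡0 eq))}} (ℕ.s≤s (ℕ.s≤s ℕ.z≤n)))
      (≡.subst (ℕ._≤ suc n) (≡.trans (ℤ.abs-* (+ 2) j) (ℕ.*-comm 2 ℤ.∣ j ∣)) ∣i∣≤1+n))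
  ...   | k , a , o , eq = suc k , a , o , ≡.trans (≡.cong (ℤ._*_ (+ 2)) eq) (≡.sym (ℤ.*-assoc (+ 2) (2^ k) a))

2^*odd-unique : ∀ {a b} k l → Odd a → Odd b → 2^ k ℤ.* a ≡ 2^ l ℤ.* b → k ≡ l
2^*odd-unique zero    zero    oa ob eq = ≡.refl
2^*odd-unique {a} {b} zero (suc l) oa ob eq = ⊥-elim (odd≢2* (2^ l ℤ.* b) oa
  (≡.trans (≡.sym (ℤ.*-identityˡ a)) (≡.trans eq (ℤ.*-assoc (+ 2) (2^ l) b))))
2^*odd-unique {a} {b} (suc k) zero oa ob eq = ⊥-elim (odd≢2* (2^ k ℤ.* a) ob
  (≡.trans (≡.sym (ℤ.*-identityˡ b)) (≡.trans (≡.sym eq) (ℤ.*-assoc (+ 2) (2^ k) a))))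
2^*odd-unique {a} {b} (suc k) (suc l) oa ob eq = ≡.cong suc (2^*odd-unique k l oa ob
  (ℤ.*-cancelˡ-≡ (+ 2) (2^ k ℤ.* a) (2^ l ℤ.* b) (≡.trans (≡.sym (ℤ.*-assoc (+ 2) (2^ k) a)) (≡.trans eq (ℤ.*-assoc (+ 2) (2^ l) b)))))

2^-+ : ∀ k l → 2^ (k ℕ.+ l) ≡ 2^ k ℤ.* 2^ l
2^-+ = ℤ.^-distribˡ-+-* (+ 2)

2^≢0 : ∀ k → 2^ k ≢ + 0
2^≢0 (suc k) eq with ℤ.i*j≡0⇒i≡0∨j≡0 (+ 2) eq
... | inj₂ eq′ = 2^≢0 k eq′

odd-cube : ∀ {i} → Odd i → Odd (i ℤ.* i ℤ.* i)
odd-cube o = odd-* (odd-* o o) o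

-- The cofactor of a + b in a³ + b³. It equals b² + a(a - b), where a - b is even.
odd-norm⁻ : ∀ {a b} → Odd a → Odd b → Odd (a ℤ.* a ℤ.- a ℤ.* b ℤ.+ b ℤ.* b)
odd-norm⁻ {a} {b} oa ob with odd+odd oa (odd-neg ob)
... | t , eq = ≡.subst Odd (≡.trans (≡.cong (λ k → b ℤ.* b ℤ.+ k) (≡.trans (lemma a t) (≡.cong (ℤ._*_ a) (≡.sym eq)))) (lemma′ a b))
    (odd-+2* (a ℤ.* t) (odd-* ob ob))
  where
  lemma : ∀ a t → + 2 ℤ.* (a ℤ.* t) ≡ a ℤ.* (+ 2 ℤ.* t)
  lemma = ℤSolver.solve-∀
  lemma′ : ∀ a b → b ℤ.* b ℤ.+ a ℤ.* (a ℤ.- b) ≡ a ℤ.* a ℤ.- a ℤ.* b ℤ.+ b ℤ.* b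
  lemma′ = ℤSolver.solve-∀

-- The cofactor of a - b in a³ - b³, obtained by replacing b with -b.
odd-norm⁺ : ∀ {a b} → Odd a → Odd b → Odd (a ℤ.* a ℤ.+ a ℤ.* b ℤ.+ b ℤ.* b)
odd-norm⁺ {a} {b} oa ob = ≡.subst Odd (lemma a b) (odd-norm⁻ oa (odd-neg ob))
  where
  lemma : ∀ a b → a ℤ.* a ℤ.- a ℤ.* (ℤ.- b) ℤ.+ (ℤ.- b) ℤ.* (ℤ.- b) ≡ a ℤ.* a ℤ.+ a ℤ.* b ℤ.+ b ℤ.* b
  lemma = ℤSolver.solve-∀

private
  -- If x(P) = A/B then x(2P) = A(A³ - 8B³) / 4B(A³ + B³).  The modules are named
  -- after the 2-adic valuation of x(P).  The powers of two are variables
  -- constrained by equations, so that they are never unfolded.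
  module Negative where
    -- Here A³ + B³ is odd, hence nonzero, so that the doubled point is affine. The index of each
    -- `q` is the fixed part of its exponent; `p` carries the variable part.
    sum : ∀ p a b {q₀ q₁} → q₀ ≡ + 1 → q₁ ≡ + 2 ℤ.* p →
          let A = q₀ ℤ.* a ; B = q₁ ℤ.* b in
          A ℤ.* A ℤ.* A ℤ.+ B ℤ.* B ℤ.* B ≡ a ℤ.* a ℤ.* a ℤ.+ + 2 ℤ.* (+ 4 ℤ.* (p ℤ.* p ℤ.* p) ℤ.* (b ℤ.* b ℤ.* b))
    sum p a b ≡.refl ≡.refl = ℤSolver.solve (p ∷ a ∷ b ∷ [])

    num : ∀ a B {q₀} → q₀ ≡ + 1 → let A = q₀ ℤ.* a in
          A ℤ.* (A ℤ.* A ℤ.* A ℤ.- + 8 ℤ.* (B ℤ.* B ℤ.* B)) ≡ + 1 ℤ.* (q₀ ℤ.* (a ℤ.* (a ℤ.* a ℤ.* a ℤ.+ + 2 ℤ.* (ℤ.- (+ 4 ℤ.* (B ℤ.* B ℤ.* B))))))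
    num a B ≡.refl = ℤSolver.solve (a ∷ B ∷ [])

    den : ∀ p a b {q₀ q₁} → q₀ ≡ + 1 → q₁ ≡ + 2 ℤ.* p →
          ∀ {q₃} → q₃ ≡ + 2 ℤ.* (+ 2 ℤ.* q₁) → let A = q₀ ℤ.* a ; B = q₁ ℤ.* b in
          + 4 ℤ.* B ℤ.* (A ℤ.* A ℤ.* A ℤ.+ B ℤ.* B ℤ.* B)
          ≡ + 1 ℤ.* (q₃ ℤ.* (b ℤ.* (a ℤ.* a ℤ.* a ℤ.+ + 2 ℤ.* (+ 4 ℤ.* (p ℤ.* p ℤ.* p) ℤ.* (b ℤ.* b ℤ.* b)))))
    den p a b ≡.refl ≡.refl ≡.refl = ℤSolver.solve (p ∷ a ∷ b ∷ [])

  module Positive where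
    sum : ∀ p a b {q₀ q₂} → q₀ ≡ + 1 → q₂ ≡ + 2 ℤ.* (+ 2 ℤ.* p) →
          let A = q₂ ℤ.* a ; B = q₀ ℤ.* b in
          A ℤ.* A ℤ.* A ℤ.+ B ℤ.* B ℤ.* B ≡ b ℤ.* b ℤ.* b ℤ.+ + 2 ℤ.* (+ 8 ℤ.* (+ 4 ℤ.* (p ℤ.* p ℤ.* p) ℤ.* (a ℤ.* a ℤ.* a)))
    sum p a b ≡.refl ≡.refl = ℤSolver.solve (p ∷ a ∷ b ∷ [])

    num : ∀ p a b {q₀ q₂} → q₀ ≡ + 1 → q₂ ≡ + 2 ℤ.* (+ 2 ℤ.* p) →
          ∀ {q₃} → q₃ ≡ + 2 ℤ.* q₂ → let A = q₂ ℤ.* a ; B = q₀ ℤ.* b in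
          A ℤ.* (A ℤ.* A ℤ.* A ℤ.- + 8 ℤ.* (B ℤ.* B ℤ.* B))
          ≡ + 4 ℤ.* (q₃ ℤ.* (a ℤ.* (ℤ.- (b ℤ.* b ℤ.* b) ℤ.+ + 2 ℤ.* (+ 4 ℤ.* (p ℤ.* p ℤ.* p) ℤ.* (a ℤ.* a ℤ.* a)))))
    num p a b ≡.refl ≡.refl ≡.refl = ℤSolver.solve (p ∷ a ∷ b ∷ [])

    den : ∀ p a b {q₀ q₂} → q₀ ≡ + 1 → q₂ ≡ + 2 ℤ.* (+ 2 ℤ.* p) →
          let A = q₂ ℤ.* a ; B = q₀ ℤ.* b in
          + 4 ℤ.* B ℤ.* (A ℤ.* A ℤ.* A ℤ.+ B ℤ.* B ℤ.* B)
          ≡ + 4 ℤ.* (q₀ ℤ.* (b ℤ.* (b ℤ.* b ℤ.* b ℤ.+ + 2 ℤ.* (+ 8 ℤ.* (+ 4 ℤ.* (p ℤ.* p ℤ.* p) ℤ.* (a ℤ.* a ℤ.* a))))))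
    den p a b ≡.refl ≡.refl = ℤSolver.solve (p ∷ a ∷ b ∷ [])

  module Zero where
    -- For odd a and b the second factor is odd, so the power of two in a³ + b³ is that in a + b,
    -- namely 2p for odd c.
    sum : ∀ p a b c {q₀} → q₀ ≡ + 1 → a ℤ.+ b ≡ + 2 ℤ.* (p ℤ.* c) →
          let A = q₀ ℤ.* a ; B = q₀ ℤ.* b in
          A ℤ.* A ℤ.* A ℤ.+ B ℤ.* B ℤ.* B ≡ (+ 2 ℤ.* p) ℤ.* (c ℤ.* (a ℤ.* a ℤ.- a ℤ.* b ℤ.+ b ℤ.* b))
    sum p a b c ≡.refl h = ≡.trans (factor a b)
        (≡.trans (≡.cong (ℤ._* (a ℤ.* a ℤ.- a ℤ.* b ℤ.+ b ℤ.* b)) h) (regroup p c _))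
      where
      factor : ∀ a b → let A = + 1 ℤ.* a ; B = + 1 ℤ.* b in
               A ℤ.* A ℤ.* A ℤ.+ B ℤ.* B ℤ.* B ≡ (a ℤ.+ b) ℤ.* (a ℤ.* a ℤ.- a ℤ.* b ℤ.+ b ℤ.* b)
      factor = ℤSolver.solve-∀
      regroup : ∀ p c s → + 2 ℤ.* (p ℤ.* c) ℤ.* s ≡ (+ 2 ℤ.* p) ℤ.* (c ℤ.* s)
      regroup = ℤSolver.solve-∀

    den : ∀ p a b c {q₀} → q₀ ≡ + 1 → a ℤ.+ b ≡ + 2 ℤ.* (p ℤ.* c) →
          ∀ {q₃} → q₃ ≡ + 2 ℤ.* (+ 2 ℤ.* (+ 2 ℤ.* p)) → let A = q₀ ℤ.* a ; B = q₀ ℤ.* b in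
          + 4 ℤ.* B ℤ.* (A ℤ.* A ℤ.* A ℤ.+ B ℤ.* B ℤ.* B) ≡ + 1 ℤ.* (q₃ ℤ.* (b ℤ.* (c ℤ.* (a ℤ.* a ℤ.- a ℤ.* b ℤ.+ b ℤ.* b))))
    den p a b c ≡.refl h ≡.refl = ≡.trans (≡.cong (ℤ._*_ (+ 4 ℤ.* (+ 1 ℤ.* b))) (sum p a b c ≡.refl h)) (regroup b p _)
      where
      regroup : ∀ b p s → + 4 ℤ.* (+ 1 ℤ.* b) ℤ.* ((+ 2 ℤ.* p) ℤ.* s)
                ≡ + 1 ℤ.* (+ 2 ℤ.* (+ 2 ℤ.* (+ 2 ℤ.* p)) ℤ.* (b ℤ.* s))
      regroup = ℤSolver.solve-∀

  module One where
    sum : ∀ a b {q₀ q₁} → q₀ ≡ + 1 → q₁ ≡ + 2 ℤ.* + 1 →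
          let A = q₁ ℤ.* a ; B = q₀ ℤ.* b in
          A ℤ.* A ℤ.* A ℤ.+ B ℤ.* B ℤ.* B ≡ b ℤ.* b ℤ.* b ℤ.+ + 2 ℤ.* (+ 4 ℤ.* (a ℤ.* a ℤ.* a))
    sum a b ≡.refl ≡.refl = ℤSolver.solve (a ∷ b ∷ [])

    -- For A = 2a and B = b the two cubes in the numerator have equal valuation and combine to 8(a³
    -- - b³), which is where a - b enters.
    num : ∀ p a b c {q₀ q₁} → q₀ ≡ + 1 → q₁ ≡ + 2 ℤ.* + 1 → a ℤ.- b ≡ + 2 ℤ.* (p ℤ.* c) →
          ∀ {q₃} → q₃ ≡ + 2 ℤ.* (+ 2 ℤ.* (+ 2 ℤ.* p)) → let A = q₁ ℤ.* a ; B = q₀ ℤ.* b in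
          A ℤ.* (A ℤ.* A ℤ.* A ℤ.- + 8 ℤ.* (B ℤ.* B ℤ.* B)) ≡ + 4 ℤ.* (q₃ ℤ.* (a ℤ.* (c ℤ.* (a ℤ.* a ℤ.+ a ℤ.* b ℤ.+ b ℤ.* b))))
    num p a b c ≡.refl ≡.refl h ≡.refl = ≡.trans (factor a b)
        (≡.trans (≡.cong (λ k → + 16 ℤ.* (a ℤ.* (k ℤ.* (a ℤ.* a ℤ.+ a ℤ.* b ℤ.+ b ℤ.* b)))) h) (regroup a p c _))
      where
      factor : ∀ a b → let A = + 2 ℤ.* a ; B = + 1 ℤ.* b in
               A ℤ.* (A ℤ.* A ℤ.* A ℤ.- + 8 ℤ.* (B ℤ.* B ℤ.* B)) ≡ + 16 ℤ.* (a ℤ.* ((a ℤ.- b) ℤ.* (a ℤ.* a ℤ.+ a ℤ.* b ℤ.+ b ℤ.* b)))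
      factor = ℤSolver.solve-∀
      regroup : ∀ a p c s → + 16 ℤ.* (a ℤ.* (+ 2 ℤ.* (p ℤ.* c) ℤ.* s))
                ≡ + 4 ℤ.* (+ 2 ℤ.* (+ 2 ℤ.* (+ 2 ℤ.* p)) ℤ.* (a ℤ.* (c ℤ.* s)))
      regroup = ℤSolver.solve-∀

    den : ∀ a b {q₀ q₁} → q₀ ≡ + 1 → q₁ ≡ + 2 ℤ.* + 1 →
          let A = q₁ ℤ.* a ; B = q₀ ℤ.* b in
          + 4 ℤ.* B ℤ.* (A ℤ.* A ℤ.* A ℤ.+ B ℤ.* B ℤ.* B) ≡ + 4 ℤ.* (q₀ ℤ.* (b ℤ.* (b ℤ.* b ℤ.* b ℤ.+ + 2 ℤ.* (+ 4 ℤ.* (a ℤ.* a ℤ.* a)))))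
    den a b ≡.refl ≡.refl = ℤSolver.solve (a ∷ b ∷ [])

-- The effect of doubling on the valuation of the x-coordinate

module TwoAdic {c ℓ n} (K : NumberField c ℓ n) where
  open NumberField K
  open DecidableEquality K
  open EllipticCurve K
  open NumberFieldProperties K
  open GroupLaw K
  open Torsion ⊕-abelianGroup

  -- x(2P) = m² - 2x with m = 3x²/2y, from which y² = x³ + 1 eliminates y. The hypothesis says that
  -- y ≠ 0, so that 2P ≠ 𝒪.
  ⊕-double : ∀ {x y e} → ¬ (x ³ + 1# ≈ 0#) → ∃[ x′ ] ∃[ y′ ] ∃[ e′ ]
             affine x y e ⊕ affine x y e ≡ affine x′ y′ e′ ×
             x′ * (ιℤ (+ 4) * (x ³ + ιℤ (+ 1))) ≈ x * (x ³ - ιℤ (+ 8))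
  ⊕-double {x} {y} {e} x³+1≉0 with affine x y e ⊕ affine x y e | ⊕-isSum (affine x y e) (affine x y e)
  ... | 𝒪 | opposite _ y≈-y = ⊥-elim (x³+1≉0 (trans (sym e) (trans (*-congʳ y≈0) (zeroˡ y))))
    where
    open Solver
    y≈0 : y ≈ 0#
    y≈0 = x*y≈0⇒y≈0 (ιℤ-≉0 {+ 2} λ ()) (trans
      (solve 1 (λ y → con (+ 2) :* y := y :+ y) refl y) (trans (+-congʳ y≈-y) (-‿inverseˡ y)))
  ... | affine x′ y′ e′ | line m s hx _ = x′ , y′ , e′ , ≡.refl ,
      (solve 5 (λ m x y x′ o →
          x′ :* (con (+ 4) :* (x :* x :* x :+ con (+ 1))) :- x :* (x :* x :* x :- con (+ 8))
          := con (+ 4) :* (y :* y) :* (x′ :- (m :* m :- x :- x))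
          :+ (con (+ 2) :* m :* y :+ con (+ 3) :* (x :* x)) :* (m :* (y :+ y) :- (x :* x :+ x :* x :+ x :* x))
          :+ (:- (con (+ 4) :* x′ :+ con (+ 8) :* x)) :* (y :* y :- (x :* x :* x :+ o))
          :+ (:- (con (+ 4) :* x′ :+ con (+ 8) :* x)) :* (o :- con (+ 1)))
        refl m x y x′ 1#
       ⇐ _ ⊡ hx ⊞ _ ⊡ Slope.tangent s ⊞ _ ⊡ e ⊞ _ ⊡ sym ιℤ.1#-homo)
    where open Solver

  private
    infix  4 _↦_
    infixl 7 _⟨*⟩_
    infixl 6 _⟨+⟩_ _⟨-⟩_

    -- A record, so that the integers can be inferred.
    record _↦_ (i : ℤ) (u : Carrier) : Set ℓ where
      constructor image
      field
        ιℤ≈ : ιℤ i ≈ u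
    open _↦_

    ↦ιℤ : ∀ i → i ↦ ιℤ i
    ↦ιℤ i = image refl

    _⟨*⟩_ : ∀ {i j u v} → i ↦ u → j ↦ v → i ℤ.* j ↦ u * v
    image p ⟨*⟩ image q = image (trans (ιℤ.*-homo _ _) (*-cong p q))

    _⟨+⟩_ : ∀ {i j u v} → i ↦ u → j ↦ v → i ℤ.+ j ↦ u + v
    image p ⟨+⟩ image q = image (trans (ιℤ.+-homo _ _) (+-cong p q))

    _⟨-⟩_ : ∀ {i j u v} → i ↦ u → j ↦ v → i ℤ.- j ↦ u - v
    image p ⟨-⟩ image q = image (trans (ιℤ.+-homo _ _) (+-cong p (trans (ιℤ.-‿homo _) (-‿cong q))))

    ↦cube : ∀ {i u} → i ↦ u → i ℤ.* i ℤ.* i ↦ u * u * u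
    ↦cube p = p ⟨*⟩ p ⟨*⟩ p

  ratio-double : ∀ {x y e} A B → x * ιℤ B ≈ ιℤ A → A ℤ.* A ℤ.* A ℤ.+ B ℤ.* B ℤ.* B ≢ + 0 →
                 ∃[ x′ ] ∃[ y′ ] ∃[ e′ ] affine x y e ⊕ affine x y e ≡ affine x′ y′ e′ ×
                 x′ * ιℤ (+ 4 ℤ.* B ℤ.* (A ℤ.* A ℤ.* A ℤ.+ B ℤ.* B ℤ.* B)) ≈ ιℤ (A ℤ.* (A ℤ.* A ℤ.* A ℤ.- + 8 ℤ.* (B ℤ.* B ℤ.* B)))
  ratio-double {x} {y} {e} A B h A³+B³≢0 =
    let x′ , y′ , e′ , eq , hx = ⊕-double {x} {y} {e} x³+1≉0 in
    x′ , y′ , e′ , eq , trans (*-congˡ (ιℤ≈ den)) (trans (homogenise hx) (sym (ιℤ≈ num)))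
    where
    open Solver
    a = image {A} (sym h)
    b = ↦ιℤ B
    den = ↦ιℤ (+ 4) ⟨*⟩ b ⟨*⟩ (↦cube a ⟨+⟩ ↦cube b)
    num = a ⟨*⟩ (↦cube a ⟨-⟩ ↦ιℤ (+ 8) ⟨*⟩ ↦cube b)
    x³+1≉0 : ¬ (x ³ + 1# ≈ 0#)
    x³+1≉0 x³+1≈0 = ιℤ-≉0 A³+B³≢0 (trans (ιℤ≈ (↦cube a ⟨+⟩ ↦cube b)) (trans
      (trans (+-congˡ (sym (*-identityʳ _)))
        (solve 3 (λ x b o → x :* b :* (x :* b) :* (x :* b) :+ b :* b :* b :* o
          := b :* b :* b :* (x :* x :* x :+ o)) refl x (ιℤ B) 1#))
      (trans (*-congˡ x³+1≈0) (zeroʳ _))))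
    homogenise : ∀ {x′} → let b = ιℤ B in
      x′ * (ιℤ (+ 4) * (x ³ + ιℤ (+ 1))) ≈ x * (x ³ - ιℤ (+ 8)) →
      x′ * (ιℤ (+ 4) * b * ((x * b) ³ + b ³)) ≈ x * b * ((x * b) ³ - ιℤ (+ 8) * b ³)
    homogenise {x′} hx =
      solve 3 (λ x b x′ →
          x′ :* (con (+ 4) :* b :* (x :* b :* (x :* b) :* (x :* b) :+ b :* b :* b))
            :- x :* b :* (x :* b :* (x :* b) :* (x :* b) :- con (+ 8) :* (b :* b :* b))
          := b :* b :* b :* b :* (x′ :* (con (+ 4) :* (x :* x :* x :+ con (+ 1)))
               :- x :* (x :* x :* x :- con (+ 8))))
        refl x (ιℤ B) x′
      ⇐ _ ⊡ hx

  -- The x-coordinate has 2-adic valuation i - j.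
  data Valuation (i j : ℕ) : Point → Set (c ⊔ ℓ) where
    valuation : ∀ {x y e} a b → Odd a → Odd b →
                x * ιℤ (2^ j ℤ.* b) ≈ ιℤ (2^ i ℤ.* a) → Valuation i j (affine x y e)

  valuation-resp : ∀ {i j P Q} → P ≈ₚ Q → Valuation i j P → Valuation i j Q
  valuation-resp (affine x≈x′ _) (valuation a b oa ob h) =
    valuation a b oa ob (trans (*-congʳ (sym x≈x′)) h)

  -- Cross-multiplying two fractions for x gives one integer with two splittings into a power of two
  -- and an odd part. Equality of i - j and i′ - j′ is phrased additively to stay in ℕ.
  valuation-unique : ∀ {i j i′ j′ P} → Valuation i j P → Valuation i′ j′ P → i ℕ.+ j′ ≡ i′ ℕ.+ j
  valuation-unique {i} {j} {i′} {j′} (valuation {x} a b oa ob h) (valuation a′ b′ oa′ ob′ h′) =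
    2^*odd-unique (i ℕ.+ j′) (i′ ℕ.+ j) (odd-* oa ob′) (odd-* oa′ ob)
      (≡.trans (regroup i j′ a b′) (≡.trans (ιℤ-injective (begin
        ιℤ ((2^ i ℤ.* a) ℤ.* (2^ j′ ℤ.* b′))                ≈⟨ trans (ιℤ.*-homo (2^ i ℤ.* a) (2^ j′ ℤ.* b′)) (*-congʳ (sym h)) ⟩
        x * ιℤ (2^ j ℤ.* b) * ιℤ (2^ j′ ℤ.* b′)             ≈⟨ solve 3 (λ x u v → x :* u :* v := x :* v :* u) refl x _ _ ⟩
        x * ιℤ (2^ j′ ℤ.* b′) * ιℤ (2^ j ℤ.* b)             ≈⟨ trans (*-congʳ h′) (sym (ιℤ.*-homo (2^ i′ ℤ.* a′) (2^ j ℤ.* b))) ⟩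
        ιℤ ((2^ i′ ℤ.* a′) ℤ.* (2^ j ℤ.* b))                ∎))
      (≡.sym (regroup i′ j a′ b))))
    where
    open Solver
    open import Relation.Binary.Reasoning.Setoid setoid
    lemma : ∀ p q a b → p ℤ.* q ℤ.* (a ℤ.* b) ≡ (p ℤ.* a) ℤ.* (q ℤ.* b)
    lemma = ℤSolver.solve-∀
    regroup : ∀ k l a b → 2^ (k ℕ.+ l) ℤ.* (a ℤ.* b) ≡ (2^ k ℤ.* a) ℤ.* (2^ l ℤ.* b)
    regroup k l a b = ≡.trans (≡.cong (ℤ._* (a ℤ.* b)) (2^-+ k l)) (lemma (2^ k) (2^ l) a b)

  ratio-reduce : ∀ {x A B A′ B′} k → k ≢ + 0 → x * ιℤ B ≈ ιℤ A → A ≡ k ℤ.* A′ → B ≡ k ℤ.* B′ →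
                 x * ιℤ B′ ≈ ιℤ A′
  ratio-reduce {x} {A′ = A′} {B′} k k≢0 h ≡.refl ≡.refl = *-cancelˡ-≉0 (ιℤ-≉0 k≢0) (begin
    ιℤ k * (x * ιℤ B′)     ≈⟨ solve 3 (λ k x b → k :* (x :* b) := x :* (k :* b)) refl (ιℤ k) x (ιℤ B′) ⟩
    x * (ιℤ k * ιℤ B′)     ≈⟨ *-congˡ (ιℤ.*-homo k B′) ⟨
    x * ιℤ (k ℤ.* B′)      ≈⟨ h ⟩
    ιℤ (k ℤ.* A′)          ≈⟨ ιℤ.*-homo k A′ ⟩
    ιℤ k * ιℤ A′           ∎)
    where
    open Solver
    open import Relation.Binary.Reasoning.Setoid setoid

  -- k is the common factor of the numerator and the denominator of x(2P).
  valuation-double : ∀ {x y e} A B i j k a b → x * ιℤ B ≈ ιℤ A → A ℤ.* A ℤ.* A ℤ.+ B ℤ.* B ℤ.* B ≢ + 0 → k ≢ + 0 →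
                     Odd a → Odd b →
                     A ℤ.* (A ℤ.* A ℤ.* A ℤ.- + 8 ℤ.* (B ℤ.* B ℤ.* B)) ≡ k ℤ.* (2^ i ℤ.* a) →
                     + 4 ℤ.* B ℤ.* (A ℤ.* A ℤ.* A ℤ.+ B ℤ.* B ℤ.* B) ≡ k ℤ.* (2^ j ℤ.* b) →
                     Valuation i j (affine x y e ⊕ affine x y e)
  valuation-double {x} {y} {e} A B i j k a b h A³+B³≢0 k≢0 oa ob num den =
    let x′ , y′ , e′ , eq , h′ = ratio-double {x} {y} {e} A B h A³+B³≢0 in
    ≡.subst (Valuation i j) (≡.sym eq)
      (valuation a b oa ob (ratio-reduce k k≢0 h′ num den))

  -- A is odd and B even, so A³ dominates in the numerator and in the denominator. Only the factor 4
  -- changes the valuation, which drops by 2.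
  negative-double : ∀ {j P} → Valuation 0 (suc j) P → Valuation 0 (3 ℕ.+ j) (P ⊕ P)
  negative-double {j} (valuation a b oa ob h) =
    valuation-double (2^ 0 ℤ.* a) (2^ suc j ℤ.* b) 0 (3 ℕ.+ j) (+ 1) _ _
      h (λ eq → odd≢0 sum-odd (≡.trans (≡.sym (Negative.sum (2^ j) a b ≡.refl ≡.refl)) eq)) (λ ())
      (odd-* oa (odd-+2* (ℤ.- (+ 4 ℤ.* (B ℤ.* B ℤ.* B))) (odd-cube oa))) (odd-* ob sum-odd)
      (Negative.num a B ≡.refl) (Negative.den (2^ j) a b ≡.refl ≡.refl ≡.refl)
    where
    B = 2^ suc j ℤ.* b
    p = 2^ j
    sum-odd = odd-+2* (+ 4 ℤ.* (p ℤ.* p ℤ.* p) ℤ.* (b ℤ.* b ℤ.* b)) (odd-cube oa)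

  -- A³ is divisible by 64, so 8B³ dominates the numerator and B³ the denominator. The quotient 8/4
  -- raises the valuation by 1. For valuation 1 the terms A³ and 8B³ would balance.
  positive-double : ∀ {i P} → Valuation (2 ℕ.+ i) 0 P → Valuation (3 ℕ.+ i) 0 (P ⊕ P)
  positive-double {i} (valuation a b oa ob h) =
    valuation-double (2^ (2 ℕ.+ i) ℤ.* a) (2^ 0 ℤ.* b) (3 ℕ.+ i) 0 (+ 4) _ _
      h (λ eq → odd≢0 sum-odd (≡.trans (≡.sym (Positive.sum p a b ≡.refl ≡.refl)) eq)) (λ ())
      (odd-* oa (odd-+2* d (odd-neg (odd-cube ob)))) (odd-* ob sum-odd)
      (Positive.num p a b ≡.refl ≡.refl ≡.refl) (Positive.den p a b ≡.refl ≡.refl)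
    where
    p = 2^ i
    d = + 4 ℤ.* (p ℤ.* p ℤ.* p) ℤ.* (a ℤ.* a ℤ.* a)
    sum-odd = odd-+2* (+ 8 ℤ.* d) (odd-cube ob)

  -- a + b is even, and nonzero because x ≠ -1. It divides the denominator, while the numerator is
  -- odd.
  zero-double : ∀ {x y e} → ¬ (x ≈ ιℤ (ℤ.- + 1)) → Valuation 0 0 (affine x y e) →
                ∃[ j ] Valuation 0 (suc j) (affine x y e ⊕ affine x y e)
  zero-double {x} {y} {e} x≉-1 (valuation a b oa ob h) with odd+odd oa ob
  ... | t , a+b≡2t with 2^*odd {t} (λ { ≡.refl → a+b≢0 a+b≡2t })
    where
    a+b≢0 : a ℤ.+ b ≢ + 0
    a+b≢0 a+b≡0 = x≉-1 (*-cancelˡ-≉0 (ιℤ-≉0 (odd≢0 ob)) (begin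
      ιℤ b * x                 ≈⟨ *-comm _ _ ⟩
      x * ιℤ b                 ≈⟨ ratio-reduce (+ 1) (λ ()) h ≡.refl ≡.refl ⟩
      ιℤ a                     ≈⟨ ιℤ.⟦⟧-cong (≡.trans (lemma a b) (≡.cong (λ k → k ℤ.+ b ℤ.* (ℤ.- + 1)) a+b≡0)) ⟩
      ιℤ (+ 0 ℤ.+ b ℤ.* (ℤ.- + 1))   ≈⟨ ιℤ.⟦⟧-cong (ℤ.+-identityˡ (b ℤ.* (ℤ.- + 1))) ⟩
      ιℤ (b ℤ.* (ℤ.- + 1))     ≈⟨ ιℤ.*-homo b (ℤ.- + 1) ⟩
      ιℤ b * ιℤ (ℤ.- + 1)      ∎))
      where
      open import Relation.Binary.Reasoning.Setoid setoid
      lemma : ∀ a b → a ≡ a ℤ.+ b ℤ.+ b ℤ.* (ℤ.- + 1)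
      lemma = ℤSolver.solve-∀
  -- The denominator has valuation 3 + k: 2 from the factor 4, 1 from a + b = 2t and k from t. The
  -- witness is one less.
  ...   | k , c , oc , ≡.refl = 2 ℕ.+ k ,
    valuation-double (2^ 0 ℤ.* a) (2^ 0 ℤ.* b) 0 (3 ℕ.+ k) (+ 1) _ _
      h (λ eq → sum≢0 (≡.trans (≡.sym (Zero.sum (2^ k) a b c ≡.refl a+b≡2t)) eq)) (λ ())
      (odd-* oa (odd-+2* (ℤ.- (+ 4 ℤ.* (B ℤ.* B ℤ.* B))) (odd-cube oa))) (odd-* ob (odd-* oc (odd-norm⁻ oa ob)))
      (Negative.num a B ≡.refl) (Zero.den (2^ k) a b c ≡.refl a+b≡2t ≡.refl)
    where
    B = 2^ 0 ℤ.* b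
    sum≢0 : 2^ suc k ℤ.* (c ℤ.* (a ℤ.* a ℤ.- a ℤ.* b ℤ.+ b ℤ.* b)) ≢ + 0
    sum≢0 eq with ℤ.i*j≡0⇒i≡0∨j≡0 (2^ suc k) eq
    ... | inj₁ eq′ = 2^≢0 (suc k) eq′
    ... | inj₂ eq′ = odd≢0 (odd-* oc (odd-norm⁻ oa ob)) eq′

  -- The numerator is 16a(a³ - b³), where a - b is even, and nonzero because x ≠ 2. The denominator
  -- is 4 times an odd number, so the valuation becomes at least 3.
  one-double : ∀ {x y e} → ¬ (x ≈ ιℤ (+ 2)) → Valuation 1 0 (affine x y e) →
               ∃[ i ] Valuation (2 ℕ.+ i) 0 (affine x y e ⊕ affine x y e)
  one-double {x} {y} {e} x≉2 (valuation a b oa ob h) with odd+odd oa (odd-neg ob)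
  ... | t , a-b≡2t with 2^*odd {t} (λ { ≡.refl → a-b≢0 a-b≡2t })
    where
    a-b≢0 : a ℤ.- b ≢ + 0
    a-b≢0 a-b≡0 = x≉2 (*-cancelˡ-≉0 (ιℤ-≉0 (odd≢0 ob)) (begin
      ιℤ b * x                 ≈⟨ *-comm _ _ ⟩
      x * ιℤ b                 ≈⟨ ratio-reduce {A′ = + 2 ℤ.* a} (+ 1) (λ ()) h (≡.sym (ℤ.*-identityˡ _)) ≡.refl ⟩
      ιℤ (+ 2 ℤ.* a)           ≈⟨ ιℤ.⟦⟧-cong (≡.trans (lemma a b) (≡.cong (λ k → + 2 ℤ.* k ℤ.+ b ℤ.* + 2) a-b≡0)) ⟩
      ιℤ (+ 0 ℤ.+ b ℤ.* + 2)   ≈⟨ ιℤ.⟦⟧-cong (ℤ.+-identityˡ (b ℤ.* + 2)) ⟩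
      ιℤ (b ℤ.* + 2)           ≈⟨ ιℤ.*-homo b (+ 2) ⟩
      ιℤ b * ιℤ (+ 2)          ∎))
      where
      open import Relation.Binary.Reasoning.Setoid setoid
      lemma : ∀ a b → + 2 ℤ.* a ≡ + 2 ℤ.* (a ℤ.- b) ℤ.+ b ℤ.* + 2
      lemma = ℤSolver.solve-∀
  ...   | k , c , oc , ≡.refl = 1 ℕ.+ k ,
    valuation-double (2^ 1 ℤ.* a) (2^ 0 ℤ.* b) (3 ℕ.+ k) 0 (+ 4) _ _
      h (λ eq → odd≢0 sum-odd (≡.trans (≡.sym (One.sum a b ≡.refl ≡.refl)) eq)) (λ ())
      (odd-* oa (odd-* oc (odd-norm⁺ oa ob))) (odd-* ob sum-odd)
      (One.num (2^ k) a b c ≡.refl ≡.refl a-b≡2t ≡.refl) (One.den a b ≡.refl ≡.refl)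
    where
    sum-odd = odd-+2* (+ 4 ℤ.* (a ℤ.* a ℤ.* a)) (odd-cube ob)

  negative⇒¬torsion : ∀ {j P} → Valuation 0 (suc j) P → ¬ IsTorsion E[K] P
  negative⇒¬torsion = level⇒¬torsion (λ j → Valuation 0 (suc j)) valuation-resp
    (λ h h′ → ≡.sym (ℕ.suc-injective (valuation-unique h h′)))
    (λ {j} h → 2 ℕ.+ j , ℕ.m≤n+m (suc j) 1 , negative-double h)

  positive⇒¬torsion : ∀ {i P} → Valuation (2 ℕ.+ i) 0 P → ¬ IsTorsion E[K] P
  positive⇒¬torsion = level⇒¬torsion (λ i → Valuation (2 ℕ.+ i) 0) valuation-resp
    (λ {i} {j} h h′ → ≡.trans (≡.sym (ℕ.+-identityʳ i))
      (≡.trans (ℕ.suc-injective (ℕ.suc-injective (valuation-unique h h′))) (ℕ.+-identityʳ j)))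
    (λ {i} h → suc i , ℕ.≤-refl , positive-double h)

  -- Common twos are cancelled until i or j is zero. Valuations below 0 and above 1 never occur for
  -- torsion points; from 0 and 1 a single doubling leads there, with the exceptions -1 and 2.
  torsion-valuation : ∀ i j {x y e} → Valuation i j (affine x y e) → IsTorsion E[K] (affine x y e) →
                      ¬ (x ≈ ιℤ (ℤ.- + 1)) → x ≈ ιℤ (+ 2)
  torsion-valuation (suc i) (suc j) (valuation a b oa ob h) =
    torsion-valuation i j (valuation a b oa ob (ratio-reduce (+ 2) (λ ()) h (ℤ.*-assoc (+ 2) (2^ i) a) (ℤ.*-assoc (+ 2) (2^ j) b)))
  torsion-valuation zero (suc j) v t _ = ⊥-elim (negative⇒¬torsion v t)
  torsion-valuation (suc (suc i)) zero v t _ = ⊥-elim (positive⇒¬torsion v t)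
  torsion-valuation zero zero v t x≉-1 with zero-double x≉-1 v
  ... | j , v′ = ⊥-elim (negative⇒¬torsion v′ (torsion-∙ t t))
  torsion-valuation (suc zero) zero {x} v t _ with x ≟ ιℤ (+ 2)
  ... | yes x≈2 = x≈2
  ... | no  x≉2 with one-double x≉2 v
  ...   | i , v′ = ⊥-elim (positive⇒¬torsion v′ (torsion-∙ t t))

  torsion-rational-x : ∀ {x y e q} → x ≈ ι q → IsTorsion E[K] (affine x y e) →
                       x ≈ ιℤ (ℤ.- + 1) ⊎ x ≈ ιℤ (+ 0) ⊎ x ≈ ιℤ (+ 2)
  torsion-rational-x {x} {y} {e} {q} x≈q t with x ≟ ιℤ (ℤ.- + 1) | ℚ.↥ q ℤ.≟ + 0
  ... | yes x≈-1 | _       = inj₁ x≈-1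
  ... | no  _    | yes q≡0 = inj₂ (inj₁ (trans x≈q (trans
      (ι.⟦⟧-cong (ℚ.↥p≡0⇒p≡0 q q≡0)) (sym (ιℤ≈ι (+ 0))))))
    where module ι = IsRingHomomorphism ι-isRingHomomorphism
  ... | no  x≉-1 | no  q≢0 with 2^*odd q≢0 | 2^*odd {ℚ.↧ q} (λ ())
  ...   | i , a , oa , ↥≡ | j , b , ob , ↧≡ = inj₂ (inj₂ (torsion-valuation i j {x} {y} {e}
      (valuation a b oa ob (trans (*-congˡ (ιℤ.⟦⟧-cong (≡.sym ↧≡)))
        (trans (*-congʳ x≈q) (trans (ι-↥↧ q) (ιℤ.⟦⟧-cong ↥≡))))) t x≉-1))

-- Quadratic fields

IsSquare : ℤ → Set
IsSquare i = ∃[ s ] s ℤ.* s ≡ i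

-- A bounded search suffices, since a root s satisfies |s| ≤ s² = |i|.
isSquare? : ∀ i → Dec (IsSquare i)
isSquare? i = map′ (λ (s , _ , eq) → + s , eq) bounded (ℕ.anyUpTo? (λ s → + s ℤ.* + s ℤ.≟ i) (suc ℤ.∣ i ∣))
  where
  m≤m*m : ∀ m → m ℕ.≤ m ℕ.* m
  m≤m*m zero    = ℕ.z≤n
  m≤m*m (suc m) = ℕ.m≤m*n (suc m) (suc m)
  abs-square : ∀ s → + ℤ.∣ s ∣ ℤ.* + ℤ.∣ s ∣ ≡ s ℤ.* s
  abs-square (+ n)    = ≡.refl
  abs-square -[1+ n ] = ≡.refl
  bounded : IsSquare i → ∃[ s ] s ℕ.< suc ℤ.∣ i ∣ × + s ℤ.* + s ≡ i
  bounded (s , ≡.refl) = ℤ.∣ s ∣ ,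
    ℕ.s≤s (ℕ.≤-trans (m≤m*m ℤ.∣ s ∣) (ℕ.≤-reflexive (≡.sym (ℤ.abs-* s s)))) , abs-square s

¬isSquare-3 : ¬ IsSquare (ℤ.- + 3)
¬isSquare-3 (+ zero , ())
¬isSquare-3 (+ suc n , ())
¬isSquare-3 (-[1+ n ] , ())

square-∣ : ∀ m N n → m ℤ.* m ≡ N ℤ.* (+ n ℤ.* + n) → n ∣ ℤ.∣ m ∣ ℕ.* ℤ.∣ m ∣
square-∣ m N n eq = divides (ℤ.∣ N ∣ ℕ.* n) (begin
  ℤ.∣ m ∣ ℕ.* ℤ.∣ m ∣              ≡⟨ ℤ.abs-* m m ⟨
  ℤ.∣ m ℤ.* m ∣                    ≡⟨ ≡.cong ℤ.∣_∣ eq ⟩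
  ℤ.∣ N ℤ.* (+ n ℤ.* + n) ∣        ≡⟨ ℤ.abs-* N (+ n ℤ.* + n) ⟩
  ℤ.∣ N ∣ ℕ.* ℤ.∣ + n ℤ.* + n ∣    ≡⟨ ≡.cong (ℤ.∣ N ∣ ℕ.*_) (ℤ.abs-* (+ n) (+ n)) ⟩
  ℤ.∣ N ∣ ℕ.* (n ℕ.* n)            ≡⟨ ℕ.*-assoc ℤ.∣ N ∣ n n ⟨
  ℤ.∣ N ∣ ℕ.* n ℕ.* n              ∎)
  where open ≡.≡-Reasoning

-- Being coprime to m, the divisor n of m² divides m, hence is 1. Applied to a fraction m/n whose
-- square is an integer.
coprime-∣-square⇒≡1 : ∀ {m n} → Coprime m n → n ∣ m ℕ.* m → n ≡ 1
coprime-∣-square⇒≡1 c n∣m² = c (ℕ.coprime-divisor (λ (d∣n , d∣m) → c (d∣m , d∣n)) n∣m² , ℕ.∣-refl)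

module QuadraticBasis {c ℓ} (K : QuadraticField c ℓ) where
  open NumberField K
  open DecidableEquality K
  open EllipticCurve K
  open NumberFieldProperties K
  open GroupLaw K
  open RingProperties ring
  private module ι = IsRingHomomorphism ι-isRingHomomorphism

  record Basis (b₀ b₁ : Carrier) : Set (c ⊔ ℓ) where
    field
      independent : ∀ p q → ι p * b₀ + ι q * b₁ ≈ 0# → p ≡ 0ℚ × q ≡ 0ℚ
      spanning    : ∀ x → ∃[ p ] ∃[ q ] x ≈ ι p * b₀ + ι q * b₁

  basis₂ : ∃[ b₀ ] ∃[ b₁ ] Basis b₀ b₁
  basis₂ = b Fin.zero , b (Fin.suc Fin.zero) , record
    { independent = λ p q h →
        let a≡0 = B.independent (p Vector.∷ q Vector.∷ Vector.[]) (trans (+-congˡ (+-identityʳ _)) h)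
        in a≡0 Fin.zero , a≡0 (Fin.suc Fin.zero)
    ; spanning = λ x → let a , x≈ = B.spanning x
        in a Fin.zero , a (Fin.suc Fin.zero) , trans x≈ (+-congˡ (+-identityʳ _)) }
    where
    b = proj₁ degree
    module B = IsBasis (proj₂ degree)

  basis-swap : ∀ {b₀ b₁} → Basis b₀ b₁ → Basis b₁ b₀
  basis-swap B = record
    { independent = λ p q h → let q≡0 , p≡0 = independent q p (trans (+-comm _ _) h) in p≡0 , q≡0
    ; spanning = λ x → let p , q , x≈ = spanning x in q , p , trans x≈ (+-comm _ _) }
    where open Basis B

  ι-1/ : ∀ {p} (p≢0 : p ≢ 0ℚ) → ∃[ r ] ι r * ι p ≈ 1#
  ι-1/ {p} p≢0 = ℚ.1/ p , trans (sym (ι.*-homo (ℚ.1/ p) p)) (trans (ι.⟦⟧-cong (ℚ.*-inverseˡ p)) ι.1#-homo)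
    where instance _ = ℚ.≢-nonZero p≢0

  ι-+ : ∀ {p q u v} → ι p ≈ u → ι q ≈ v → ι (p ℚ.+ q) ≈ u + v
  ι-+ {p} {q} h h′ = trans (ι.+-homo p q) (+-cong h h′)

  ι-* : ∀ {p q u v} → ι p ≈ u → ι q ≈ v → ι (p ℚ.* q) ≈ u * v
  ι-* {p} {q} h h′ = trans (ι.*-homo p q) (*-cong h h′)

  ι-neg : ∀ {p u} → ι p ≈ u → ι (ℚ.- p) ≈ - u
  ι-neg {p} h = trans (ι.-‿homo p) (-‿cong h)

  p*q≡0⇒p≡0 : ∀ {p q} → q ≢ 0ℚ → p ℚ.* q ≡ 0ℚ → p ≡ 0ℚ
  p*q≡0⇒p≡0 {p} {q} q≢0 eq = ι-injective (trans
    (x*y≈0⇒y≈0 (ι-≉0 q≢0) (trans (*-comm _ _) (trans (sym (ι.*-homo p q)) (trans (ι.⟦⟧-cong eq) ι.0#-homo))))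
    (sym ι.0#-homo))

  -- Steinitz exchange: 1 can replace b₀ because its coordinate p at b₀ is nonzero.
  basis-replace : ∀ {b₀ b₁} p q → p ≢ 0ℚ → 1# ≈ ι p * b₀ + ι q * b₁ → Basis b₀ b₁ → Basis 1# b₁
  basis-replace {b₀} {b₁} p q p≢0 1≈ B = record
    { independent = λ u v h →
        let up≡0 , uq+v≡0 = independent (u ℚ.* p) (u ℚ.* q ℚ.+ v) (trans
              (trans (+-cong (*-congʳ (ι-* {u} {p} refl refl)) (*-congʳ (ι-+ {u ℚ.* q} {v} (ι-* {u} {q} refl refl) refl)))
                (solve 7 (λ u v p q b₀ b₁ o → u :* p :* b₀ :+ (u :* q :+ v) :* b₁ :- (u :* o :+ v :* b₁)
                    := (:- u) :* (o :- (p :* b₀ :+ q :* b₁)))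
                  refl (ι u) (ι v) (ι p) (ι q) b₀ b₁ 1#
                 ⇐ _ ⊡ 1≈)) h)
            u≡0 = p*q≡0⇒p≡0 p≢0 up≡0
        in u≡0 , ≡.trans (≡.sym (ℚ.+-identityˡ v))
             (≡.trans (≡.cong (ℚ._+ v) (≡.sym (≡.trans (≡.cong (ℚ._* q) u≡0) (ℚ.*-zeroˡ q)))) uq+v≡0)
    ; spanning = λ x → let r , rp≈1 = ι-1/ p≢0 ; s , t , x≈ = spanning x in
        s ℚ.* r , t ℚ.+ ℚ.- (s ℚ.* r ℚ.* q) , trans x≈ (sym (trans
          (+-cong (*-congʳ (ι-* {s} {r} refl refl)) (*-congʳ (ι-+ {t} {ℚ.- (s ℚ.* r ℚ.* q)} refl
            (ι-neg {s ℚ.* r ℚ.* q} (ι-* {s ℚ.* r} {q} (ι-* {s} {r} refl refl) refl)))))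
          (solve 8 (λ s t r p q b₀ b₁ o → s :* r :* o :+ (t :+ :- (s :* r :* q)) :* b₁ :- (s :* b₀ :+ t :* b₁)
              := s :* r :* (o :- (p :* b₀ :+ q :* b₁)) :+ s :* b₀ :* (r :* p :- o) :+ (:- (s :* b₀)) :* (con (+ 1) :- o))
            refl (ι s) (ι t) (ι r) (ι p) (ι q) b₀ b₁ 1#
           ⇐ _ ⊡ 1≈ ⊞ _ ⊡ rp≈1 ⊞ _ ⊡ ιℤ.1#-homo))) }
    where
    open Basis B
    open Solver

  basis-1 : ∃[ β ] Basis 1# β
  basis-1 = let b₀ , b₁ , B = basis₂ ; p , q , 1≈ = Basis.spanning B 1# in go b₀ b₁ B p q 1≈
    where
    go : ∀ b₀ b₁ → Basis b₀ b₁ → ∀ p q → 1# ≈ ι p * b₀ + ι q * b₁ → ∃[ β ] Basis 1# β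
    go b₀ b₁ B p q 1≈ with p ℚ.≟ 0ℚ | q ℚ.≟ 0ℚ
    ... | no p≢0     | _          = b₁ , basis-replace p q p≢0 1≈ B
    ... | yes _      | no q≢0     = b₀ , basis-replace q p q≢0 (trans 1≈ (+-comm _ _)) (basis-swap B)
    ... | yes ≡.refl | yes ≡.refl = ⊥-elim (0≉1 (sym (trans 1≈ (trans
      (+-cong (trans (*-congʳ ι.0#-homo) (zeroˡ b₀)) (trans (*-congʳ ι.0#-homo) (zeroˡ b₁))) (+-identityˡ 0#)))))

  record SquareRoot : Set (c ⊔ ℓ) where
    field
      θ     : Carrier
      d     : ℚ
      θ²≈d  : θ * θ ≈ ι d
      basis : Basis 1# θ

  -- Completing the square: if β² = p + qβ, take θ = β - q/2.
  squareRoot : SquareRoot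
  squareRoot = record
    { θ = β - ι h
    ; d = p ℚ.+ h ℚ.* h
    ; θ²≈d = trans
        (solve 5 (λ p q h β o → (β :- h) :* (β :- h) :- (p :+ h :* h)
            := con (+ 1) :* (β :* β :- (p :* o :+ q :* β)) :+ (:- β) :* (h :+ h :- q) :+ p :* (o :- con (+ 1)))
          refl (ι p) (ι q) (ι h) β 1#
         ⇐ _ ⊡ β² ⊞ _ ⊡ 2h≈q ⊞ _ ⊡ sym ιℤ.1#-homo)
        (sym (ι-+ {p} {h ℚ.* h} refl (ι-* {h} {h} refl refl)))
    ; basis = record
      { independent = λ u v eq →
          let u-vh≡0 , v≡0 = independent (u ℚ.+ ℚ.- (v ℚ.* h)) v (trans
                (trans (+-congʳ (*-congʳ (ι-+ {u} {ℚ.- (v ℚ.* h)} refl (ι-neg {v ℚ.* h} (ι-* {v} {h} refl refl)))))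
                  (solve 5 (λ u v h β o → (u :+ :- (v :* h)) :* o :+ v :* β :- (u :* o :+ v :* (β :- h))
                      := (:- (v :* h)) :* (o :- con (+ 1))) refl (ι u) (ι v) (ι h) β 1#
                    ⇐ _ ⊡ sym ιℤ.1#-homo)) eq)
          in ι-injective (trans (solve 3 (λ u v h → u := u :+ :- (v :* h) :+ v :* h) refl (ι u) (ι v) (ι h))
               (trans (+-cong (trans (sym (ι-+ {u} {ℚ.- (v ℚ.* h)} refl (ι-neg {v ℚ.* h} (ι-* {v} {h} refl refl))))
                         (trans (ι.⟦⟧-cong u-vh≡0) ι.0#-homo))
                       (trans (*-congʳ (trans (ι.⟦⟧-cong v≡0) ι.0#-homo)) (zeroˡ _)))
                 (trans (+-identityˡ 0#) (sym ι.0#-homo)))) , v≡0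
      ; spanning = λ x → let u , v , x≈ = spanning x in u ℚ.+ v ℚ.* h , v , trans x≈ (sym (trans
          (+-congʳ (*-congʳ (ι-+ {u} {v ℚ.* h} refl (ι-* {v} {h} refl refl))))
          (solve 5 (λ u v h β o → (u :+ v :* h) :* o :+ v :* (β :- h) :- (u :* o :+ v :* β)
              := v :* h :* (o :- con (+ 1))) refl (ι u) (ι v) (ι h) β 1#
           ⇐ _ ⊡ sym ιℤ.1#-homo))) } }
    where
    open Solver
    β = proj₁ basis-1
    open Basis (proj₂ basis-1)
    p = proj₁ (spanning (β * β))
    q = proj₁ (proj₂ (spanning (β * β)))
    β² = proj₂ (proj₂ (spanning (β * β)))
    h = ℚ.½ ℚ.* q
    2h≈q : ι h + ι h ≈ ι q
    2h≈q = trans (sym (ι.+-homo h h)) (ι.⟦⟧-cong (≡.trans (≡.sym (ℚ.*-distribʳ-+ q ℚ.½ ℚ.½)) (ℚ.*-identityˡ q)))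

-- Conjugation of the field and its action on the curve

module Conjugation {c ℓ} (K : QuadraticField c ℓ) (√d : QuadraticBasis.SquareRoot K) where
  open NumberField K
  open DecidableEquality K
  open EllipticCurve K
  open NumberFieldProperties K
  open GroupLaw K
  open RingProperties ring
  open QuadraticBasis K hiding (SquareRoot; squareRoot)
  open QuadraticBasis.SquareRoot √d
  open Basis basis
  private module ι = IsRingHomomorphism ι-isRingHomomorphism

  IsRational : Carrier → Set ℓ
  IsRational x = ∃[ q ] x ≈ ι q

  rational-+ : ∀ {x y} → IsRational x → IsRational y → IsRational (x + y)
  rational-+ (p , x≈p) (q , y≈q) = p ℚ.+ q , sym (ι-+ {p} {q} (sym x≈p) (sym y≈q))

  rational-* : ∀ {x y} → IsRational x → IsRational y → IsRational (x * y)
  rational-* (p , x≈p) (q , y≈q) = p ℚ.* q , sym (ι-* {p} {q} (sym x≈p) (sym y≈q))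

  rational-neg : ∀ {x} → IsRational x → IsRational (- x)
  rational-neg (p , x≈p) = ℚ.- p , sym (ι-neg {p} (sym x≈p))

  rational-ιℤ : ∀ i → IsRational (ιℤ i)
  rational-ιℤ i = fromℤ i , ιℤ≈ι i

  rational-independent : ∀ {u v} → IsRational u → IsRational v → u + v * θ ≈ 0# → u ≈ 0# × v ≈ 0#
  rational-independent (p , u≈p) (q , v≈q) h =
    let p≡0 , q≡0 = independent p q (trans
          (+-cong (trans (*-identityʳ (ι p)) (sym u≈p)) (*-congʳ (sym v≈q))) h)
    in trans u≈p (trans (ι.⟦⟧-cong p≡0) ι.0#-homo) , trans v≈q (trans (ι.⟦⟧-cong q≡0) ι.0#-homo)

  re im : Carrier → Carrier
  re x = ι (proj₁ (spanning x))
  im x = ι (proj₁ (proj₂ (spanning x)))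

  re-rational : ∀ x → IsRational (re x)
  re-rational x = proj₁ (spanning x) , refl

  im-rational : ∀ x → IsRational (im x)
  im-rational x = proj₁ (proj₂ (spanning x)) , refl

  re+imθ : ∀ x → x ≈ re x + im x * θ
  re+imθ x = trans (proj₂ (proj₂ (spanning x))) (+-congʳ (*-identityʳ _))

  conj : Carrier → Carrier
  conj x = re x - im x * θ

  re-im-unique : ∀ {x u v} → IsRational u → IsRational v → x ≈ u + v * θ → re x ≈ u × im x ≈ v
  re-im-unique {x} {u} {v} ru rv x≈ =
    let re-u≈0 , im-v≈0 = rational-independent
          (rational-+ (re-rational x) (rational-neg ru)) (rational-+ (im-rational x) (rational-neg rv))
          (trans (solve 5 (λ r i u v t → (r :- u) :+ (i :- v) :* t := (r :+ i :* t) :- (u :+ v :* t))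
                   refl (re x) (im x) u v θ)
            (trans (+-cong (sym (re+imθ x)) (-‿cong (sym x≈))) (-‿inverseʳ x)))
    in x∙y⁻¹≈ε⇒x≈y _ _ re-u≈0 , x∙y⁻¹≈ε⇒x≈y _ _ im-v≈0
    where open Solver

  -- Any rational coordinates compute `conj`, not only those that `spanning` returns. The laws below
  -- exhibit suitable coordinates.
  conj-unique : ∀ {x u v} → IsRational u → IsRational v → x ≈ u + v * θ → conj x ≈ u - v * θ
  conj-unique ru rv x≈ = let re≈u , im≈v = re-im-unique ru rv x≈ in +-cong re≈u (-‿cong (*-congʳ im≈v))

  conj-cong : ∀ {x y} → x ≈ y → conj x ≈ conj y
  conj-cong {x} {y} x≈y = conj-unique (re-rational y) (im-rational y) (trans x≈y (re+imθ y))

  conj-rational : ∀ {x} → IsRational x → conj x ≈ x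
  conj-rational {x} rx = trans
    (conj-unique {v = ιℤ (+ 0)} rx (rational-ιℤ (+ 0)) (solve 2 (λ x t → x := x :+ con (+ 0) :* t) refl x θ))
    (solve 2 (λ x t → x :- con (+ 0) :* t := x) refl x θ)
    where open Solver

  conj-+ : ∀ x y → conj (x + y) ≈ conj x + conj y
  conj-+ x y = trans
    (conj-unique (rational-+ (re-rational x) (re-rational y)) (rational-+ (im-rational x) (im-rational y))
      (trans (+-cong (re+imθ x) (re+imθ y))
        (solve 5 (λ r i r′ i′ t → (r :+ i :* t) :+ (r′ :+ i′ :* t) := (r :+ r′) :+ (i :+ i′) :* t)
          refl (re x) (im x) (re y) (im y) θ)))
    (solve 5 (λ r i r′ i′ t → (r :+ r′) :- (i :+ i′) :* t := (r :- i :* t) :+ (r′ :- i′ :* t))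
      refl (re x) (im x) (re y) (im y) θ)
    where open Solver

  conj-* : ∀ x y → conj (x * y) ≈ conj x * conj y
  conj-* x y = trans
    (conj-unique
      (rational-+ (rational-* (re-rational x) (re-rational y))
                  (rational-* (rational-* (im-rational x) (im-rational y)) (d , refl)))
      (rational-+ (rational-* (re-rational x) (im-rational y)) (rational-* (im-rational x) (re-rational y)))
      (trans (*-cong (re+imθ x) (re+imθ y))
        (solve 6 (λ r i r′ i′ t d → (r :+ i :* t) :* (r′ :+ i′ :* t) :- ((r :* r′ :+ i :* i′ :* d) :+ (r :* i′ :+ i :* r′) :* t)
            := i :* i′ :* (t :* t :- d))
          refl (re x) (im x) (re y) (im y) θ (ι d)
         ⇐ _ ⊡ θ²≈d)))
    (solve 6 (λ r i r′ i′ t d → (r :* r′ :+ i :* i′ :* d) :- (r :* i′ :+ i :* r′) :* t :- (r :- i :* t) :* (r′ :- i′ :* t)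
        := (:- (i :* i′)) :* (t :* t :- d))
      refl (re x) (im x) (re y) (im y) θ (ι d)
     ⇐ _ ⊡ θ²≈d)
    where open Solver

  conj-neg : ∀ x → conj (- x) ≈ - conj x
  conj-neg x = +-inverseˡ-unique _ _ (trans (sym (conj-+ (- x) x))
    (trans (conj-cong (-‿inverseˡ x)) (trans (conj-rational (0ℚ , sym ι.0#-homo)) refl)))

  conj-involutive : ∀ x → conj (conj x) ≈ x
  conj-involutive x = trans
    (conj-unique {v = - im x} (re-rational x) (rational-neg (im-rational x))
      (solve 3 (λ r i t → r :- i :* t := r :+ (:- i) :* t) refl (re x) (im x) θ))
    (trans (solve 3 (λ r i t → r :- (:- i) :* t := r :+ i :* t) refl (re x) (im x) θ) (sym (re+imθ x)))
    where open Solver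

  conj-fixed⇒rational : ∀ {x} → conj x ≈ x → IsRational x
  conj-fixed⇒rational {x} h = proj₁ (re-rational x) , trans (re+imθ x)
      (trans (+-congˡ (trans (*-congʳ im≈0) (zeroˡ θ))) (+-identityʳ _))
    where
    open Solver
    im≈0 : im x ≈ 0#
    im≈0 = x*y≈0⇒y≈0 (ιℤ-≉0 {+ 2} λ ()) (proj₂ (rational-independent (0ℚ , sym ι.0#-homo)
      (rational-* (rational-ιℤ (+ 2)) (im-rational x))
      (trans (+-identityˡ _) (trans
        (solve 3 (λ r i t → con (+ 2) :* i :* t := (r :+ i :* t) :- (r :- i :* t)) refl (re x) (im x) θ)
        (trans (+-cong (trans (sym (re+imθ x)) (sym h)) refl) (-‿inverseʳ (conj x)))))))

  conjₚ : Point → Point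
  conjₚ 𝒪              = 𝒪
  conjₚ (affine x y e) = affine (conj x) (conj y) (begin
    conj y * conj y                      ≈⟨ conj-* y y ⟨
    conj (y * y)                         ≈⟨ conj-cong e ⟩
    conj (x * x * x + 1#)                ≈⟨ conj-+ (x * x * x) 1# ⟩
    conj (x * x * x) + conj 1#           ≈⟨ +-cong (trans (conj-* (x * x) x) (*-congʳ (conj-* x x)))
                                                   (conj-rational (1ℚ , sym ι.1#-homo)) ⟩
    conj x * conj x * conj x + 1#        ∎)
    where open import Relation.Binary.Reasoning.Setoid setoid

  conjₚ-cong : ∀ {P Q} → P ≈ₚ Q → conjₚ P ≈ₚ conjₚ Q
  conjₚ-cong 𝒪            = 𝒪
  conjₚ-cong (affine p q) = affine (conj-cong p) (conj-cong q)

  conj-minus : ∀ x y → conj (x - y) ≈ conj x - conj y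
  conj-minus x y = trans (conj-+ x (- y)) (+-congˡ (conj-neg y))

  -- Every condition in `IsSum` is a polynomial equation with rational coefficients, so it can be
  -- conjugated term by term; the conjugate of the slope is the new slope.
  conj-isSum : ∀ {P Q R} → IsSum P Q R → IsSum (conjₚ P) (conjₚ Q) (conjₚ R)
  conj-isSum (𝒪ˡ Q≈R)       = 𝒪ˡ (conjₚ-cong Q≈R)
  conj-isSum (𝒪ʳ P≈R)       = 𝒪ʳ (conjₚ-cong P≈R)
  conj-isSum (opposite x y) = opposite (conj-cong x) (trans (conj-cong y) (conj-neg _))
  conj-isSum (line m {x₁ = x₁} {y₁} {_} {x₂} {y₂} {_} {x₃} {y₃} (slope h k) hx hy) = line (conj m)
    (slope
      (trans (*-congˡ (sym (conj-minus x₂ x₁))) (trans (sym (conj-* m _)) (trans (conj-cong h) (conj-minus y₂ y₁))))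
      (trans (*-congˡ (sym (conj-+ y₁ y₂))) (trans (sym (conj-* m _)) (trans (conj-cong k)
        (trans (conj-+ _ _) (+-cong (trans (conj-+ _ _) (+-cong (conj-* x₁ x₁) (conj-* x₁ x₂))) (conj-* x₂ x₂)))))))
    (trans (conj-cong hx) (trans (conj-minus _ x₂) (+-congʳ (trans (conj-minus _ x₁) (+-congʳ (conj-* m m))))))
    (trans (conj-cong hy) (trans (conj-minus _ y₁) (+-congʳ (trans (conj-* m _) (*-congˡ (conj-minus x₁ x₃))))))

  conjₚ-⊕ : ∀ P Q → conjₚ (P ⊕ Q) ≈ₚ conjₚ P ⊕ conjₚ Q
  conjₚ-⊕ P Q = ≈ₚ-sym (isSum⇒⊕ (conj-isSum (⊕-isSum P Q)))

  conjₚ-⊖ : ∀ P → conjₚ (⊖ P) ≈ₚ ⊖ conjₚ P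
  conjₚ-⊖ 𝒪              = 𝒪
  conjₚ-⊖ (affine x y e) = affine refl (conj-neg y)

  conjₚ-involutive : ∀ P → conjₚ (conjₚ P) ≈ₚ P
  conjₚ-involutive 𝒪              = 𝒪
  conjₚ-involutive (affine x y e) = affine (conj-involutive x) (conj-involutive y)

  open Torsion ⊕-abelianGroup

  conjₚ-torsion : ∀ {P} → IsTorsion E[K] P → IsTorsion E[K] (conjₚ P)
  conjₚ-torsion {P} (n , n≢0 , nP≈𝒪) = n , n≢0 , ≈ₚ-trans (≈ₚ-sym (conjₚ-· n)) (conjₚ-cong nP≈𝒪)
    where
    conjₚ-· : ∀ n → conjₚ (n · P) ≈ₚ n · conjₚ P
    conjₚ-· zero    = 𝒪
    conjₚ-· (suc n) = ≈ₚ-trans (conjₚ-⊕ P (n · P)) (AbelianGroup.∙-congˡ ⊕-abelianGroup {conjₚ P} (conjₚ-· n))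

  -- ℤ is integrally closed: for x = m/n in lowest terms, m² = Nn² makes n a divisor of m².
  rational-square⇒integer : ∀ {x N} → IsRational x → x * x ≈ ιℤ N → ∃[ s ] x ≈ ιℤ s
  rational-square⇒integer {x} {N} (q@(ℚ.mkℚ m n-1 m⊥n) , x≈q) x²≈N = m , trans (sym (*-identityʳ x))
      (trans (*-congˡ (sym (trans (ιℤ.⟦⟧-cong (≡.cong +_ n≡1)) ιℤ.1#-homo))) xn≈m)
    where
    open Solver
    n = suc n-1
    xn≈m : x * ιℤ (+ n) ≈ ιℤ m
    xn≈m = trans (*-congʳ x≈q) (ι-↥↧ q)
    m²≡Nn² : m ℤ.* m ≡ N ℤ.* (+ n ℤ.* + n)
    m²≡Nn² = ιℤ-injective (begin
      ιℤ (m ℤ.* m)                              ≈⟨ ιℤ.*-homo m m ⟩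
      ιℤ m * ιℤ m                               ≈⟨ *-cong xn≈m xn≈m ⟨
      x * ιℤ (+ n) * (x * ιℤ (+ n))             ≈⟨ solve 2 (λ x n → x :* n :* (x :* n) := x :* x :* (n :* n)) refl x (ιℤ (+ n)) ⟩
      x * x * (ιℤ (+ n) * ιℤ (+ n))             ≈⟨ *-cong x²≈N (sym (ιℤ.*-homo (+ n) (+ n))) ⟩
      ιℤ N * ιℤ (+ n ℤ.* + n)                   ≈⟨ ιℤ.*-homo N (+ n ℤ.* + n) ⟨
      ιℤ (N ℤ.* (+ n ℤ.* + n))                  ∎)
      where open import Relation.Binary.Reasoning.Setoid setoid
    n≡1 : n ≡ 1
    n≡1 = coprime-∣-square⇒≡1 (ℕ.recompute m⊥n) (square-∣ m N n m²≡Nn²)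

  ¬rational-√-3 : ∀ {x} → x * x ≈ ιℤ (ℤ.- + 3) → ¬ IsRational x
  ¬rational-√-3 x²≈-3 rx = let s , x≈s = rational-square⇒integer rx x²≈-3 in
    ¬isSquare-3 (s , ιℤ-injective (trans (ιℤ.*-homo s s) (trans (*-cong (sym x≈s) (sym x≈s)) x²≈-3)))

  -- If d = a/b then vθ is a square root of -3 exactly when (av)² = -3ab.
  √-3? : Dec (∃[ z ] z * z ≈ ιℤ (ℤ.- + 3))
  √-3? = map′ to from (isSquare? (ℤ.- + 3 ℤ.* (a ℤ.* b)))
    where
    open Solver
    a = ℚ.↥ d
    b = ℚ.↧ d
    db≈a : ι d * ιℤ b ≈ ιℤ a
    db≈a = ι-↥↧ d
    -- If d vanished, then θ² = 0 and θ = 0, against the independence of 1 and θ.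
    a≉0 : ¬ (ιℤ a ≈ 0#)
    a≉0 a≈0 = θ≉0 (x*y≈0⇒y≈0 θ≉0 (trans θ²≈d d≈0))
      where
      θ≉0 : ¬ (θ ≈ 0#)
      θ≉0 θ≈0 = 0≉1 (sym (proj₂ (rational-independent (0ℚ , sym ι.0#-homo) (1ℚ , sym ι.1#-homo)
        (trans (+-identityˡ _) (trans (*-identityˡ θ) θ≈0)))))
      d≈0 : ι d ≈ 0#
      d≈0 = x*y≈0⇒y≈0 (ιℤ-≉0 {b} (λ ())) (trans (*-comm _ _) (trans db≈a a≈0))
    to : IsSquare (ℤ.- + 3 ℤ.* (a ℤ.* b)) → ∃[ z ] z * z ≈ ιℤ (ℤ.- + 3)
    to (s , s²≡) = z , *-cancelˡ-≉0 a²b≉0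
        (solve 7 (λ s a b a⁻¹ t d o →
            a :* a :* b :* (s :* a⁻¹ :* t :* (s :* a⁻¹ :* t)) :- a :* a :* b :* con (ℤ.- + 3)
            := (s :* s :* b :* t :* t :* (a⁻¹ :* a :+ o)) :* (a⁻¹ :* a :- o)
               :+ s :* s :* b :* t :* t :* (o :+ con (+ 1)) :* (o :- con (+ 1))
               :+ s :* s :* b :* (t :* t :- d)
               :+ s :* s :* (d :* b :- a)
               :+ a :* (s :* s :- con (ℤ.- + 3) :* (a :* b)))
          refl (ιℤ s) (ιℤ a) (ιℤ b) a⁻¹ θ (ι d) 1#
         ⇐ _ ⊡ a⁻¹a≈1 ⊞ _ ⊡ sym ιℤ.1#-homo ⊞ _ ⊡ θ²≈d ⊞ _ ⊡ db≈a ⊞ _ ⊡ s²≈)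
      where
      a⁻¹ = proj₁ (invertible (ιℤ a) a≉0)
      a⁻¹a≈1 = proj₁ (proj₂ (invertible (ιℤ a) a≉0))
      -- z² = s²d/a² = s²/(ab) = -3.
      z = ιℤ s * a⁻¹ * θ
      a²b≉0 = x*y≉0 (x*y≉0 a≉0 a≉0) (ιℤ-≉0 {b} (λ ()))
      s²≈ : ιℤ s * ιℤ s ≈ ιℤ (ℤ.- + 3) * (ιℤ a * ιℤ b)
      s²≈ = trans (sym (ιℤ.*-homo s s)) (trans (ιℤ.⟦⟧-cong s²≡)
        (trans (ιℤ.*-homo (ℤ.- + 3) (a ℤ.* b)) (*-congˡ (ιℤ.*-homo a b))))
    from : ∃[ z ] z * z ≈ ιℤ (ℤ.- + 3) → IsSquare (ℤ.- + 3 ℤ.* (a ℤ.* b))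
    from (z , z²≈-3) with u ≟ 0#
      where u = re z
    -- Now z = vθ, so av is a rational number whose square is the integer -3ab; hence av is itself
    -- an integer.
    ... | yes u≈0 = let s , av≈s = rational-square⇒integer (rational-* (rational-ιℤ a) (im-rational z)) av² in
        s , ιℤ-injective (trans (ιℤ.*-homo s s) (trans (*-cong (sym av≈s) (sym av≈s)) av²))
      where
      v = im z
      av² : ιℤ a * v * (ιℤ a * v) ≈ ιℤ (ℤ.- + 3 ℤ.* (a ℤ.* b))
      av² = trans
        (solve 7 (λ a b u v t d z → a :* v :* (a :* v) :- con (ℤ.- + 3) :* (a :* b)
            := (:- (a :* v :* v)) :* (d :* b :- a)
               :+ (:- (a :* b :* v :* v)) :* (t :* t :- d)
               :+ (:- (a :* b :* (z :+ v :* t))) :* (z :- (u :+ v :* t))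
               :+ (:- (a :* b :* (z :+ v :* t))) :* (u :- con (+ 0))
               :+ a :* b :* (z :* z :- con (ℤ.- + 3)))
          refl (ιℤ a) (ιℤ b) (re z) v θ (ι d) z
         ⇐ _ ⊡ db≈a ⊞ _ ⊡ θ²≈d ⊞ _ ⊡ re+imθ z ⊞ _ ⊡ trans u≈0 (sym ιℤ.0#-homo) ⊞ _ ⊡ z²≈-3)
        (sym (trans (ιℤ.*-homo (ℤ.- + 3) (a ℤ.* b)) (*-congˡ (ιℤ.*-homo a b))))
    -- The θ-coordinate 2uv of z² vanishes, so v = 0 and -3 = u² would be a rational square.
    ... | no  u≉0 = ⊥-elim (¬rational-√-3 u²≈-3 (re-rational z))
      where
      u = re z
      v = im z
      re² : u * u + v * v * ι d - ιℤ (ℤ.- + 3) ≈ 0# × ιℤ (+ 2) * (u * v) ≈ 0#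
      re² = rational-independent
        (rational-+ (rational-+ (rational-* (re-rational z) (re-rational z))
                                (rational-* (rational-* (im-rational z) (im-rational z)) (d , refl)))
                    (rational-neg (rational-ιℤ (ℤ.- + 3))))
        (rational-* (rational-ιℤ (+ 2)) (rational-* (re-rational z) (im-rational z)))
        (trans (solve 5 (λ u v t d z →
            (u :* u :+ v :* v :* d :- con (ℤ.- + 3)) :+ con (+ 2) :* (u :* v) :* t
            := con (+ 1) :* (z :* z :- con (ℤ.- + 3))
               :+ (:- (z :+ u :+ v :* t)) :* (z :- (u :+ v :* t))
               :+ (:- (v :* v)) :* (t :* t :- d))
          refl u v θ (ι d) z) (_ ⊡ z²≈-3 ⊞ _ ⊡ re+imθ z ⊞ _ ⊡ θ²≈d))
      v≈0 : v ≈ 0#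
      v≈0 = x*y≈0⇒y≈0 u≉0 (x*y≈0⇒y≈0 (ιℤ-≉0 {+ 2} λ ()) (proj₂ re²))
      u²≈-3 : u * u ≈ ιℤ (ℤ.- + 3)
      u²≈-3 = trans (sym (trans (+-congˡ (trans (*-congʳ (trans (*-congʳ v≈0) (zeroˡ v))) (zeroˡ _))) (+-identityʳ _)))
        (x∙y⁻¹≈ε⇒x≈y _ _ (proj₁ re²))

-- Descent along an involution

parity : ∀ t → ∃[ u ] (t ≡ u ℕ.* 2 ⊎ t ≡ 1 ℕ.+ u ℕ.* 2)
parity t with t ℕ.% 2 | ℕ.m%n<n t 2 | ℕ.m≡m%n+[m/n]*n t 2
... | 0           | _                   | eq = t ℕ./ 2 , inj₁ eq
... | 1           | _                   | eq = t ℕ./ 2 , inj₂ eq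
... | suc (suc _) | ℕ.s≤s (ℕ.s≤s ()) | _

module Descent {a ℓ} (G : AbelianGroup a ℓ) where
  open AbelianGroup G renaming (rawGroup to raw)
  open Torsion G
  open AbelianGroupProperties G
  open CommutativeSemigroupProperties commutativeSemigroup using (interchange)
  open SetoidReasoning setoid

  -- Pure group theory; σ will be conjugation and g the point G. On the curve `fixed` and `inverted`
  -- have one cause: σP = P and σP = -P both make the x-coordinate rational.
  module _ (σ : Carrier → Carrier)
           (σ-cong : ∀ {x y} → x ≈ y → σ x ≈ σ y)
           (σ-∙ : ∀ x y → σ (x ∙ y) ≈ σ x ∙ σ y)
           (σ-⁻¹ : ∀ x → σ (x ⁻¹) ≈ σ x ⁻¹)
           (σ-involutive : ∀ x → σ (σ x) ≈ x)
           (σ-torsion : ∀ {x} → IsTorsion raw x → IsTorsion raw (σ x))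
           (g : Carrier) (order : HasOrder g 6)
           (fixed    : ∀ {x} → IsTorsion raw x → σ x ≈ x → ∃[ r ] x ≈ r · g)
           (inverted : ∀ {x} → IsTorsion raw x → σ x ≈ x ⁻¹ → ∃[ r ] x ≈ r · g)
           (σ-g : σ g ≈ g)
           where

    σ-· : ∀ n → σ (n · g) ≈ n · g
    σ-· zero    = identityʳ-unique (σ ε) (σ ε) (trans (sym (σ-∙ ε ε)) (σ-cong (identityˡ ε)))
    σ-· (suc n) = trans (σ-∙ g (n · g)) (∙-cong σ-g (σ-· n))

    ·-6* : ∀ k → (k ℕ.* 6) · g ≈ ε
    ·-6* k = multiple≈ε k (proj₁ order)

    ·-double : ∀ {x r} → x ≈ r · g → x ∙ x ≈ (r ℕ.+ r) · g
    ·-double {x} {r} h = trans (∙-cong h h) (sym (×-homo-+ g r r))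

    sum-fixed : ∀ x → σ (x ∙ σ x) ≈ x ∙ σ x
    sum-fixed x = trans (σ-∙ x (σ x)) (trans (∙-congˡ (σ-involutive x)) (comm (σ x) x))

    difference-inverted : ∀ x → σ (x ∙ σ x ⁻¹) ≈ (x ∙ σ x ⁻¹) ⁻¹
    difference-inverted x = begin
      σ (x ∙ σ x ⁻¹)         ≈⟨ σ-∙ x (σ x ⁻¹) ⟩
      σ x ∙ σ (σ x ⁻¹)       ≈⟨ ∙-congˡ (trans (σ-⁻¹ (σ x)) (⁻¹-cong (σ-involutive x))) ⟩
      σ x ∙ x ⁻¹             ≈⟨ comm (σ x) (x ⁻¹) ⟩
      x ⁻¹ ∙ σ x             ≈⟨ ∙-congˡ (⁻¹-involutive (σ x)) ⟨
      x ⁻¹ ∙ (σ x ⁻¹) ⁻¹     ≈⟨ ⁻¹-∙-comm x (σ x ⁻¹) ⟩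
      (x ∙ σ x ⁻¹) ⁻¹        ∎

    sum∙difference : ∀ x → (x ∙ σ x) ∙ (x ∙ σ x ⁻¹) ≈ x ∙ x
    sum∙difference x = trans (interchange x (σ x) x (σ x ⁻¹))
      (trans (∙-congˡ (inverseʳ (σ x))) (identityʳ (x ∙ x)))

    -- The difference is both inverted and, as a multiple of g, fixed by σ.
    difference : ∀ {x} → IsTorsion raw x → ∃[ r ] x ∙ σ x ⁻¹ ≈ (r ℕ.* 3) · g
    difference {x} t = r′ , trans r-spec (×-congˡ r≡)
      where
      r = proj₁ (inverted (torsion-∙ t (torsion-⁻¹ (σ-torsion t))) (difference-inverted x))
      r-spec = proj₂ (inverted (torsion-∙ t (torsion-⁻¹ (σ-torsion t))) (difference-inverted x))
      2r·g≈ε : (2 ℕ.* r) · g ≈ ε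
      2r·g≈ε = begin
        (2 ℕ.* r) · g                       ≈⟨ ×-congˡ (≡.cong (r ℕ.+_) (ℕ.+-identityʳ r)) ⟩
        (r ℕ.+ r) · g                       ≈⟨ ·-double {r = r} r-spec ⟨
        (x ∙ σ x ⁻¹) ∙ (x ∙ σ x ⁻¹)         ≈⟨ ∙-congˡ (trans r-spec (trans (sym (σ-· r)) (trans (σ-cong (sym r-spec)) (difference-inverted x)))) ⟩
        (x ∙ σ x ⁻¹) ∙ (x ∙ σ x ⁻¹) ⁻¹      ≈⟨ inverseʳ _ ⟩
        ε                                   ∎
      3∣r : 3 ∣ r
      3∣r = ℕ.*-cancelˡ-∣ 2 (proj₂ order (2 ℕ.* r) 2r·g≈ε)
      r′ = _∣_.quotient 3∣r
      r≡ : r ≡ r′ ℕ.* 3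
      r≡ = _∣_.equality 3∣r

    -- Otherwise (2r + 3)g = 0, and 6 would divide the odd number 2r + 3.
    double≉3g : ∀ {x} r → x ≈ r · g → ¬ (x ∙ x ≈ 3 · g)
    double≉3g {x} r x≈ 2x≈3g = 2∤2r+3 (ℕ.∣-trans (divides 3 ≡.refl) (proj₂ order (r ℕ.+ r ℕ.+ 3) (begin
      (r ℕ.+ r ℕ.+ 3) · g       ≈⟨ ×-homo-+ g (r ℕ.+ r) 3 ⟩
      (r ℕ.+ r) · g ∙ 3 · g     ≈⟨ ∙-congʳ (trans (sym (·-double {r = r} x≈)) 2x≈3g) ⟩
      3 · g ∙ 3 · g             ≈⟨ ×-homo-+ g 3 3 ⟨
      6 · g                     ≈⟨ proj₁ order ⟩
      ε                         ∎)))
      where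
      2∤2r+3 : ¬ (2 ∣ r ℕ.+ r ℕ.+ 3)
      2∤2r+3 h with ℕ.∣m+n∣m⇒∣n h (divides r (≡.trans (≡.cong (r ℕ.+_) (≡.sym (ℕ.+-identityʳ r))) (ℕ.*-comm 2 r)))
      ... | divides (suc (suc _)) ()

    -- x - σx is 0 or 3g. If it is 0, x is fixed; if it is 3g, then x + σx = 2x - 3g = 0, and x is
    -- inverted. Either way x is a multiple of g, whose double has even coefficient.
    torsion-double≉3g : ∀ {x} → IsTorsion raw x → ¬ (x ∙ x ≈ 3 · g)
    torsion-double≉3g {x} t 2x≈3g = cases (difference t)
      where
      cases : ∃[ r ] x ∙ σ x ⁻¹ ≈ (r ℕ.* 3) · g → ⊥
      cases (r , diff≈) with parity r
      ... | u , inj₁ ≡.refl = let r′ , x≈ = fixed t (sym (x∙y⁻¹≈ε⇒x≈y x (σ x) diff≈ε)) in double≉3g r′ x≈ 2x≈3g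
        where
        diff≈ε : x ∙ σ x ⁻¹ ≈ ε
        diff≈ε = trans diff≈ (trans (×-congˡ (ℕ.*-assoc u 2 3)) (·-6* u))
      ... | u , inj₂ ≡.refl = let r′ , x≈ = inverted t (inverseʳ-unique x (σ x) x∙σx≈ε) in double≉3g r′ x≈ 2x≈3g
        where
        diff≈3g : x ∙ σ x ⁻¹ ≈ 3 · g
        diff≈3g = trans diff≈ (trans (×-congˡ (≡.cong (3 ℕ.+_) (ℕ.*-assoc u 2 3)))
          (trans (×-homo-+ g 3 (u ℕ.* 6)) (trans (∙-congˡ (·-6* u)) (identityʳ (3 · g)))))
        x∙σx≈ε : x ∙ σ x ≈ ε
        x∙σx≈ε = identityˡ-unique (x ∙ σ x) (3 · g) (trans (∙-congˡ (sym diff≈3g)) (trans (sum∙difference x) 2x≈3g))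

    translate-double : ∀ {x t} k → x ∙ x ≈ t · g → (x ∙ k · g) ∙ (x ∙ k · g) ≈ (t ℕ.+ (k ℕ.+ k)) · g
    translate-double {x} {t} k h = trans (interchange x (k · g) x (k · g))
      (trans (∙-cong h (sym (×-homo-+ g k k))) (sym (×-homo-+ g t (k ℕ.+ k))))

    -- Modulo 6 the coefficient 5k is -k, so that multiples of g stay natural.
    translate-back : ∀ x k → x ≈ (x ∙ k · g) ∙ (5 ℕ.* k) · g
    translate-back x k = sym (trans (assoc x (k · g) ((5 ℕ.* k) · g)) (trans (∙-congˡ (trans
      (sym (×-homo-+ g k (5 ℕ.* k))) (trans (×-congˡ (ℕ.*-comm 6 k)) (·-6* k)))) (identityʳ x)))

    double-multiple : ∀ {x} → IsTorsion raw x → ∃[ t ] x ∙ x ≈ t · g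
    double-multiple {x} tx =
      let s , sum≈ = fixed (torsion-∙ tx (σ-torsion tx)) (sum-fixed x) ; d , difference≈ = difference tx in
      s ℕ.+ d ℕ.* 3 , trans (sym (sum∙difference x)) (trans (∙-cong sum≈ difference≈) (sym (×-homo-+ g s (d ℕ.* 3))))

    -- 2x = tg. For t = 2u the element w = x - ug is killed by 2; an odd t is impossible, as a
    -- translate of x would double to 3g.
    torsion-decomposition : ∀ {x} → IsTorsion raw x → ∃[ w ] ∃[ r ] w ∙ w ≈ ε × x ≈ w ∙ r · g
    torsion-decomposition {x} tx = let t , 2x≈ = double-multiple tx in cases t 2x≈ (parity t)
      where
      even : ∀ u → u ℕ.* 2 ℕ.+ (5 ℕ.* u ℕ.+ 5 ℕ.* u) ≡ (2 ℕ.* u) ℕ.* 6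
      even = ℕSolver.solve-∀
      odd : ∀ u → 1 ℕ.+ u ℕ.* 2 ℕ.+ (5 ℕ.* u ℕ.+ 1 ℕ.+ (5 ℕ.* u ℕ.+ 1)) ≡ 3 ℕ.+ (2 ℕ.* u) ℕ.* 6
      odd = ℕSolver.solve-∀
      cases : ∀ t → x ∙ x ≈ t · g → ∃[ u ] (t ≡ u ℕ.* 2 ⊎ t ≡ 1 ℕ.+ u ℕ.* 2) →
              ∃[ w ] ∃[ r ] w ∙ w ≈ ε × x ≈ w ∙ r · g
      cases t 2x≈ (u , inj₁ t≡) = x ∙ k · g , 5 ℕ.* k , 2w≈ε , translate-back x k
        where
        k = 5 ℕ.* u
        2w≈ε = trans (translate-double {t = t} k 2x≈)
          (trans (×-congˡ (≡.trans (≡.cong (ℕ._+ (k ℕ.+ k)) t≡) (even u))) (·-6* (2 ℕ.* u)))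
      cases t 2x≈ (u , inj₂ t≡) = ⊥-elim (torsion-double≉3g
        (torsion-∙ tx (torsion-· k (6 , _ , proj₁ order)))
        (trans (translate-double {t = t} k 2x≈)
          (trans (×-congˡ (≡.trans (≡.cong (ℕ._+ (k ℕ.+ k)) t≡) (odd u)))
            (trans (×-homo-+ g 3 ((2 ℕ.* u) ℕ.* 6)) (trans (∙-congˡ (·-6* (2 ℕ.* u))) (identityʳ (3 · g)))))))
        -- This is 1 - u modulo 6, and 2u + 1 + 2(1 - u) = 3.
        where k = 5 ℕ.* u ℕ.+ 1

  module _ {g u t} (2g≈u : g ∙ g ≈ u) (g∙u≈t : g ∙ u ≈ t) (2t≈ε : t ∙ t ≈ ε) where

    2·g≈u : 2 · g ≈ u
    2·g≈u = trans (∙-congˡ (identityʳ g)) 2g≈u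

    3·g≈t : 3 · g ≈ t
    3·g≈t = trans (∙-congˡ 2·g≈u) g∙u≈t

    6·g≈ε : 6 · g ≈ ε
    6·g≈ε = trans (×-homo-+ g 3 3) (trans (∙-cong 3·g≈t 3·g≈t) 2t≈ε)

    4·g≈u⁻¹ : 4 · g ≈ u ⁻¹
    4·g≈u⁻¹ = inverseˡ-unique (4 · g) u (trans (∙-congˡ (sym 2·g≈u)) (trans (sym (×-homo-+ g 4 2)) 6·g≈ε))

    5·g≈g⁻¹ : 5 · g ≈ g ⁻¹
    5·g≈g⁻¹ = inverseˡ-unique (5 · g) g (trans (comm (5 · g) g) 6·g≈ε)

    -- The nonzero residues 1 to 5 give g, u, t, -u and -g, so three inequalities suffice.
    hasOrder-6 : ¬ (g ≈ ε) → ¬ (u ≈ ε) → ¬ (t ≈ ε) → HasOrder g 6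
    hasOrder-6 g≉ε u≉ε t≉ε = 6·g≈ε , λ k kg≈ε →
      ℕ.m%n≡0⇒n∣m k 6 (residue (ℕ.m%n<n k 6) (trans (sym (·-% k 6·g≈ε)) kg≈ε))
      where
      inverse≉ε : ∀ {x} → ¬ (x ≈ ε) → ¬ (x ⁻¹ ≈ ε)
      inverse≉ε {x} x≉ε h = x≉ε (trans (sym (⁻¹-involutive x)) (trans (⁻¹-cong h) ε⁻¹≈ε))
      residue : ∀ {r} → r ℕ.< 6 → r · g ≈ ε → r ≡ 0
      residue {0} _ _ = ≡.refl
      residue {1} _ h = ⊥-elim (g≉ε (trans (sym (identityʳ g)) h))
      residue {2} _ h = ⊥-elim (u≉ε (trans (sym 2·g≈u) h))
      residue {3} _ h = ⊥-elim (t≉ε (trans (sym 3·g≈t) h))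
      residue {4} _ h = ⊥-elim (inverse≉ε u≉ε (trans (sym 4·g≈u⁻¹) h))
      residue {5} _ h = ⊥-elim (inverse≉ε g≉ε (trans (sym 5·g≈g⁻¹) h))
      residue {suc (suc (suc (suc (suc (suc _)))))} (ℕ.s≤s (ℕ.s≤s (ℕ.s≤s (ℕ.s≤s (ℕ.s≤s (ℕ.s≤s ())))))) _

  -- In a relation kw + lg = 0 an odd k would give w = -lg, a multiple of g.
  independent-involution : ∀ {g w} → HasOrder g 6 → w ∙ w ≈ ε → ¬ (∃[ r ] w ≈ r · g) → Independent w 2 g 6
  independent-involution {g} {w} order 2w≈ε w∉⟨g⟩ = 2·w≈ε , proj₁ order , λ k l h → cases k l h (parity k)
    where
    2·w≈ε : 2 · w ≈ ε
    2·w≈ε = trans (∙-congˡ (identityʳ w)) 2w≈ε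
    cases : ∀ k l → k · w ∙ l · g ≈ ε → ∃[ u ] (k ≡ u ℕ.* 2 ⊎ k ≡ 1 ℕ.+ u ℕ.* 2) → 2 ∣ k × 6 ∣ l
    cases k l h (u , inj₁ ≡.refl) = divides u ≡.refl ,
      proj₂ order l (trans (sym (trans (∙-congʳ (multiple≈ε u 2·w≈ε)) (identityˡ (l · g)))) h)
    cases k l h (u , inj₂ ≡.refl) = ⊥-elim (w∉⟨g⟩ (5 ℕ.* l , (begin
      w                  ≈⟨ inverseˡ-unique w (l · g) (trans (∙-congʳ (sym (trans (∙-congˡ (multiple≈ε u 2·w≈ε)) (identityʳ w)))) h) ⟩
      (l · g) ⁻¹         ≈⟨ inverseʳ-unique (l · g) ((5 ℕ.* l) · g) (trans (sym (×-homo-+ g l (5 ℕ.* l)))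
                              (trans (×-congˡ (ℕ.*-comm 6 l)) (multiple≈ε l (proj₁ order)))) ⟨
      (5 ℕ.* l) · g      ∎)))

-- Classification of the torsion points

module Classification {c ℓ} (K : QuadraticField c ℓ) (√d : QuadraticBasis.SquareRoot K) where
  open NumberField K
  open DecidableEquality K
  open EllipticCurve K
  open NumberFieldProperties K
  open GroupLaw K
  open TwoAdic K
  open Conjugation K √d
  open RingProperties ring
  open Torsion ⊕-abelianGroup
  open Descent ⊕-abelianGroup
  open Solver
  private
    module E = AbelianGroup ⊕-abelianGroup
    module EP = AbelianGroupProperties ⊕-abelianGroup

  -1ℤ : ℤ
  -1ℤ = ℤ.- + 1

  onCurve : ∀ x y → ιℤ y * ιℤ y ≈ ιℤ x * ιℤ x * ιℤ x + ιℤ (+ 1) → ιℤ y ² ≈ ιℤ x ³ + 1#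
  onCurve x y h = trans h (+-congˡ ιℤ.1#-homo)

  opaque
    -- Opaque, so that multiples of G are identified through the equations below rather than by
    -- evaluating `_⊕_`.
    G 2G 3G : Point
    G  = affine (ιℤ (+ 2)) (ιℤ (+ 3)) (onCurve (+ 2) (+ 3)
           (solve 0 (con (+ 3) :* con (+ 3) := con (+ 2) :* con (+ 2) :* con (+ 2) :+ con (+ 1)) refl))
    2G = affine (ιℤ (+ 0)) (ιℤ (+ 1)) (onCurve (+ 0) (+ 1)
           (solve 0 (con (+ 1) :* con (+ 1) := con (+ 0) :* con (+ 0) :* con (+ 0) :+ con (+ 1)) refl))
    3G = affine (ιℤ -1ℤ) (ιℤ (+ 0)) (onCurve -1ℤ (+ 0)
           (solve 0 (con (+ 0) :* con (+ 0) := con -1ℤ :* con -1ℤ :* con -1ℤ :+ con (+ 1)) refl))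

    G⊕G≈2G : G ⊕ G ≈ₚ 2G
    -- The tangent at (2, 3) has slope 3·2²/(2·3) = 2.
    G⊕G≈2G = isSum⇒⊕ {G} {G} {2G} (line (ιℤ (+ 2))
      (slope (solve 0 (con (+ 2) :* (con (+ 2) :- con (+ 2)) := con (+ 3) :- con (+ 3)) refl)
             (solve 0 (con (+ 2) :* (con (+ 3) :+ con (+ 3))
                := con (+ 2) :* con (+ 2) :+ con (+ 2) :* con (+ 2) :+ con (+ 2) :* con (+ 2)) refl))
      (solve 0 (con (+ 0) := con (+ 2) :* con (+ 2) :- con (+ 2) :- con (+ 2)) refl)
      (solve 0 (con (+ 1) := con (+ 2) :* (con (+ 2) :- con (+ 0)) :- con (+ 3)) refl))

    G⊕2G≈3G : G ⊕ 2G ≈ₚ 3G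
    -- The line through (2, 3) and (0, 1) has slope 1.
    G⊕2G≈3G = isSum⇒⊕ {G} {2G} {3G} (line (ιℤ (+ 1))
      (slope (solve 0 (con (+ 1) :* (con (+ 0) :- con (+ 2)) := con (+ 1) :- con (+ 3)) refl)
             (solve 0 (con (+ 1) :* (con (+ 3) :+ con (+ 1))
                := con (+ 2) :* con (+ 2) :+ con (+ 2) :* con (+ 0) :+ con (+ 0) :* con (+ 0)) refl))
      (solve 0 (con -1ℤ := con (+ 1) :* con (+ 1) :- con (+ 2) :- con (+ 0)) refl)
      (solve 0 (con (+ 0) := con (+ 1) :* (con (+ 2) :- con -1ℤ) :- con (+ 3)) refl))

    3G⊕3G≈𝒪 : 3G ⊕ 3G ≈ₚ 𝒪
    3G⊕3G≈𝒪 = isSum⇒⊕ {3G} {3G} {𝒪} (opposite refl (solve 0 (con (+ 0) := :- con (+ 0)) refl))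

    G≉𝒪 : ¬ (G ≈ₚ 𝒪)
    G≉𝒪 ()

    2G≉𝒪 : ¬ (2G ≈ₚ 𝒪)
    2G≉𝒪 ()

    3G≉𝒪 : ¬ (3G ≈ₚ 𝒪)
    3G≉𝒪 ()

    conjₚ-G : conjₚ G ≈ₚ G
    conjₚ-G = affine (conj-rational (rational-ιℤ (+ 2))) (conj-rational (rational-ιℤ (+ 3)))

    ≈G : ∀ {x y e} → x ≈ ιℤ (+ 2) → y ≈ ιℤ (+ 3) → affine x y e ≈ₚ G
    ≈G = affine

    ≈⊖G : ∀ {x y e} → x ≈ ιℤ (+ 2) → y ≈ - ιℤ (+ 3) → affine x y e ≈ₚ ⊖ G
    ≈⊖G = affine

    ≈2G : ∀ {x y e} → x ≈ ιℤ (+ 0) → y ≈ ιℤ (+ 1) → affine x y e ≈ₚ 2G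
    ≈2G = affine

    ≈⊖2G : ∀ {x y e} → x ≈ ιℤ (+ 0) → y ≈ - ιℤ (+ 1) → affine x y e ≈ₚ ⊖ 2G
    ≈⊖2G = affine

    ≈3G : ∀ {x y e} → x ≈ ιℤ -1ℤ → y ≈ 0# → affine x y e ≈ₚ 3G
    ≈3G x≈ y≈ = affine x≈ (trans y≈ (sym ιℤ.0#-homo))

  2·G≈2G : 2 · G ≈ₚ 2G
  2·G≈2G = 2·g≈u {G} {2G} {3G} G⊕G≈2G G⊕2G≈3G 3G⊕3G≈𝒪

  3·G≈3G : 3 · G ≈ₚ 3G
  3·G≈3G = 3·g≈t {G} {2G} {3G} G⊕G≈2G G⊕2G≈3G 3G⊕3G≈𝒪

  4·G≈⊖2G : 4 · G ≈ₚ ⊖ 2G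
  4·G≈⊖2G = 4·g≈u⁻¹ {G} {2G} {3G} G⊕G≈2G G⊕2G≈3G 3G⊕3G≈𝒪

  5·G≈⊖G : 5 · G ≈ₚ ⊖ G
  5·G≈⊖G = 5·g≈g⁻¹ {G} {2G} {3G} G⊕G≈2G G⊕2G≈3G 3G⊕3G≈𝒪

  G-order : HasOrder G 6
  G-order = hasOrder-6 {G} {2G} {3G} G⊕G≈2G G⊕2G≈3G 3G⊕3G≈𝒪 G≉𝒪 2G≉𝒪 3G≉𝒪

  square-roots : ∀ {y s} → y * y ≈ s * s → y ≈ s ⊎ y ≈ - s
  square-roots {y} {s} h with y ≟ s
  ... | yes y≈s = inj₁ y≈s
  ... | no  y≉s = inj₂ (+-inverseˡ-unique y s (x*y≈0⇒y≈0 (λ d≈0 → y≉s (x∙y⁻¹≈ε⇒x≈y y s d≈0))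
      (trans (solve 2 (λ y s → (y :- s) :* (y :+ s) := y :* y :- s :* s) refl y s)
        (trans (+-congʳ h) (-‿inverseʳ (s * s))))))

  onCurve-at : ∀ {x y} a s → y ² ≈ x ³ + 1# → x ≈ ιℤ a →
               ιℤ a * ιℤ a * ιℤ a + ιℤ (+ 1) ≈ ιℤ s * ιℤ s → y ≈ ιℤ s ⊎ y ≈ - ιℤ s
  onCurve-at a s e x≈a h = square-roots
    (trans e (trans (+-cong (*-cong (*-cong x≈a x≈a) x≈a) (sym ιℤ.1#-homo)) h))

  -- The x-coordinates -1, 0 and 2 belong to 3G, ±2G and ±G: with 𝒪 these are all multiples of G.
  rational⇒multiple : ∀ {x y e} → IsTorsion E[K] (affine x y e) → IsRational x → ∃[ r ] affine x y e ≈ₚ r · G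
  rational⇒multiple {x} {y} {e} t (q , x≈q) = cases (torsion-rational-x {q = q} x≈q t)
    where
    cases : x ≈ ιℤ -1ℤ ⊎ x ≈ ιℤ (+ 0) ⊎ x ≈ ιℤ (+ 2) → ∃[ r ] affine x y e ≈ₚ r · G
    cases (inj₁ x≈-1) with onCurve-at -1ℤ (+ 0) e x≈-1
                             (solve 0 (con -1ℤ :* con -1ℤ :* con -1ℤ :+ con (+ 1) := con (+ 0) :* con (+ 0)) refl)
    ... | inj₁ y≈0  = 3 , E.trans {j = 3G} (≈3G x≈-1 (trans y≈0 ιℤ.0#-homo)) (E.sym 3·G≈3G)
    ... | inj₂ y≈-0 = 3 , E.trans {j = 3G} (≈3G x≈-1 (trans y≈-0 (trans (-‿cong ιℤ.0#-homo) -0#≈0#))) (E.sym 3·G≈3G)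
    cases (inj₂ (inj₁ x≈0)) with onCurve-at (+ 0) (+ 1) e x≈0
                             (solve 0 (con (+ 0) :* con (+ 0) :* con (+ 0) :+ con (+ 1) := con (+ 1) :* con (+ 1)) refl)
    ... | inj₁ y≈1  = 2 , E.trans {j = 2G} (≈2G x≈0 y≈1) (E.sym 2·G≈2G)
    ... | inj₂ y≈-1 = 4 , E.trans {j = ⊖ 2G} (≈⊖2G x≈0 y≈-1) (E.sym 4·G≈⊖2G)
    cases (inj₂ (inj₂ x≈2)) with onCurve-at (+ 2) (+ 3) e x≈2
                             (solve 0 (con (+ 2) :* con (+ 2) :* con (+ 2) :+ con (+ 1) := con (+ 3) :* con (+ 3)) refl)
    ... | inj₁ y≈3  = 1 , E.trans {j = G} (≈G x≈2 y≈3) (E.sym (E.identityʳ G))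
    ... | inj₂ y≈-3 = 5 , E.trans {j = ⊖ G} (≈⊖G x≈2 y≈-3) (E.sym 5·G≈⊖G)

  fixed⇒multiple : ∀ {P} → IsTorsion E[K] P → conjₚ P ≈ₚ P → ∃[ r ] P ≈ₚ r · G
  fixed⇒multiple {𝒪}            t _            = 0 , 𝒪
  fixed⇒multiple {affine x y e} t (affine h _) = rational⇒multiple t (conj-fixed⇒rational h)

  -- P and -P share their x-coordinate, so conjugation fixes it here too.
  inverted⇒multiple : ∀ {P} → IsTorsion E[K] P → conjₚ P ≈ₚ ⊖ P → ∃[ r ] P ≈ₚ r · G
  inverted⇒multiple {𝒪}            t _            = 0 , 𝒪
  inverted⇒multiple {affine x y e} t (affine h _) = rational⇒multiple t (conj-fixed⇒rational h)

  decomposition : ∀ {P} → IsTorsion E[K] P → ∃[ Q ] ∃[ r ] Q ⊕ Q ≈ₚ 𝒪 × P ≈ₚ Q ⊕ r · G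
  decomposition = torsion-decomposition conjₚ conjₚ-cong conjₚ-⊕ conjₚ-⊖ conjₚ-involutive conjₚ-torsion
    G G-order fixed⇒multiple inverted⇒multiple conjₚ-G

  -- The roots of x² - x + 1 are the primitive sixth roots of unity (1 ± √-3)/2; `root` therefore
  -- brings √-3 into K.
  data Involution (P : Point) : Set (c ⊔ ℓ) where
    isZero : P ≈ₚ 𝒪 → Involution P
    is3G   : P ≈ₚ 3G → Involution P
    root   : ∀ {x y e} → P ≈ₚ affine x y e → y ≈ 0# → x * x - x + ιℤ (+ 1) ≈ 0# → Involution P

  self-inverse⇒involution : ∀ {P} → P ≈ₚ ⊖ P → Involution P
  self-inverse⇒involution {𝒪}            _               = isZero 𝒪
  self-inverse⇒involution {affine x y e} (affine _ y≈-y) = cases (x ≟ ιℤ -1ℤ)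
    where
    y≈0 : y ≈ 0#
    y≈0 = x*y≈0⇒y≈0 (ιℤ-≉0 {+ 2} λ ()) (trans
      (solve 1 (λ y → con (+ 2) :* y := y :+ y) refl y) (trans (+-congʳ y≈-y) (-‿inverseˡ y)))
    cases : Dec (x ≈ ιℤ -1ℤ) → Involution (affine x y e)
    cases (yes x≈-1) = is3G (≈3G x≈-1 y≈0)
    cases (no  x≉-1) = root ≈ₚ-refl y≈0 (x*y≈0⇒y≈0 (λ h → x≉-1 (x∙y⁻¹≈ε⇒x≈y x (ιℤ -1ℤ) h))
      (trans (solve 1 (λ x → (x :- con -1ℤ) :* (x :* x :- x :+ con (+ 1)) := x :* x :* x :+ con (+ 1)) refl x)
        (trans (+-congˡ ιℤ.1#-homo) (trans (sym e) (trans (*-congʳ y≈0) (zeroˡ y))))))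

  involution : ∀ P → P ⊕ P ≈ₚ 𝒪 → Involution P
  involution P 2P≈𝒪 = self-inverse⇒involution (EP.inverseʳ-unique P P 2P≈𝒪)

  -- (2x - 1)² + 3 = 4(x² - x + 1).
  root⇒√-3 : ∀ {x} → x * x - x + ιℤ (+ 1) ≈ 0# →
             (ιℤ (+ 2) * x - ιℤ (+ 1)) * (ιℤ (+ 2) * x - ιℤ (+ 1)) ≈ ιℤ (ℤ.- + 3)
  root⇒√-3 {x} h = solve 1 (λ x →
      (con (+ 2) :* x :- con (+ 1)) :* (con (+ 2) :* x :- con (+ 1)) :- con (ℤ.- + 3)
      := con (+ 4) :* (x :* x :- x :+ con (+ 1) :- con (+ 0))) refl x
    ⇐ _ ⊡ trans h (sym ιℤ.0#-homo)

  E[K]tors = IsSubgroup.subgroup isTorsion-isSubgroup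

  cyclic : ¬ (∃[ z ] z * z ≈ ιℤ (ℤ.- + 3)) → E[K]tors ≅ ℤ/ 6 ℤ
  cyclic ∄√-3 = cyclic-≅ G-order λ P t → let Q , r , 2Q≈𝒪 , P≈ = decomposition t in multiple P Q r P≈ (involution Q 2Q≈𝒪)
    where
    multiple : ∀ P Q r → P ≈ₚ Q ⊕ r · G → Involution Q → ∃[ s ] P ≈ₚ s · G
    multiple P Q r P≈ (isZero Q≈𝒪) = r , E.trans P≈ (E.∙-congʳ {r · G} Q≈𝒪)
    multiple P Q r P≈ (is3G Q≈3G)  = 3 ℕ.+ r , E.trans P≈ (E.trans
      (E.∙-congʳ {r · G} (E.trans Q≈3G (E.sym 3·G≈3G))) (E.sym (×-homo-+ G 3 r)))
    multiple P Q r P≈ (root _ _ h) = ⊥-elim (∄√-3 (_ , root⇒√-3 h))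

  √-3⇒root : ∃[ z ] z * z ≈ ιℤ (ℤ.- + 3) → ∃[ x ] x * x - x + ιℤ (+ 1) ≈ 0#
  √-3⇒root (z , z²≈-3) = x , x*y≈0⇒y≈0 (ιℤ-≉0 {+ 4} λ ()) (trans
      (solve 2 (λ x z → con (+ 4) :* (x :* x :- x :+ con (+ 1)) :- con (+ 0)
          := (con (+ 2) :* x :+ z :- con (+ 1)) :* (con (+ 2) :* x :- (con (+ 1) :+ z))
             :+ con (+ 1) :* (z :* z :- con (ℤ.- + 3))) refl x z
        ⇐ _ ⊡ 2x≈1+z ⊞ _ ⊡ z²≈-3) ιℤ.0#-homo)
    where
    half = invertible (ιℤ (+ 2)) (ιℤ-≉0 λ ())
    x = proj₁ half * (ιℤ (+ 1) + z)
    2x≈1+z : ιℤ (+ 2) * x ≈ ιℤ (+ 1) + z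
    2x≈1+z = trans (sym (*-assoc _ _ _)) (trans (*-congʳ (proj₂ (proj₂ half))) (*-identityˡ _))

  module _ (ζ : Carrier) (ζ²-ζ+1≈0 : ζ * ζ - ζ + ιℤ (+ 1) ≈ 0#) where
    root-onCurve : ∀ x → x * x - x + ιℤ (+ 1) ≈ 0# → ιℤ (+ 0) ² ≈ x ³ + 1#
    root-onCurve x h = trans
      (solve 1 (λ x → con (+ 0) :* con (+ 0) :- (x :* x :* x :+ con (+ 1))
          := (:- (x :+ con (+ 1))) :* (x :* x :- x :+ con (+ 1) :- con (+ 0))) refl x
        ⇐ _ ⊡ trans h (sym ιℤ.0#-homo)) (+-congˡ ιℤ.1#-homo)

    1-ζ : Carrier
    1-ζ = ιℤ (+ 1) - ζ

    1-ζ-root : 1-ζ * 1-ζ - 1-ζ + ιℤ (+ 1) ≈ 0#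
    1-ζ-root = trans (solve 1 (λ x → let y = con (+ 1) :- x in y :* y :- y :+ con (+ 1) := x :* x :- x :+ con (+ 1)) refl ζ) ζ²-ζ+1≈0

    opaque
      unfolding G

      W W⊕3G : Point
      W    = affine ζ (ιℤ (+ 0)) (root-onCurve ζ ζ²-ζ+1≈0)
      W⊕3G = affine 1-ζ (ιℤ (+ 0)) (root-onCurve 1-ζ 1-ζ-root)

      W⊕W≈𝒪 : W ⊕ W ≈ₚ 𝒪
      W⊕W≈𝒪 = isSum⇒⊕ {W} {W} {𝒪} (opposite refl (solve 0 (con (+ 0) := :- con (+ 0)) refl))

      W⊕3G≈ : W ⊕ 3G ≈ₚ W⊕3G
      -- The three points of order two lie on the line y = 0, so the slope is 0.
      W⊕3G≈ = isSum⇒⊕ {W} {3G} {W⊕3G} (line (ιℤ (+ 0))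
        (slope (solve 1 (λ x → con (+ 0) :* (con -1ℤ :- x) := con (+ 0) :- con (+ 0)) refl ζ)
          (solve 1 (λ x → con (+ 0) :* (con (+ 0) :+ con (+ 0)) :- (x :* x :+ x :* con -1ℤ :+ con -1ℤ :* con -1ℤ)
              := con -1ℤ :* (x :* x :- x :+ con (+ 1) :- con (+ 0))) refl ζ
            ⇐ _ ⊡ trans ζ²-ζ+1≈0 (sym ιℤ.0#-homo)))
        (solve 1 (λ x → con (+ 1) :- x := con (+ 0) :* con (+ 0) :- x :- con -1ℤ) refl ζ)
        (solve 1 (λ x → con (+ 0) := con (+ 0) :* (x :- (con (+ 1) :- x)) :- con (+ 0)) refl ζ))

      ≈W : ∀ {x y e} → x ≈ ζ → y ≈ 0# → affine x y e ≈ₚ W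
      ≈W x≈ y≈ = affine x≈ (trans y≈ (sym ιℤ.0#-homo))

      ≈W⊕3G : ∀ {x y e} → x ≈ 1-ζ → y ≈ 0# → affine x y e ≈ₚ W⊕3G
      ≈W⊕3G x≈ y≈ = affine x≈ (trans y≈ (sym ιℤ.0#-homo))

      conjₚ-W : conjₚ W ≈ₚ W → conj ζ ≈ ζ
      conjₚ-W (affine h _) = h

    roots : ∀ {x} → x * x - x + ιℤ (+ 1) ≈ 0# → x ≈ ζ ⊎ x ≈ 1-ζ
    roots {x} h with x ≟ ζ
    ... | yes x≈ζ = inj₁ x≈ζ
    ... | no  x≉ζ = inj₂ (x∙y⁻¹≈ε⇒x≈y x 1-ζ (x*y≈0⇒y≈0 (λ d≈0 → x≉ζ (x∙y⁻¹≈ε⇒x≈y x ζ d≈0))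
      (trans (solve 2 (λ x y → (x :- y) :* (x :- (con (+ 1) :- y))
          := (x :* x :- x :+ con (+ 1)) :- (y :* y :- y :+ con (+ 1))) refl x ζ)
        (trans (+-cong h (-‿cong ζ²-ζ+1≈0)) (-‿inverseʳ 0#)))))

    multiples-fixed : ∀ r → conjₚ (r · G) ≈ₚ r · G
    multiples-fixed zero    = 𝒪
    multiples-fixed (suc r) = E.trans (conjₚ-⊕ G (r · G)) (E.∙-cong {conjₚ G} {G} conjₚ-G (multiples-fixed r))

    -- Conjugation fixes every multiple of G. It would fix ζ, and 2ζ - 1 would be a rational square
    -- root of -3.
    W∉⟨G⟩ : ¬ (∃[ r ] W ≈ₚ r · G)
    W∉⟨G⟩ (r , W≈rG) = ¬rational-√-3 (root⇒√-3 ζ²-ζ+1≈0)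
      (rational-+ (rational-* (rational-ιℤ (+ 2)) (conj-fixed⇒rational (conjₚ-W W-fixed)))
                  (rational-neg (rational-ιℤ (+ 1))))
      where
      W-fixed : conjₚ W ≈ₚ W
      W-fixed = E.trans (conjₚ-cong W≈rG) (E.trans (multiples-fixed r) (E.sym W≈rG))

    product : E[K]tors ≅ rawGroup (ℤ/ 2 ℤ) (ℤ/ 6 ℤ)
    product = product-≅ (independent-involution {G} {W} G-order W⊕W≈𝒪 W∉⟨G⟩)
      λ P t → let Q , r , 2Q≈𝒪 , P≈ = decomposition t in combination P Q r P≈ (involution Q 2Q≈𝒪)
      where
      combine : ∀ {P Q} r k l → P ≈ₚ Q ⊕ r · G → Q ≈ₚ k · W ⊕ l · G → ∃[ s ] P ≈ₚ proj₁ s · W ⊕ proj₂ s · G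
      combine {P} {Q} r k l P≈ Q≈ = (k , l ℕ.+ r) , E.trans P≈ (E.trans (E.∙-congʳ {r · G} Q≈)
        (E.trans (E.assoc (k · W) (l · G) (r · G)) (E.∙-congˡ {k · W} (E.sym (×-homo-+ G l r)))))
      combination : ∀ P Q r → P ≈ₚ Q ⊕ r · G → Involution Q → ∃[ s ] P ≈ₚ proj₁ s · W ⊕ proj₂ s · G
      combination P Q r P≈ (isZero Q≈𝒪) = combine r 0 0 P≈ Q≈𝒪
      combination P Q r P≈ (is3G Q≈3G)  = combine r 0 3 P≈ (E.trans Q≈3G (E.sym 3·G≈3G))
      combination P Q r P≈ (root {x} Q≈ y≈0 h) with roots h
      ... | inj₁ x≈ζ = combine r 1 0 P≈ (E.trans Q≈ (E.trans {j = W} (≈W x≈ζ y≈0)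
              (E.sym (E.trans (E.identityʳ (1 · W)) (E.identityʳ W)))))
      -- The other root 1 - ζ is the x-coordinate of W + 3G, hence the coefficients 1 and 3.
      ... | inj₂ x≈1-ζ = combine r 1 3 P≈ (E.trans Q≈ (E.trans {j = W⊕3G} (≈W⊕3G x≈1-ζ y≈0)
              (E.sym (E.trans (E.∙-cong {1 · W} {W} (E.identityʳ W) 3·G≈3G) W⊕3G≈))))

  classification : Dec (∃[ z ] z * z ≈ ιℤ (ℤ.- + 3)) →
    (E[K]tors ≅ ℤ/ 6 ℤ) ⊎ (E[K]tors ≅ ℤ/ 18 ℤ) ⊎ (E[K]tors ≅ rawGroup (ℤ/ 2 ℤ) (ℤ/ 6 ℤ))
  classification (no ∄√-3) = inj₁ (cyclic ∄√-3)
  classification (yes √-3) = let ζ , ζ-root = √-3⇒root √-3 in inj₂ (inj₂ (product ζ ζ-root))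

corollary3 : ∀ {c ℓ} (K : QuadraticField c ℓ) →
    let open EllipticCurve K in
    Σ (IsSubgroup E[K] (IsTorsion E[K])) λ isSubgroup →
    let E[K]tors = IsSubgroup.subgroup isSubgroup in
    (E[K]tors ≅ ℤ/ 6 ℤ)
    ⊎ (E[K]tors ≅ ℤ/ 18 ℤ)
    ⊎ (E[K]tors ≅ rawGroup (ℤ/ 2 ℤ) (ℤ/ 6 ℤ))
corollary3 K = Torsion.isTorsion-isSubgroup (GroupLaw.⊕-abelianGroup K) ,
  Classification.classification K √d (Conjugation.√-3? K √d)
  where √d = QuadraticBasis.squareRoot K
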